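{- Let $\phi:\mathbb{N}\to\mathbb{N}$ be weakly order-preserving and $\lambda,\mu$ partitions with $n$ parts such that $\phi(\lambda)=\mu$. Let $\mathrm{inc}(\lambda,\phi)$ be the lexicographically smallest $\zeta\in S_\lambda$ with $\phi(\zeta)=\mu$. Then at $q=1$, $E_{\mathrm{inc}(\lambda,\phi)}(\mathbf{x};1,t)$ is a symmetric-function multiple of $E_\mu(\mathbf{x};1,t)=F_\mu(\mathbf{x};1,t)$; that is, $E_{\mathrm{inc}(\lambda,\phi)}(\mathbf{x};1,t)/E_\mu(\mathbf{x};1,t)$ is symmetric in $x_1,\dots,x_n$.
   Context: $\phi$ is weakly order-preserving if $\phi(i)\le\phi(j)$ whenever $i\le j$; $\phi(\rho)=(\phi(\rho_1),\dots,\phi(\rho_n))$. $S_\lambda$ is the set of compositions rearranging $\lambda$. Operators: for $f\in\mathbb{Q}(q,t)[x_1,\dots,x_n]$, $s_if$ swaps $x_i,x_{i+1}$; $L_if=\frac{tx_i-x_{i+1}}{x_i-x_{i+1}}(f-s_if)$; $T_if=tf-L_if$; $T_i^{ -1}f=t^{ -1}f-t^{ -1}L_if$; $(\omega f)(x_1,\dots,x_n)=f(qx_n,x_1,\dots,x_{n-1})$; $Y_i=t^{ -(i-1)}T_i^{ -1}\cdots T_{n-1}^{ -1}\omega T_1\cdots T_{i-1}$. For a composition $\eta$, $y_i(\eta)=q^{\eta_i}t^{ -\#\{j>i:\eta_j\ge\eta_i\}-\#\{j<i:\eta_j>\eta_i\}}$. With $\eta^+$ the decreasing rearrangement, $\eta\le\nu$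 means $\eta^+\le\nu^+$ in dominance order, or $\eta^+=\nu^+$ and $\eta_1+\dots+\eta_i\le\nu_1+\dots+\nu_i$ for all $i$. $E_\eta(\mathbf{x};q,t)$ is the unique polynomial $\sum_{\zeta\le\eta}v_{\eta,\zeta}\mathbf{x}^\zeta$ with $v_{\eta,\eta}=1$ and $Y_iE_\eta=y_i(\eta)E_\eta$ for all $i$. The ASEP polynomial $F_\mu$ of the partition $\mu$ is by definition equal to $E_\mu$. -}

module Defs where

open import Data.Nat as ℕ using (ℕ; zero; suc; _≤_; _<_; _∸_; _≡ᵇ_; _<ᵇ_; _≤ᵇ_)
open import Data.Bool using (Bool; true; false; _∧_; if_then_else_)
open import Data.Rational as Q using (ℚ; 0ℚ; 1ℚ)
open import Data.Product using (_×_; _,_; Σ; ∃)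
open import Data.Sum using (_⊎_)
open import Data.Unit using (⊤)
open import Data.Empty using (⊥)
open import Data.Fin using (Fin; toℕ)
open import Data.List as L using (List; []; _∷_; _++_; allFin)
open import Data.Nat.ListAction using (sum)
open import Data.List.Relation.Unary.All using (All)
open import Data.List.Relation.Binary.Pointwise using (Pointwise)
open import Data.List.Relation.Binary.Permutation.Propositional using (_↭_)
open import Data.Vec as V using (Vec; []; _∷_; _∷ʳ_; replicate; lookup; toList)
open import Relation.Binary.PropositionalEquality using (_≡_)
open import Relation.Nullary using (¬_)

-- Polynomials in q, t, x₁,…,xₙ with rational coefficients.
-- A monomial q^a t^b x^v is (a , b , v); a polynomial is a finite list of
-- (coefficient , monomial) terms (not necessarily normalised); two
-- polynomials are equal when all their coefficients agree.

Mon : ℕ → Set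
Mon n = ℕ × ℕ × Vec ℕ n

Poly : ℕ → Set
Poly n = List (ℚ × Mon n)

vecEqᵇ : ∀ {n} → Vec ℕ n → Vec ℕ n → Bool
vecEqᵇ [] [] = true
vecEqᵇ (a ∷ v) (b ∷ w) = (a ≡ᵇ b) ∧ vecEqᵇ v w

monEqᵇ : ∀ {n} → Mon n → Mon n → Bool
monEqᵇ (a , b , v) (a' , b' , v') = (a ≡ᵇ a') ∧ ((b ≡ᵇ b') ∧ vecEqᵇ v v')

coeff : ∀ {n} → Poly n → Mon n → ℚ
coeff [] m = 0ℚ
coeff ((c , m') ∷ p) m = if monEqᵇ m' m then c Q.+ coeff p m else coeff p m

infix 4 _≈P_
_≈P_ : ∀ {n} → Poly n → Poly n → Set
p ≈P p' = ∀ m → coeff p m ≡ coeff p' m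

zeroP : ∀ {n} → Poly n
zeroP = []

zeros : ∀ {n} → Vec ℕ n
zeros = replicate _ 0

constP : ∀ {n} → ℚ → Poly n
constP c = (c , 0 , 0 , zeros) ∷ []

oneP : ∀ {n} → Poly n
oneP = constP 1ℚ

addP : ∀ {n} → Poly n → Poly n → Poly n
addP = _++_

negP : ∀ {n} → Poly n → Poly n
negP = L.map (λ { (c , m) → (Q.- c , m) })

subP : ∀ {n} → Poly n → Poly n → Poly n
subP p r = addP p (negP r)

mulMon : ∀ {n} → Mon n → Mon n → Mon n
mulMon (a , b , v) (a' , b' , v') = (a ℕ.+ a' , b ℕ.+ b' , V.zipWith ℕ._+_ v v')

mulP : ∀ {n} → Poly n → Poly n → Poly n
mulP p r = L.concatMap (λ { (c , m) → L.map (λ { (c' , m') → (c Q.* c' , mulMon m m') }) r }) p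

qPow tPow : ∀ {n} → ℕ → Poly n
qPow k = (1ℚ , k , 0 , zeros) ∷ []
tPow k = (1ℚ , 0 , k , zeros) ∷ []

tP : ∀ {n} → Poly n
tP = tPow 1

unitV : ∀ {n} → ℕ → Vec ℕ n
unitV {zero} _ = []
unitV {suc n} zero = 1 ∷ zeros
unitV {suc n} (suc k) = 0 ∷ unitV k

-- the variable x_j (1-based j)
xP : ∀ {n} → ℕ → Poly n
xP j = (1ℚ , 0 , 0 , unitV (j ∸ 1)) ∷ []

swapAt : ∀ {n} → ℕ → Vec ℕ n → Vec ℕ n
swapAt _ [] = []
swapAt zero (a ∷ []) = a ∷ []
swapAt zero (a ∷ b ∷ v) = b ∷ a ∷ v
swapAt (suc k) (a ∷ v) = a ∷ swapAt k v

-- s_j : swap x_j and x_{j+1} (1-based j)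
sP : ∀ {n} → ℕ → Poly n → Poly n
sP j = L.map (λ { (c , a , b , v) → (c , a , b , swapAt (j ∸ 1) v) })

-- ω f (x₁,…,xₙ) = f(q xₙ, x₁, …, x_{n-1}), on monomials:
-- x₁^{v₁}x₂^{v₂}…xₙ^{vₙ} ↦ (q xₙ)^{v₁} x₁^{v₂} … x_{n-1}^{vₙ}
ωMon : ∀ {n} → ℚ × Mon n → ℚ × Mon n
ωMon (c , a , b , []) = (c , a , b , [])
ωMon (c , a , b , (h ∷ w)) = (c , a ℕ.+ h , b , w ∷ʳ h)

ωP : ∀ {n} → Poly n → Poly n
ωP = L.map ωMon

-- specialisation q = 1
specP : ∀ {n} → Poly n → Poly n
specP = L.map (λ { (c , a , b , v) → (c , 0 , b , v) })

XFree : ∀ {n} → Poly n → Set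
XFree p = All (λ { (c , a , b , v) → v ≡ zeros }) p

xCoeff : ∀ {n} → Poly n → Vec ℕ n → Poly n
xCoeff p ζ = L.map (λ { (c , a , b , v) → (c , a , b , zeros) })
                   (L.filter (λ { (c , a , b , v) → Data.Bool._≟_ (vecEqᵇ v ζ) true }) p)
  where import Data.Bool

-- Rational functions num / den (den always nonzero in what follows);
-- equality by cross multiplication.

Frac : ℕ → Set
Frac n = Poly n × Poly n

infix 4 _≈F_
_≈F_ : ∀ {n} → Frac n → Frac n → Set
(a , b) ≈F (c , d) = mulP a d ≈P mulP c b

addF subF mulF divF : ∀ {n} → Frac n → Frac n → Frac n
addF (a , b) (c , d) = (addP (mulP a d) (mulP c b) , mulP b d)
subF (a , b) (c , d) = (subP (mulP a d) (mulP c b) , mulP b d)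
mulF (a , b) (c , d) = (mulP a c , mulP b d)
divF (a , b) (c , d) = (mulP a d , mulP b c)

sF : ∀ {n} → ℕ → Frac n → Frac n
sF j (a , b) = (sP j a , sP j b)

ωF : ∀ {n} → Frac n → Frac n
ωF (a , b) = (ωP a , ωP b)

specF : ∀ {n} → Frac n → Frac n
specF (a , b) = (specP a , specP b)

LF : ∀ {n} → ℕ → Frac n → Frac n
LF j f = mulF (subP (mulP tP (xP j)) (xP (suc j)) , subP (xP j) (xP (suc j)))
              (subF f (sF j f))

TF : ∀ {n} → ℕ → Frac n → Frac n
TF j f = subF (mulF (tP , oneP) f) (LF j f)

TinvF : ∀ {n} → ℕ → Frac n → Frac n
TinvF j f = mulF (oneP , tP) (subF f (LF j f))

Tup : ∀ {n} → ℕ → Frac n → Frac n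
Tup zero f = f
Tup (suc k) f = Tup k (TF (suc k) f)

TinvRange : ∀ {n} → ℕ → ℕ → Frac n → Frac n
TinvRange a zero f = f
TinvRange a (suc m) f = TinvF a (TinvRange (suc a) m f)

YF : ∀ {n} → ℕ → Frac n → Frac n
YF {n} i f = mulF (oneP , tPow (i ∸ 1)) (TinvRange i (n ∸ i) (ωF (Tup (i ∸ 1) f)))

countFin : ∀ {n} → (Fin n → Bool) → ℕ
countFin {n} P = L.foldr (λ j acc → if P j then suc acc else acc) 0 (allFin n)

yEig : ∀ {n} → Vec ℕ n → Fin n → Frac n
yEig {n} η i =
  ( qPow (lookup η i)
  , tPow (countFin (λ j → (toℕ i <ᵇ toℕ j) ∧ (lookup η i ≤ᵇ lookup η j))
          ℕ.+ countFin (λ j → (toℕ j <ᵇ toℕ i) ∧ (lookup η i <ᵇ lookup η j))) )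

insertDec : ℕ → List ℕ → List ℕ
insertDec a [] = a ∷ []
insertDec a (b ∷ l) = if b ≤ᵇ a then a ∷ b ∷ l else b ∷ insertDec a l

sortDec : List ℕ → List ℕ
sortDec = L.foldr insertDec []

_⁺ : ∀ {n} → Vec ℕ n → List ℕ
η ⁺ = sortDec (toList η)

psums : List ℕ → List ℕ
psums [] = []
psums (a ∷ l) = a ∷ L.map (a ℕ.+_) (psums l)

Dominated : List ℕ → List ℕ → Set
Dominated l r = sum l ≡ sum r × Pointwise _≤_ (psums l) (psums r)

_≤c_ : ∀ {n} → Vec ℕ n → Vec ℕ n → Set
ζ ≤c η = Dominated (ζ ⁺) (η ⁺)
       ⊎ (ζ ⁺ ≡ η ⁺ × Pointwise _≤_ (psums (toList ζ)) (psums (toList η)))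

-- (P , D) represents the polynomial P/D ∈ ℚ(q,t)[x], D ∈ ℚ[q,t] ∖ {0},
-- and it satisfies the defining properties of E_η.
IsE : ∀ {n} → Vec ℕ n → Frac n → Set
IsE {n} η (P , D) =
    XFree D
  × ¬ (D ≈P zeroP)
  × (∀ ζ → ¬ (ζ ≤c η) → xCoeff P ζ ≈P zeroP)
  × xCoeff P η ≈P D
  × (∀ (i : Fin n) → YF (suc (toℕ i)) (P , D) ≈F mulF (yEig η i) (P , D))

-- (P' , D') is another representation of the same element of ℚ(q,t)[x]
-- whose denominator does not vanish at q = 1
RegularAt1 : ∀ {n} → Frac n → Frac n → Set
RegularAt1 E E'@(P' , D') = XFree D' × E ≈F E' × ¬ (specP D' ≈P zeroP)

IsSymmetric : ∀ {n} → Frac n → Set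
IsSymmetric {n} f = ∀ j → 1 ≤ j → j < n → sF j f ≈F f

WeaklyOrderPreserving : (ℕ → ℕ) → Set
WeaklyOrderPreserving φ = ∀ i j → i ≤ j → φ i ≤ φ j

IsPartition : ∀ {n} → Vec ℕ n → Set
IsPartition {n} λ' = ∀ (i j : Fin n) → toℕ i ≤ toℕ j → lookup λ' j ≤ lookup λ' i

_∈S_ : ∀ {n} → Vec ℕ n → Vec ℕ n → Set
ζ ∈S λ' = toList ζ ↭ toList λ'

LexLeq : ∀ {n} → Vec ℕ n → Vec ℕ n → Set
LexLeq [] [] = ⊤
LexLeq (a ∷ v) (b ∷ w) = a < b ⊎ (a ≡ b × LexLeq v w)

IsInc : ∀ {n} → Vec ℕ n → (ℕ → ℕ) → Vec ℕ n → Vec ℕ n → Set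
IsInc λ' φ μ ζ =
    ζ ∈S λ'
  × V.map φ ζ ≡ μ
  × (∀ ζ' → ζ' ∈S λ' → V.map φ ζ' ≡ μ → LexLeq ζ ζ')

{-# OPTIONS --safe #-}
-- At q = 1 the Cherednik operators Y_i commute with multiplication by symmetric functions, and
-- E_inc and E_μ have the same eigenvalues there, because inc(λ, φ) and μ have the same rank word:
-- inc is increasing inside every block of constant φ-value.  So it suffices that each joint
-- eigenspace of the Y_i at q = 1 has dimension at most one over the symmetric functions.
-- For the eigenvalues of the constant 1 every eigenvector f is symmetric: (T_i - t) f has the
-- swapped eigenvalues and is T_i-antisymmetric, which triangularity of the Y_i excludes unless it
-- is 0.  Any other weight that occurs is carried to this one by operators that are injective and
-- linear over symmetric functions: intertwiners exchanging adjacent eigenvalues whose ratio is not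
-- t^{±1}, and x_1 ω^{-1}, which rotates the eigenvalues.
-- For regularity at q = 1, the intertwiners and x_1 ω^{-1} also build, for generic q, an eigenvector
-- whose leading coefficient survives q = 1; triangularity makes it unique up to scalars, since
-- the q-exponents of the eigenvalues recover η.
module Submission where

open import Defs
open import Algebra.Bundles using (CommutativeRing; RawRing)
open import Algebra.Structures using (IsCommutativeRing)
open import Relation.Binary.Structures using (IsEquivalence)
import Algebra.Solver.Ring as RingSolver
import Algebra.Solver.Ring.AlmostCommutativeRing as ACR
import Algebra.Properties.Ring as RingProps
import Algebra.Properties.Semiring.Mult.TCOptimised as SemiringMult
import Relation.Binary.Reasoning.Setoid as SetoidReasoning
open import Data.Bool using (Bool; true; false; _∧_; if_then_else_; T)
open import Data.Bool.Properties using (T-≡)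
open import Data.Empty using (⊥-elim)
open import Data.Fin using (Fin; toℕ; fromℕ<) renaming (zero to fzero; suc to fsuc)
import Data.Fin.Properties as Fₚ
open import Data.Integer as ℤ using (ℤ; -[1+_]; _⊖_)
import Data.Integer.Properties as ℤₚ
open import Data.List as L using (List; []; _∷_; _++_; _∷ʳ_; length)
import Data.List.Properties as Lₚ
open import Data.List.Membership.Propositional using (_∈_; _∉_)
open import Data.List.Relation.Unary.All as All using (All; []; _∷_)
import Data.List.Relation.Unary.All.Properties as Allₚ
open import Data.List.Relation.Unary.AllPairs using (AllPairs; []; _∷_)
open import Data.List.Relation.Unary.Linked using (Linked; []; [-]; _∷_)
open import Data.List.Relation.Unary.Linked.Properties using (Linked⇒AllPairs)
open import Data.List.Relation.Binary.Permutation.Propositional using (_↭_; prep; swap; ↭-refl; ↭-trans)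
open import Data.List.Relation.Unary.Any using (here; there)
open import Data.Maybe using (Maybe; just; nothing)
open import Data.Nat as ℕ using (ℕ; zero; suc; _≤_; _<_; z≤n; s≤s; _∸_; _≡ᵇ_; _<ᵇ_; _≤ᵇ_)
import Data.Nat.Properties as ℕₚ
open import Data.Nat.ListAction using (sum)
open import Data.Nat.ListAction.Properties using (sum-++)
import Data.Nat.Solver as ℕSolver
open import Data.Product using (_×_; _,_; ∃; proj₁; proj₂)
open import Data.Rational as Q using (ℚ; 0ℚ; 1ℚ)
import Data.Rational.Properties as Qₚ
open import Data.Sign as Sign using (Sign)
open import Data.Sum using (_⊎_; inj₁; inj₂)
open import Data.Unit using (⊤; tt)
open import Data.Vec as V using (Vec; []; _∷_; toList; lookup; map)
import Data.Vec.Properties as Vₚ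
open import Function using (_∘_; id; Equivalence)
open import Level using (0ℓ)
open import Relation.Binary.PropositionalEquality
  using (_≡_; _≢_; refl; sym; trans; cong; cong₂; subst; subst₂; module ≡-Reasoning)
open import Relation.Binary.Definitions using (Tri; tri<; tri≈; tri>)
open import Relation.Nullary using (¬_; Dec; yes; no)

-- A ring solver with integer coefficients

-- The obstacle is that an intertwiner stops being injective when its two eigenvalues differ by a
-- factor t, and the ranks 0, ..., n - 1 make this happen for r and r + 1. At q = 1 there is a way
-- around: there x₁ ω⁻¹ changes no eigenvalue but only rotates them, so that a letter of the rank
-- word can pass from one end to the other. The rank word of a partition consists of increasing
-- runs, one for each distinct part; its last run is emptied letter by letter into the run before
-- it, and no r ever crosses r + 1 or r - 1, until the word 0, 1, ..., n - 1 of the constant 1 is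
-- left. Up to the last part, fractions are avoided. Proportionality over the symmetric functions is
-- an equation a f = b g with symmetric a and b. The operators are kept polynomial: τ_i = t T_i⁻¹
-- replaces T_i⁻¹, t^(n-1) Y_i replaces Y_i, and x₁ ω⁻¹ is described by what ω makes of its values.
-- A parameter ε puts q^ε for q: ε = 1 serves existence and uniqueness for generic q, ε = 0 the
-- eigenspaces at q = 1, and the Hecke algebra identities are shared by both.

module IntegerSolver (R : CommutativeRing 0ℓ 0ℓ) where
  private
    open module R = CommutativeRing R hiding (zero; refl; sym; trans)
    open RingProps ring
    module M = SemiringMult semiring
    open SetoidReasoning setoid

    -- With this form of iterated addition `fromℕ 1` reduces to `1#`, so `1-homo` is reflexivity and
    -- `:1` in solver equations denotes the unit itself.
    fromℕ : ℕ → Carrier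
    fromℕ n = n M.× 1#

    fromℤ : ℤ → Carrier
    fromℤ (ℤ.+ n)  = fromℕ n
    fromℤ -[1+ n ] = - fromℕ (suc n)

    fromℕ-+ : ∀ m n → fromℕ (m ℕ.+ n) ≈ fromℕ m + fromℕ n
    fromℕ-+ m n = M.×-homo-+ 1# m n

    suc≈ : ∀ n → fromℕ (suc n) ≈ 1# + fromℕ n
    suc≈ n = fromℕ-+ 1 n

    cancel-1+ : ∀ x y → x - y ≈ (1# + x) - (1# + y)
    cancel-1+ x y = R.sym (begin
      (1# + x) - (1# + y) ≈⟨ +-congˡ (-‿+-comm 1# y) ⟨
      (1# + x) + (- 1# + - y) ≈⟨ +-congʳ (+-comm 1# x) ⟩
      (x + 1#) + (- 1# + - y) ≈⟨ +-assoc x 1# _ ⟩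
      x + (1# + (- 1# + - y)) ≈⟨ +-congˡ (+-assoc 1# (- 1#) (- y)) ⟨
      x + ((1# + - 1#) + - y) ≈⟨ +-congˡ (+-congʳ (-‿inverseʳ 1#)) ⟩
      x + (0# + - y) ≈⟨ +-congˡ (+-identityˡ (- y)) ⟩
      x - y ∎)

    from-⊖ : ∀ m n → fromℤ (m ⊖ n) ≈ fromℕ m - fromℕ n
    from-⊖ m zero = R.sym (R.trans (+-congˡ -0#≈0#) (+-identityʳ _))
    from-⊖ zero (suc n) = R.sym (+-identityˡ _)
    from-⊖ (suc m) (suc n) = begin
      fromℤ (suc m ⊖ suc n) ≡⟨ cong fromℤ (ℤₚ.[1+m]⊖[1+n]≡m⊖n m n) ⟩
      fromℤ (m ⊖ n) ≈⟨ from-⊖ m n ⟩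
      fromℕ m - fromℕ n ≈⟨ cancel-1+ _ _ ⟩
      (1# + fromℕ m) - (1# + fromℕ n) ≈⟨ +-cong (suc≈ m) (-‿cong (suc≈ n)) ⟨
      fromℕ (suc m) - fromℕ (suc n) ∎

    from-+ : ∀ i j → fromℤ (i ℤ.+ j) ≈ fromℤ i + fromℤ j
    from-+ (ℤ.+ m) (ℤ.+ n)   = fromℕ-+ m n
    from-+ (ℤ.+ m) -[1+ n ]  = from-⊖ m (suc n)
    from-+ -[1+ m ] (ℤ.+ n)  = R.trans (from-⊖ n (suc m)) (+-comm _ _)
    from-+ -[1+ m ] -[1+ n ] = begin
      - fromℕ (suc (suc (m ℕ.+ n))) ≡⟨ cong (λ k → - fromℕ (suc k)) (ℕₚ.+-suc m n) ⟨
      - fromℕ (suc m ℕ.+ suc n) ≈⟨ -‿cong (fromℕ-+ (suc m) (suc n)) ⟩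
      - (fromℕ (suc m) + fromℕ (suc n)) ≈⟨ -‿+-comm _ _ ⟨
      - fromℕ (suc m) - fromℕ (suc n) ∎

    from-neg : ∀ i → fromℤ (ℤ.- i) ≈ - fromℤ i
    from-neg (ℤ.+ zero)    = R.sym -0#≈0#
    from-neg (ℤ.+ (suc n)) = R.refl
    from-neg -[1+ n ]      = R.sym (-‿involutive _)

    from-neg◃ : ∀ n → fromℤ (Sign.- ℤ.◃ n) ≈ - fromℕ n
    from-neg◃ n = R.trans (reflexive (cong fromℤ (ℤₚ.-◃n≡-n n))) (from-neg (ℤ.+ n))

    from-pos◃ : ∀ n → fromℤ (Sign.+ ℤ.◃ n) ≈ fromℕ n
    from-pos◃ n = reflexive (cong fromℤ (ℤₚ.+◃n≡+n n))

    from-* : ∀ i j → fromℤ (i ℤ.* j) ≈ fromℤ i * fromℤ j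
    from-* (ℤ.+ m) (ℤ.+ n)   = R.trans (from-pos◃ (m ℕ.* n)) (M.×1-homo-* m n)
    from-* (ℤ.+ m) -[1+ n ]  = R.trans (from-neg◃ (m ℕ.* suc n))
      (R.trans (-‿cong (M.×1-homo-* m (suc n))) (-‿distribʳ-* _ _))
    from-* -[1+ m ] (ℤ.+ n)  = R.trans (from-neg◃ (suc m ℕ.* n))
      (R.trans (-‿cong (M.×1-homo-* (suc m) n)) (-‿distribˡ-* _ _))
    from-* -[1+ m ] -[1+ n ] = R.trans (from-pos◃ (suc m ℕ.* suc n)) (R.trans (M.×1-homo-* (suc m) (suc n))
      (R.trans (R.sym (-‿involutive _)) (R.trans (-‿cong (-‿distribˡ-* _ _)) (-‿distribʳ-* _ _))))

    ℤ-rawRing : RawRing 0ℓ 0ℓ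
    ℤ-rawRing = record { _≈_ = _≡_ ; _+_ = ℤ._+_ ; _*_ = ℤ._*_ ; -_ = ℤ.-_ ; 0# = ℤ.0ℤ ; 1# = ℤ.1ℤ }

    target : ACR.AlmostCommutativeRing 0ℓ 0ℓ
    target = ACR.fromCommutativeRing R

    morphism : ℤ-rawRing ACR.-Raw-AlmostCommutative⟶ target
    morphism = record { ⟦_⟧ = fromℤ ; +-homo = from-+ ; *-homo = from-* ; -‿homo = from-neg
                      ; 0-homo = R.refl ; 1-homo = R.refl }

    coeff≟ : ∀ i j → Maybe (fromℤ i ≈ fromℤ j)
    coeff≟ i j with i ℤₚ.≟ j
    ... | yes i≡j = just (reflexive (cong fromℤ i≡j))
    ... | no _    = nothing

  open RingSolver ℤ-rawRing target morphism coeff≟ public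
    using (solve; Polynomial; con; _:+_; _:*_; :-_; _:-_; _:=_)

  :0 :1 : ∀ {k} → Polynomial k
  :0 = con ℤ.0ℤ
  :1 = con ℤ.1ℤ

-- The polynomial ring ℚ[q, t, x₁, …, xₙ]

pair : ∀ {n} → Poly n → (Mon n → ℚ) → ℚ
pair []            F = 0ℚ
pair ((c , m) ∷ p) F = c Q.* F m Q.+ pair p F

infix 4 _≋_
-- Lists of terms are not normalised, so equality is tested against every linear functional, given
-- by its values F on monomials. Ring laws and substitutions then become manipulations of F without
-- normal forms. The record keeps p and r recoverable by unification.
record _≋_ {n} (p r : Poly n) : Set where
  constructor mk≋
  field pair≡ : ∀ F → pair p F ≡ pair r F
open _≋_ public

module _ {n : ℕ} where
  open ≡-Reasoning

  private
    +-interchange : ∀ a b c d → (a Q.+ b) Q.+ (c Q.+ d) ≡ (a Q.+ c) Q.+ (b Q.+ d)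
    +-interchange a b c d = begin
      (a Q.+ b) Q.+ (c Q.+ d) ≡⟨ Qₚ.+-assoc a b _ ⟩
      a Q.+ (b Q.+ (c Q.+ d)) ≡⟨ cong (a Q.+_) (Qₚ.+-assoc b c d) ⟨
      a Q.+ ((b Q.+ c) Q.+ d) ≡⟨ cong (λ e → a Q.+ (e Q.+ d)) (Qₚ.+-comm b c) ⟩
      a Q.+ ((c Q.+ b) Q.+ d) ≡⟨ cong (a Q.+_) (Qₚ.+-assoc c b d) ⟩
      a Q.+ (c Q.+ (b Q.+ d)) ≡⟨ Qₚ.+-assoc a c _ ⟨
      (a Q.+ c) Q.+ (b Q.+ d) ∎

    *-swap : ∀ a b c → a Q.* (b Q.* c) ≡ b Q.* (a Q.* c)
    *-swap a b c = trans (sym (Qₚ.*-assoc a b c)) (trans (cong (Q._* c) (Qₚ.*-comm a b)) (Qₚ.*-assoc b a c))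

  pair-cong : ∀ (p : Poly n) {F G} → (∀ m → F m ≡ G m) → pair p F ≡ pair p G
  pair-cong [] F≡G = refl
  pair-cong ((c , m) ∷ p) F≡G = cong₂ Q._+_ (cong (c Q.*_) (F≡G m)) (pair-cong p F≡G)

  pair-++ : ∀ (p r : Poly n) F → pair (p ++ r) F ≡ pair p F Q.+ pair r F
  pair-++ [] r F = sym (Qₚ.+-identityˡ _)
  pair-++ ((c , m) ∷ p) r F = trans (cong (c Q.* F m Q.+_) (pair-++ p r F)) (sym (Qₚ.+-assoc (c Q.* F m) _ _))

  pair-0 : ∀ (p : Poly n) → pair p (λ _ → 0ℚ) ≡ 0ℚ
  pair-0 [] = refl
  pair-0 ((c , m) ∷ p) = trans (cong₂ Q._+_ (Qₚ.*-zeroʳ c) (pair-0 p)) (Qₚ.+-identityˡ 0ℚ)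

  pair-+ : ∀ (p : Poly n) F G → pair p (λ m → F m Q.+ G m) ≡ pair p F Q.+ pair p G
  pair-+ [] F G = refl
  pair-+ ((c , m) ∷ p) F G = trans (cong₂ Q._+_ (Qₚ.*-distribˡ-+ c _ _) (pair-+ p F G))
                                   (+-interchange (c Q.* F m) (c Q.* G m) (pair p F) (pair p G))

  pair-* : ∀ (p : Poly n) c F → pair p (λ m → c Q.* F m) ≡ c Q.* pair p F
  pair-* [] c F = sym (Qₚ.*-zeroʳ c)
  pair-* ((d , m) ∷ p) c F = trans (cong₂ Q._+_ (*-swap d c (F m)) (pair-* p c F))
                                   (sym (Qₚ.*-distribˡ-+ c (d Q.* F m) (pair p F)))

  pair-map : ∀ {k} (h : ℚ × Mon n → ℚ × Mon k) g → (∀ c m → h (c , m) ≡ (c , g m)) →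
             ∀ p F → pair (L.map h p) F ≡ pair p (F ∘ g)
  pair-map h g h≡ [] F = refl
  pair-map h g h≡ ((c , m) ∷ p) F rewrite h≡ c m = cong (c Q.* F (g m) Q.+_) (pair-map h g h≡ p F)

  pair-scale : ∀ d (h : ℚ × Mon n → ℚ × Mon n) g → (∀ c m → h (c , m) ≡ (d Q.* c , g m)) →
               ∀ p F → pair (L.map h p) F ≡ d Q.* pair p (F ∘ g)
  pair-scale d h g h≡ [] F = sym (Qₚ.*-zeroʳ d)
  pair-scale d h g h≡ ((c , m) ∷ p) F rewrite h≡ c m =
    trans (cong₂ Q._+_ (Qₚ.*-assoc d c (F (g m))) (pair-scale d h g h≡ p F))
          (sym (Qₚ.*-distribˡ-+ d (c Q.* F (g m)) (pair p (F ∘ g))))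

  pair-neg : ∀ (p : Poly n) F → pair (negP p) F ≡ Q.- pair p F
  pair-neg [] F = refl
  pair-neg ((c , m) ∷ p) F = trans (cong₂ Q._+_ (sym (Qₚ.neg-distribˡ-* c (F m))) (pair-neg p F))
                                   (sym (Qₚ.neg-distrib-+ (c Q.* F m) (pair p F)))

  pair-mul : ∀ (p r : Poly n) F → pair (mulP p r) F ≡ pair p (λ m → pair r (λ m' → F (mulMon m m')))
  pair-mul [] r F = refl
  pair-mul ((c , m) ∷ p) r F = trans (pair-++ (L.map _ r) (mulP p r) F)
    (cong₂ Q._+_ (pair-scale c _ (mulMon m) (λ _ _ → refl) r F) (pair-mul p r F))

  pair-swap : ∀ {k} (p : Poly n) (r : Poly k) (G : Mon n → Mon k → ℚ) →
              pair p (λ m → pair r (λ m' → G m m')) ≡ pair r (λ m' → pair p (λ m → G m m'))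
  pair-swap [] r G = sym (go r)
    where go : ∀ {k} (r : Poly k) → pair r (λ _ → 0ℚ) ≡ 0ℚ
          go [] = refl
          go ((c , m) ∷ r) = trans (cong₂ Q._+_ (Qₚ.*-zeroʳ c) (go r)) (Qₚ.+-identityˡ 0ℚ)
  pair-swap ((c , m) ∷ p) r G = trans (cong (c Q.* pair r (G m) Q.+_) (pair-swap p r G)) (go r)
    where go : ∀ {k} (r : Poly k) {H K : Mon k → ℚ} → c Q.* pair r H Q.+ pair r K ≡ pair r (λ m' → c Q.* H m' Q.+ K m')
          go [] = trans (cong (Q._+ 0ℚ) (Qₚ.*-zeroʳ c)) refl
          go ((d , m) ∷ r) {H} {K} = begin
            c Q.* (d Q.* H m Q.+ pair r H) Q.+ (d Q.* K m Q.+ pair r K)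
              ≡⟨ cong (Q._+ _) (Qₚ.*-distribˡ-+ c (d Q.* H m) (pair r H)) ⟩
            (c Q.* (d Q.* H m) Q.+ c Q.* pair r H) Q.+ (d Q.* K m Q.+ pair r K)
              ≡⟨ +-interchange (c Q.* (d Q.* H m)) (c Q.* pair r H) (d Q.* K m) (pair r K) ⟩
            (c Q.* (d Q.* H m) Q.+ d Q.* K m) Q.+ (c Q.* pair r H Q.+ pair r K)
              ≡⟨ cong₂ Q._+_ (cong (Q._+ d Q.* K m) (*-swap c d (H m))) (go r) ⟩
            (d Q.* (c Q.* H m) Q.+ d Q.* K m) Q.+ pair r (λ m' → c Q.* H m' Q.+ K m')
              ≡⟨ cong (Q._+ _) (Qₚ.*-distribˡ-+ d (c Q.* H m) (K m)) ⟨
            d Q.* (c Q.* H m Q.+ K m) Q.+ pair r (λ m' → c Q.* H m' Q.+ K m') ∎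

  mulMon-comm : ∀ (m k : Mon n) → mulMon m k ≡ mulMon k m
  mulMon-comm (a , b , v) (a' , b' , v') =
    cong₂ _,_ (ℕₚ.+-comm a a') (cong₂ _,_ (ℕₚ.+-comm b b') (Vₚ.zipWith-comm ℕₚ.+-comm v v'))

  mulMon-assoc : ∀ (m k l : Mon n) → mulMon (mulMon m k) l ≡ mulMon m (mulMon k l)
  mulMon-assoc (a , b , v) (a' , b' , v') (a'' , b'' , v'') =
    cong₂ _,_ (ℕₚ.+-assoc a a' a'') (cong₂ _,_ (ℕₚ.+-assoc b b' b'') (Vₚ.zipWith-assoc ℕₚ.+-assoc v v' v''))

  mulMon-identityˡ : ∀ (m : Mon n) → mulMon (0 , 0 , zeros) m ≡ m
  mulMon-identityˡ (a , b , v) = cong (λ w → a , b , w) (Vₚ.zipWith-identityˡ ℕₚ.+-identityˡ v)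

opaque
  infixl 6 _⊕_
  infixl 7 _⊗_
  infix  8 ⊟_
  -- Opaque copies of the operations on lists, so that unification sees ring expressions and does
  -- not unfold them.
  _⊕_ _⊗_ : ∀ {n} → Poly n → Poly n → Poly n
  p ⊕ r = addP p r
  p ⊗ r = mulP p r
  ⊟_ : ∀ {n} → Poly n → Poly n
  ⊟ p = negP p
  0p 1p : ∀ {n} → Poly n
  0p = zeroP
  1p = oneP

  ≋-isCommutativeRing : ∀ n → IsCommutativeRing (_≋_ {n}) _⊕_ _⊗_ ⊟_ 0p 1p
  ≋-isCommutativeRing n = record
      { isRing = record
        { +-isAbelianGroup = record
          { isGroup = record
            { isMonoid = record
              { isSemigroup = record
                { isMagma = record { isEquivalence = ≋-equiv ; ∙-cong = λ {p} {r} {s} {u} → +-cng {p} {r} {s} {u} }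
                ; assoc = λ p r s → mk≋ λ F → cong (λ z → pair z F) (Lₚ.++-assoc p r s) }
              ; identity = (λ p → mk≋ λ F → refl) , λ p → mk≋ λ F → cong (λ z → pair z F) (Lₚ.++-identityʳ p) }
            ; inverse = (λ p → mk≋ λ F → trans (pair-++ (negP p) p F)
                          (trans (cong (Q._+ pair p F) (pair-neg p F)) (Qₚ.+-inverseˡ (pair p F))))
                      , (λ p → mk≋ λ F → trans (pair-++ p (negP p) F)
                          (trans (cong (pair p F Q.+_) (pair-neg p F)) (Qₚ.+-inverseʳ (pair p F))))
            ; ⁻¹-cong = λ {p} {r} e → mk≋ λ F →
                trans (pair-neg p F) (trans (cong Q.-_ (pair≡ e F)) (sym (pair-neg r F))) }
          ; comm = λ p r → mk≋ λ F → trans (pair-++ p r F) (trans (Qₚ.+-comm (pair p F) (pair r F)) (sym (pair-++ r p F))) }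
        ; *-cong = λ {p} {r} {s} {u} → *-cng {p} {r} {s} {u}
        ; *-assoc = λ p r s → mk≋ λ F → begin
            pair (mulP (mulP p r) s) F ≡⟨ pair-mul (mulP p r) s F ⟩
            pair (mulP p r) (λ a → pair s (λ b → F (mulMon a b))) ≡⟨ pair-mul p r _ ⟩
            pair p (λ a → pair r (λ b → pair s (λ c → F (mulMon (mulMon a b) c))))
              ≡⟨ pair-cong p (λ a → pair-cong r (λ b → pair-cong s (λ c → cong F (mulMon-assoc a b c)))) ⟩
            pair p (λ a → pair r (λ b → pair s (λ c → F (mulMon a (mulMon b c)))))
              ≡⟨ pair-cong p (λ a → pair-mul r s _) ⟨
            pair p (λ a → pair (mulP r s) (λ b → F (mulMon a b))) ≡⟨ pair-mul p (mulP r s) F ⟨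
            pair (mulP p (mulP r s)) F ∎
        ; *-identity = idˡ , λ p → mk≋ λ F → trans (pair≡ (*-cm p oneP) F) (pair≡ (idˡ p) F)
        ; distrib = dl , λ p r s → mk≋ λ F → trans (pair≡ (*-cm (addP r s) p) F)
            (trans (pair≡ (dl p r s) F) (pair≡ (+-cng {mulP p r} {mulP r p} {mulP p s} {mulP s p} (*-cm p r) (*-cm p s)) F)) }
      ; *-comm = *-cm }
    where
    open ≡-Reasoning
    ≋-equiv : IsEquivalence (_≋_ {n})
    ≋-equiv = record { refl = mk≋ λ F → refl ; sym = λ e → mk≋ λ F → sym (pair≡ e F)
                     ; trans = λ e f → mk≋ λ F → trans (pair≡ e F) (pair≡ f F) }
    +-cng : ∀ {p r s u : Poly n} → p ≋ r → s ≋ u → addP p s ≋ addP r u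
    +-cng {p} {r} {s} {u} e f = mk≋ λ F →
      trans (pair-++ p s F) (trans (cong₂ Q._+_ (pair≡ e F) (pair≡ f F)) (sym (pair-++ r u F)))
    *-cng : ∀ {p r s u : Poly n} → p ≋ r → s ≋ u → mulP p s ≋ mulP r u
    *-cng {p} {r} {s} {u} e f = mk≋ λ F → trans (pair-mul p s F)
      (trans (pair≡ e _) (trans (pair-cong r (λ m → pair≡ f _)) (sym (pair-mul r u F))))
    *-cm : ∀ (p r : Poly n) → mulP p r ≋ mulP r p
    *-cm p r = mk≋ λ F → trans (pair-mul p r F) (trans (pair-swap p r _)
      (trans (pair-cong r (λ m' → pair-cong p (λ m → cong F (mulMon-comm m m')))) (sym (pair-mul r p F))))
    idˡ : ∀ (p : Poly n) → mulP oneP p ≋ p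
    idˡ p = mk≋ λ F → trans (pair-mul oneP p F) (trans (Qₚ.+-identityʳ _) (trans (Qₚ.*-identityˡ _)
      (pair-cong p (λ m → cong F (mulMon-identityˡ m)))))
    dl : ∀ (p r s : Poly n) → mulP p (addP r s) ≋ addP (mulP p r) (mulP p s)
    dl p r s = mk≋ λ F → trans (pair-mul p (addP r s) F) (trans (pair-cong p (λ m → pair-++ r s _))
      (trans (pair-+ p _ _) (sym (trans (pair-++ (mulP p r) (mulP p s) F) (cong₂ Q._+_ (pair-mul p r F) (pair-mul p s F))))))

PolyRing : ℕ → CommutativeRing 0ℓ 0ℓ
PolyRing n = record
  { Carrier = Poly n ; _≈_ = _≋_ ; _+_ = _⊕_ ; _*_ = _⊗_ ; -_ = ⊟_ ; 0# = 0p ; 1# = 1p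
  ; isCommutativeRing = ≋-isCommutativeRing n }

-- Coefficientwise equality, leading terms and the absence of zero divisors

module _ where
  open ≡-Reasoning

  ≡ᵇ-sound : ∀ a b → (a ≡ᵇ b) ≡ true → a ≡ b
  ≡ᵇ-sound a b e = ℕₚ.≡ᵇ⇒≡ a b (subst T (sym e) tt)

  ≡ᵇ-refl : ∀ a → (a ≡ᵇ a) ≡ true
  ≡ᵇ-refl zero    = refl
  ≡ᵇ-refl (suc a) = ≡ᵇ-refl a

  vecEqᵇ-sound : ∀ {n} (v w : Vec ℕ n) → vecEqᵇ v w ≡ true → v ≡ w
  vecEqᵇ-sound [] [] e = refl
  vecEqᵇ-sound (a ∷ v) (b ∷ w) e with a ≡ᵇ b in a≡ᵇb
  ... | true = cong₂ _∷_ (≡ᵇ-sound a b a≡ᵇb) (vecEqᵇ-sound v w e)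

  vecEqᵇ-refl : ∀ {n} (v : Vec ℕ n) → vecEqᵇ v v ≡ true
  vecEqᵇ-refl [] = refl
  vecEqᵇ-refl (a ∷ v) rewrite ≡ᵇ-refl a = vecEqᵇ-refl v

  monEqᵇ-sound : ∀ {n} (m k : Mon n) → monEqᵇ m k ≡ true → m ≡ k
  monEqᵇ-sound (a , b , v) (a' , b' , v') e with a ≡ᵇ a' in ea | b ≡ᵇ b' in eb
  ... | true | true = cong₂ _,_ (≡ᵇ-sound a a' ea) (cong₂ _,_ (≡ᵇ-sound b b' eb) (vecEqᵇ-sound v v' e))

  monEqᵇ-refl : ∀ {n} (m : Mon n) → monEqᵇ m m ≡ true
  monEqᵇ-refl (a , b , v) rewrite ≡ᵇ-refl a | ≡ᵇ-refl b = vecEqᵇ-refl v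

  δ : ∀ {n} → Mon n → Mon n → ℚ
  δ m k = if monEqᵇ k m then 1ℚ else 0ℚ

  coeff-pair : ∀ {n} (p : Poly n) m → coeff p m ≡ pair p (δ m)
  coeff-pair [] m = refl
  coeff-pair ((c , k) ∷ p) m with monEqᵇ k m
  ... | true  = cong₂ Q._+_ (sym (Qₚ.*-identityʳ c)) (coeff-pair p m)
  ... | false = trans (coeff-pair p m) (trans (sym (Qₚ.+-identityˡ _)) (cong (Q._+ pair p (δ m)) (sym (Qₚ.*-zeroʳ c))))

  -- All terms with monomial m go at once, because they may be scattered over the list and cancel
  -- each other.
  remove : ∀ {n} → Mon n → Poly n → Poly n
  remove m [] = []
  remove m ((c , k) ∷ p) = if monEqᵇ k m then remove m p else (c , k) ∷ remove m p

  pair-remove : ∀ {n} (p : Poly n) m F → pair p F ≡ coeff p m Q.* F m Q.+ pair (remove m p) F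
  pair-remove [] m F = sym (trans (Qₚ.+-identityʳ _) (Qₚ.*-zeroˡ (F m)))
  pair-remove ((c , k) ∷ p) m F with monEqᵇ k m in e
  ... | true  = begin
    c Q.* F k Q.+ pair p F ≡⟨ cong₂ Q._+_ (cong (λ z → c Q.* F z) (monEqᵇ-sound k m e)) (pair-remove p m F) ⟩
    c Q.* F m Q.+ (coeff p m Q.* F m Q.+ pair (remove m p) F) ≡⟨ Qₚ.+-assoc (c Q.* F m) _ _ ⟨
    (c Q.* F m Q.+ coeff p m Q.* F m) Q.+ pair (remove m p) F ≡⟨ cong (Q._+ _) (Qₚ.*-distribʳ-+ (F m) c (coeff p m)) ⟨
    (c Q.+ coeff p m) Q.* F m Q.+ pair (remove m p) F ∎
  ... | false = begin
    c Q.* F k Q.+ pair p F ≡⟨ cong (c Q.* F k Q.+_) (pair-remove p m F) ⟩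
    c Q.* F k Q.+ (coeff p m Q.* F m Q.+ pair (remove m p) F) ≡⟨ Qₚ.+-assoc (c Q.* F k) _ _ ⟨
    (c Q.* F k Q.+ coeff p m Q.* F m) Q.+ pair (remove m p) F ≡⟨ cong (Q._+ _) (Qₚ.+-comm (c Q.* F k) (coeff p m Q.* F m)) ⟩
    (coeff p m Q.* F m Q.+ c Q.* F k) Q.+ pair (remove m p) F ≡⟨ Qₚ.+-assoc (coeff p m Q.* F m) _ _ ⟩
    coeff p m Q.* F m Q.+ (c Q.* F k Q.+ pair (remove m p) F) ∎

  length-remove : ∀ {n} m (p : Poly n) → length (remove m p) ≤ length p
  length-remove m [] = z≤n
  length-remove m ((c , k) ∷ p) with monEqᵇ k m
  ... | true  = ℕₚ.m≤n⇒m≤1+n (length-remove m p)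
  ... | false = s≤s (length-remove m p)

  coeff-remove-0 : ∀ {n} m (p : Poly n) k → coeff p m ≡ 0ℚ → coeff p k ≡ coeff (remove m p) k
  coeff-remove-0 m p k e = begin
    coeff p k ≡⟨ coeff-pair p k ⟩
    pair p (δ k) ≡⟨ pair-remove p m (δ k) ⟩
    coeff p m Q.* δ k m Q.+ pair (remove m p) (δ k) ≡⟨ cong (λ z → z Q.* δ k m Q.+ pair (remove m p) (δ k)) e ⟩
    0ℚ Q.* δ k m Q.+ pair (remove m p) (δ k) ≡⟨ cong (Q._+ pair (remove m p) (δ k)) (Qₚ.*-zeroˡ (δ k m)) ⟩
    0ℚ Q.+ pair (remove m p) (δ k) ≡⟨ Qₚ.+-identityˡ _ ⟩
    pair (remove m p) (δ k) ≡⟨ coeff-pair (remove m p) k ⟨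
    coeff (remove m p) k ∎

  -- The recursive call is on `remove m p`, which is shorter but no structural part of p; hence the
  -- bound ℓ on the length.
  pair-coeff-0 : ∀ {n} ℓ (p : Poly n) → length p ≤ ℓ → (∀ m → coeff p m ≡ 0ℚ) → ∀ F → pair p F ≡ 0ℚ
  pair-coeff-0 ℓ [] _ _ F = refl
  pair-coeff-0 (suc ℓ) p@((c , m) ∷ p') (s≤s le) p≈0 F = begin
    pair p F ≡⟨ pair-remove p m F ⟩
    coeff p m Q.* F m Q.+ pair (remove m p) F ≡⟨ cong₂ (λ x y → x Q.* F m Q.+ y) (p≈0 m) IH ⟩
    0ℚ Q.* F m Q.+ 0ℚ ≡⟨ trans (Qₚ.+-identityʳ _) (Qₚ.*-zeroˡ (F m)) ⟩
    0ℚ ∎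
    where
    shorter : length (remove m p) ≤ length p'
    shorter rewrite monEqᵇ-refl m = length-remove m p'
    IH = pair-coeff-0 ℓ (remove m p) (ℕₚ.≤-trans shorter le)
                      (λ k → trans (sym (coeff-remove-0 m p k (p≈0 m))) (p≈0 k)) F

  ≋⇒≈P : ∀ {n} {p r : Poly n} → p ≋ r → p ≈P r
  ≋⇒≈P {p = p} {r} e m = trans (coeff-pair p m) (trans (pair≡ e (δ m)) (sym (coeff-pair r m)))

  ≈P⇒≋ : ∀ {n} {p r : Poly n} → p ≈P r → p ≋ r
  ≈P⇒≋ {n} {p} {r} e = mk≋ λ F → begin
    pair p F ≡⟨ Qₚ.+-identityʳ _ ⟨
    pair p F Q.+ 0ℚ ≡⟨ cong (pair p F Q.+_) (Qₚ.+-inverseˡ (pair r F)) ⟨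
    pair p F Q.+ (Q.- pair r F Q.+ pair r F) ≡⟨ Qₚ.+-assoc (pair p F) _ _ ⟨
    (pair p F Q.+ Q.- pair r F) Q.+ pair r F ≡⟨ cong (Q._+ pair r F) (pair-sub F) ⟨
    pair (subP p r) F Q.+ pair r F ≡⟨ cong (Q._+ pair r F) (pair-coeff-0 _ (subP p r) ℕₚ.≤-refl sub≈0 F) ⟩
    0ℚ Q.+ pair r F ≡⟨ Qₚ.+-identityˡ _ ⟩
    pair r F ∎
    where
    pair-sub : ∀ F → pair (subP p r) F ≡ pair p F Q.+ Q.- pair r F
    pair-sub F = trans (pair-++ p (negP r) F) (cong (pair p F Q.+_) (pair-neg r F))
    sub≈0 : ∀ m → coeff (subP p r) m ≡ 0ℚ
    sub≈0 m = begin
      coeff (subP p r) m ≡⟨ coeff-pair (subP p r) m ⟩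
      pair (subP p r) (δ m) ≡⟨ pair-sub (δ m) ⟩
      pair p (δ m) Q.+ Q.- pair r (δ m) ≡⟨ cong₂ (λ x y → x Q.+ Q.- y) (coeff-pair p m) (coeff-pair r m) ⟨
      coeff p m Q.+ Q.- coeff r m ≡⟨ cong (λ z → z Q.+ Q.- coeff r m) (e m) ⟩
      coeff r m Q.+ Q.- coeff r m ≡⟨ Qₚ.+-inverseʳ (coeff r m) ⟩
      0ℚ ∎

  infix 4 _<ᵛ_
  -- Applied to exponent vectors with q and t included, this order is total and compatible with
  -- multiplication; the argument by leading terms rests on these two properties.
  data _<ᵛ_ : ∀ {k} → Vec ℕ k → Vec ℕ k → Set where
    here  : ∀ {k a b} {v w : Vec ℕ k} → a < b → (a ∷ v) <ᵛ (b ∷ w)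
    there : ∀ {k a} {v w : Vec ℕ k} → v <ᵛ w → (a ∷ v) <ᵛ (a ∷ w)

  <ᵛ-trans : ∀ {k} {u v w : Vec ℕ k} → u <ᵛ v → v <ᵛ w → u <ᵛ w
  <ᵛ-trans (here p)  (here q)  = here (ℕₚ.<-trans p q)
  <ᵛ-trans (here p)  (there q) = here p
  <ᵛ-trans (there p) (here q)  = here q
  <ᵛ-trans (there p) (there q) = there (<ᵛ-trans p q)

  <ᵛ-irrefl : ∀ {k} {v : Vec ℕ k} → ¬ v <ᵛ v
  <ᵛ-irrefl (here p)  = ℕₚ.<-irrefl refl p
  <ᵛ-irrefl (there p) = <ᵛ-irrefl p

  <ᵛ-total : ∀ {k} (v w : Vec ℕ k) → v <ᵛ w ⊎ v ≡ w ⊎ w <ᵛ v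
  <ᵛ-total [] [] = inj₂ (inj₁ refl)
  <ᵛ-total (a ∷ v) (b ∷ w) with ℕₚ.<-cmp a b
  ... | tri< a<b _ _ = inj₁ (here a<b)
  ... | tri> _ _ b<a = inj₂ (inj₂ (here b<a))
  ... | tri≈ _ refl _ with <ᵛ-total v w
  ...   | inj₁ p           = inj₁ (there p)
  ...   | inj₂ (inj₁ refl) = inj₂ (inj₁ refl)
  ...   | inj₂ (inj₂ p)    = inj₂ (inj₂ (there p))

  <ᵛ-+ʳ : ∀ {k} (u : Vec ℕ k) {v w} → v <ᵛ w → V.zipWith ℕ._+_ u v <ᵛ V.zipWith ℕ._+_ u w
  <ᵛ-+ʳ (a ∷ u) (here p)  = here (ℕₚ.+-monoʳ-< a p)
  <ᵛ-+ʳ (a ∷ u) (there p) = there (<ᵛ-+ʳ u p)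

  exponents : ∀ {n} → Mon n → Vec ℕ (2 ℕ.+ n)
  exponents (a , b , v) = a ∷ b ∷ v

  infix 4 _<ᵐ_
  record _<ᵐ_ {n} (m k : Mon n) : Set where
    constructor mk<
    field lt : exponents m <ᵛ exponents k
  open _<ᵐ_

  <ᵐ-total : ∀ {n} (m k : Mon n) → m <ᵐ k ⊎ m ≡ k ⊎ k <ᵐ m
  <ᵐ-total m k with <ᵛ-total (exponents m) (exponents k)
  ... | inj₁ p           = inj₁ (mk< p)
  ... | inj₂ (inj₁ refl) = inj₂ (inj₁ refl)
  ... | inj₂ (inj₂ p)    = inj₂ (inj₂ (mk< p))

  <ᵐ-trans : ∀ {n} {m k l : Mon n} → m <ᵐ k → k <ᵐ l → m <ᵐ l
  <ᵐ-trans (mk< p) (mk< q) = mk< (<ᵛ-trans p q)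

  <ᵐ⇒monEqᵇ : ∀ {n} {m k : Mon n} → m <ᵐ k → monEqᵇ m k ≡ false
  <ᵐ⇒monEqᵇ {m = m} {k} p with monEqᵇ m k in e
  ... | false = refl
  ... | true with monEqᵇ-sound m k e
  ...   | refl = ⊥-elim (<ᵛ-irrefl (lt p))

  mulMon-monoʳ : ∀ {n} (m : Mon n) {k l} → k <ᵐ l → mulMon m k <ᵐ mulMon m l
  mulMon-monoʳ m (mk< p) = mk< (<ᵛ-+ʳ (exponents m) p)

  mulMon-monoˡ : ∀ {n} (m : Mon n) {k l} → k <ᵐ l → mulMon k m <ᵐ mulMon l m
  mulMon-monoˡ m {k} {l} p = subst₂ _<ᵐ_ (mulMon-comm m k) (mulMon-comm m l) (mulMon-monoʳ m p)

  record Leading {n} (p : Poly n) : Set where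
    field
      lc    : ℚ
      lm    : Mon n
      tl    : Poly n
      lc≢0  : lc ≢ 0ℚ
      split : p ≋ (lc , lm) ∷ tl
      below : All (λ cm → proj₂ cm <ᵐ lm) tl

  largest : ∀ {n} c (k : Mon n) (p : Poly n) →
            ∃ λ m → All (λ cm → proj₂ cm ≡ m ⊎ proj₂ cm <ᵐ m) ((c , k) ∷ p)
  largest c k [] = k , inj₁ refl ∷ []
  largest c k ((d , l) ∷ p) with largest d l p
  ... | m , all with <ᵐ-total k m
  ...   | inj₁ k<m        = m , inj₂ k<m ∷ all
  ...   | inj₂ (inj₁ k≡m) = m , inj₁ k≡m ∷ all
  ...   | inj₂ (inj₂ m<k) = k , inj₁ refl ∷ All.map (λ { (inj₁ refl) → inj₂ m<k ; (inj₂ x<m) → inj₂ (<ᵐ-trans x<m m<k) }) all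

  remove-below : ∀ {n} (m : Mon n) p → All (λ cm → proj₂ cm ≡ m ⊎ proj₂ cm <ᵐ m) p →
                 All (λ cm → proj₂ cm <ᵐ m) (remove m p)
  remove-below m [] [] = []
  remove-below m ((c , .m) ∷ p) (inj₁ refl ∷ all) rewrite monEqᵇ-refl m = remove-below m p all
  remove-below m ((c , k) ∷ p) (inj₂ k<m ∷ all) rewrite <ᵐ⇒monEqᵇ k<m = k<m ∷ remove-below m p all

  remove-shorter : ∀ {n} (m : Mon n) c k p → All (λ cm → proj₂ cm ≡ m ⊎ proj₂ cm <ᵐ m) ((c , k) ∷ p) →
                   (∃ λ j → j ∈ ((c , k) ∷ p) × proj₂ j ≡ m) → length (remove m ((c , k) ∷ p)) ≤ length p
  remove-shorter m c k p all (_ , here refl , refl) rewrite monEqᵇ-refl m = length-remove m p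
  remove-shorter m c k ((d , l) ∷ p) (_ ∷ all) (j , there j∈ , e) with monEqᵇ k m
  ... | true  = length-remove m ((d , l) ∷ p)
  ... | false = s≤s (remove-shorter m d l p all (j , j∈ , e))

  largest-∈ : ∀ {n} c (k : Mon n) p → ∃ λ j → j ∈ ((c , k) ∷ p) × proj₂ j ≡ proj₁ (largest c k p)
  largest-∈ c k [] = _ , here refl , refl
  largest-∈ c k ((d , l) ∷ p) with largest d l p | largest-∈ d l p
  ... | m , all | j , j∈ , e with <ᵐ-total k m
  ...   | inj₁ _        = j , there j∈ , e
  ...   | inj₂ (inj₁ _) = j , there j∈ , e
  ...   | inj₂ (inj₂ _) = _ , here refl , refl

  -- The largest monomial that is listed may have total coefficient 0; its terms are then dropped
  -- and the search starts again on a shorter list.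
  leading? : ∀ {n} ℓ (p : Poly n) → length p ≤ ℓ → p ≋ [] ⊎ Leading p
  leading? ℓ [] _ = inj₁ (mk≋ λ F → refl)
  leading? (suc ℓ) p@((c , k) ∷ p') (s≤s le) with largest c k p' | largest-∈ c k p'
  ... | m , all | j with coeff p m Qₚ.≟ 0ℚ
  ...   | no lc≢0 = inj₂ record
      { lc = coeff p m ; lm = m ; tl = remove m p ; lc≢0 = lc≢0
      ; split = mk≋ (pair-remove p m) ; below = remove-below m p all }
  ...   | yes lc≡0 = lift-remove (leading? ℓ (remove m p) (ℕₚ.≤-trans (remove-shorter m c k p' all j) le))
    where
    p≋ : p ≋ remove m p
    p≋ = ≈P⇒≋ λ l → coeff-remove-0 m p l lc≡0
    lift-remove : remove m p ≋ [] ⊎ Leading (remove m p) → p ≋ [] ⊎ Leading p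
    lift-remove (inj₁ e) = inj₁ (mk≋ λ F → trans (pair≡ p≋ F) (pair≡ e F))
    lift-remove (inj₂ L) = inj₂ record
      { lc≢0 = Leading.lc≢0 L ; split = mk≋ λ F → trans (pair≡ p≋ F) (pair≡ (Leading.split L) F) ; below = Leading.below L }

  ℚ-domain : ∀ c d → c ≢ 0ℚ → c Q.* d ≡ 0ℚ → d ≡ 0ℚ
  ℚ-domain c d c≢0 e = begin
    d ≡⟨ Qₚ.*-identityˡ d ⟨
    1ℚ Q.* d ≡⟨ cong (Q._* d) (Qₚ.*-inverseˡ c) ⟨
    (Q.1/ c Q.* c) Q.* d ≡⟨ Qₚ.*-assoc (Q.1/ c) c d ⟩
    Q.1/ c Q.* (c Q.* d) ≡⟨ cong (Q.1/ c Q.*_) e ⟩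
    Q.1/ c Q.* 0ℚ ≡⟨ Qₚ.*-zeroʳ (Q.1/ c) ⟩
    0ℚ ∎
    where instance _ = Q.≢-nonZero c≢0

  pair-All-0 : ∀ {n} (p : Poly n) F → All (λ cm → F (proj₂ cm) ≡ 0ℚ) p → pair p F ≡ 0ℚ
  pair-All-0 [] F [] = refl
  pair-All-0 ((c , m) ∷ p) F (e ∷ es) =
    trans (cong₂ Q._+_ (trans (cong (c Q.*_) e) (Qₚ.*-zeroʳ c)) (pair-All-0 p F es)) (Qₚ.+-identityˡ 0ℚ)

  -- Multiplication preserves the order strictly, so only the pair of leading monomials reaches
  -- their product.
  leading-product : ∀ {n} {p r : Poly n} (P : Leading p) (R : Leading r) →
                    pair (mulP p r) (δ (mulMon (Leading.lm P) (Leading.lm R))) ≡ Leading.lc P Q.* Leading.lc R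
  leading-product {n} {p} {r} P R = begin
    pair (mulP p r) F ≡⟨ pair-mul p r F ⟩
    pair p (λ m → pair r (λ k → F (mulMon m k))) ≡⟨ pair-cong p (λ m → pair≡ R.split _) ⟩
    pair p (λ m → pair R′ (λ k → F (mulMon m k))) ≡⟨ pair≡ P.split _ ⟩
    P.lc Q.* pair R′ (λ k → F (mulMon P.lm k)) Q.+ pair P.tl (λ m → pair R′ (λ k → F (mulMon m k)))
      ≡⟨ cong₂ (λ x y → P.lc Q.* x Q.+ y) top (pair-All-0 P.tl _ (All.map (λ {cm} → low {cm}) P.below)) ⟩
    P.lc Q.* R.lc Q.+ 0ℚ ≡⟨ Qₚ.+-identityʳ _ ⟩
    P.lc Q.* R.lc ∎
    where
    module P = Leading P
    module R = Leading R
    R′ = (R.lc , R.lm) ∷ R.tl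
    F = δ (mulMon P.lm R.lm)
    F0 : ∀ {k} → k <ᵐ mulMon P.lm R.lm → F k ≡ 0ℚ
    F0 k< rewrite <ᵐ⇒monEqᵇ k< = refl
    F1 : F (mulMon P.lm R.lm) ≡ 1ℚ
    F1 rewrite monEqᵇ-refl (mulMon P.lm R.lm) = refl
    top : pair R′ (λ k → F (mulMon P.lm k)) ≡ R.lc
    top = trans (cong₂ Q._+_ (trans (cong (R.lc Q.*_) F1) (Qₚ.*-identityʳ R.lc))
                             (pair-All-0 R.tl _ (All.map (λ k< → F0 (mulMon-monoʳ P.lm k<)) R.below)))
                (Qₚ.+-identityʳ R.lc)
    low : ∀ {cm : ℚ × Mon n} → proj₂ cm <ᵐ P.lm → pair R′ (λ k → F (mulMon (proj₂ cm) k)) ≡ 0ℚ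
    low {_ , m} m< = pair-All-0 R′ _
      (F0 (mulMon-monoˡ R.lm m<) ∷ All.map (λ k< → F0 (<ᵐ-trans (mulMon-monoʳ m k<) (mulMon-monoˡ R.lm m<))) R.below)

opaque
  unfolding _⊕_
  0p≋[] : ∀ {n} → 0p {n} ≋ []
  0p≋[] = mk≋ λ F → refl

  ≋0? : ∀ {n} (p : Poly n) → Dec (p ≋ 0p)
  ≋0? p with leading? (length p) p ℕₚ.≤-refl
  ... | inj₁ e = yes e
  ... | inj₂ L = no λ e → lc≢0 (begin
    lc ≡⟨ Qₚ.*-identityʳ lc ⟨
    lc Q.* 1ℚ ≡⟨ cong (lc Q.*_) F1 ⟨
    lc Q.* δ lm lm ≡⟨ Qₚ.+-identityʳ _ ⟨
    lc Q.* δ lm lm Q.+ 0ℚ ≡⟨ cong (lc Q.* δ lm lm Q.+_) (pair-All-0 tl _ (All.map (λ {cm} → F0 {proj₂ cm}) below)) ⟨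
    pair ((lc , lm) ∷ tl) (δ lm) ≡⟨ pair≡ split _ ⟨
    pair p (δ lm) ≡⟨ pair≡ e _ ⟩
    0ℚ ∎)
    where
    open Leading L
    open ≡-Reasoning
    F1 : δ lm lm ≡ 1ℚ
    F1 rewrite monEqᵇ-refl lm = refl
    F0 : ∀ {k} → k <ᵐ lm → δ lm k ≡ 0ℚ
    F0 k< rewrite <ᵐ⇒monEqᵇ k< = refl

  ⊗-domain : ∀ {n} {p r : Poly n} → ¬ p ≋ 0p → p ⊗ r ≋ 0p → r ≋ 0p
  ⊗-domain {p = p} {r} p≢0 pr≋0 with leading? (length p) p ℕₚ.≤-refl | leading? (length r) r ℕₚ.≤-refl
  ... | inj₁ e | _      = ⊥-elim (p≢0 e)
  ... | inj₂ _ | inj₁ e = e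
  ... | inj₂ P | inj₂ R = ⊥-elim (Leading.lc≢0 R (ℚ-domain (Leading.lc P) (Leading.lc R) (Leading.lc≢0 P)
                            (trans (sym (leading-product P R)) (pair≡ pr≋0 _))))

-- Actions on monomials

record Hom {n k} (f : Poly n → Poly k) : Set where
  field
    ⟦⟧-cong : ∀ {p r} → p ≋ r → f p ≋ f r
    ⊕-homo  : ∀ p r → f (p ⊕ r) ≋ f p ⊕ f r
    ⊗-homo  : ∀ p r → f (p ⊗ r) ≋ f p ⊗ f r
    ⊟-homo  : ∀ p → f (⊟ p) ≋ ⊟ f p
    0-homo  : f 0p ≋ 0p
    1-homo  : f 1p ≋ 1p
open Hom public

mapMon : ∀ {n k} → (Mon n → Mon k) → Poly n → Poly k
mapMon g = L.map (λ { (c , m) → c , g m })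

pair-mapMon : ∀ {n k} (g : Mon n → Mon k) p F → pair (mapMon g p) F ≡ pair p (F ∘ g)
pair-mapMon g = pair-map _ g (λ _ _ → refl)

swapMon : ∀ {n} → ℕ → Mon n → Mon n
swapMon j (a , b , v) = a , b , swapAt j v

-- ε is the power of q that ω attaches to its variable: 1 for generic q and 0 after putting q = 1.
rotMon : ∀ {n} → ℕ → Mon n → Mon n
rotMon ε (a , b , [])    = a , b , []
rotMon ε (a , b , h ∷ w) = a ℕ.+ ε ℕ.* h , b , w V.∷ʳ h

specMon : ∀ {n} → Mon n → Mon n
specMon (a , b , v) = 0 , b , v

embedMon : ∀ {n} → Mon 0 → Mon n
embedMon (a , b , _) = a , b , zeros

opaque
  unfolding _⊕_

  mapMon-hom : ∀ {n k} (g : Mon n → Mon k) → g (0 , 0 , zeros) ≡ (0 , 0 , zeros) →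
               (∀ m m' → g (mulMon m m') ≡ mulMon (g m) (g m')) → Hom (mapMon g)
  mapMon-hom g g1 g* = record
    { ⟦⟧-cong = λ {p} {r} e → mk≋ λ F → trans (pair-mapMon g p F) (trans (pair≡ e _) (sym (pair-mapMon g r F)))
    ; ⊕-homo = λ p r → mk≋ λ F → cong (λ z → pair z F) (Lₚ.map-++ _ p r)
    ; ⊗-homo = λ p r → mk≋ λ F → trans (pair-mapMon g (p ⊗ r) F) (trans (pair-mul p r _)
        (trans (pair-cong p (λ m → pair-cong r (λ m' → cong F (g* m m'))))
        (sym (trans (pair-mul (mapMon g p) (mapMon g r) F) (trans (pair-mapMon g p _)
          (pair-cong p (λ m → pair-mapMon g r _)))))))
    ; ⊟-homo = λ p → mk≋ λ F → trans (pair-mapMon g (negP p) F) (trans (pair-neg p _)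
        (sym (trans (pair-neg (mapMon g p) F) (cong Q.-_ (pair-mapMon g p F)))))
    ; 0-homo = mk≋ λ F → refl
    ; 1-homo = mk≋ λ F → cong (λ m → 1ℚ Q.* F m Q.+ 0ℚ) g1 }

  mono : ∀ {n} → Mon n → Poly n
  mono m = (1ℚ , m) ∷ []

  mono-⊗ : ∀ {n} (m k : Mon n) → mono m ⊗ mono k ≋ mono (mulMon m k)
  mono-⊗ m k = mk≋ λ F → trans (pair-mul (mono m) (mono k) F)
    (trans (Qₚ.+-identityʳ _) (trans (Qₚ.*-identityˡ _) refl))

  pair-mono-⊗ : ∀ {n} (m : Mon n) p F → pair (mono m ⊗ p) F ≡ pair p (λ k → F (mulMon m k))
  pair-mono-⊗ m p F = trans (pair-mul (mono m) p F) (trans (Qₚ.+-identityʳ _) (Qₚ.*-identityˡ _))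

  mono-1 : ∀ {n} → mono {n} (0 , 0 , zeros) ≋ 1p
  mono-1 = mk≋ λ F → refl

  mono-diff≢0 : ∀ {n} (m k : Mon n) → m ≢ k → ¬ (mono m ⊕ ⊟ mono k ≋ 0p)
  mono-diff≢0 m k m≢k e = 1≢0 (trans (sym value) (pair≡ e (δ m)))
    where
    1≢0 : 1ℚ ≢ 0ℚ
    1≢0 ()
    F1 : δ m m ≡ 1ℚ
    F1 rewrite monEqᵇ-refl m = refl
    F0 : δ m k ≡ 0ℚ
    F0 with monEqᵇ k m in e
    ... | true  = ⊥-elim (m≢k (sym (monEqᵇ-sound k m e)))
    ... | false = refl
    value : pair (mono m ⊕ ⊟ mono k) (δ m) ≡ 1ℚ
    value rewrite F1 | F0 = refl

  mono≢0 : ∀ {n} (m : Mon n) → ¬ (mono m ≋ 0p)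
  mono≢0 m e = 1≢0 (trans (sym value) (pair≡ e (λ _ → 1ℚ)))
    where
    1≢0 : 1ℚ ≢ 0ℚ
    1≢0 ()
    value : pair (mono m) (λ _ → 1ℚ) ≡ 1ℚ
    value = refl

  s : ∀ {n} → ℕ → Poly n → Poly n
  s j = mapMon (swapMon j)

  ω : ∀ {n} → ℕ → Poly n → Poly n
  ω ε = mapMon (rotMon ε)

  spec : ∀ {n} → Poly n → Poly n
  spec = mapMon specMon

  ι : ∀ {n} → Poly 0 → Poly n
  ι = mapMon embedMon

  pair-s : ∀ {n} j (p : Poly n) F → pair (s j p) F ≡ pair p (F ∘ swapMon j)
  pair-s j = pair-mapMon (swapMon j)
  pair-ω : ∀ {n} ε (p : Poly n) F → pair (ω ε p) F ≡ pair p (F ∘ rotMon ε)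
  pair-ω ε = pair-mapMon (rotMon ε)
  pair-spec : ∀ {n} (p : Poly n) F → pair (spec p) F ≡ pair p (F ∘ specMon)
  pair-spec = pair-mapMon specMon
  pair-ι : ∀ {n} (p : Poly 0) F → pair (ι {n} p) F ≡ pair p (F ∘ embedMon)
  pair-ι = pair-mapMon embedMon

x : ∀ {n} → ℕ → Poly n
x j = mono (0 , 0 , unitV j)

sc : ∀ {n} → ℕ → ℕ → Poly n
sc a b = mono (a , b , zeros)

swapAt-zeros : ∀ {n} j → swapAt j (zeros {n}) ≡ zeros
swapAt-zeros {zero} j = refl
swapAt-zeros {suc zero} zero = refl
swapAt-zeros {suc (suc n)} zero = refl
swapAt-zeros {suc n} (suc j) = cong (0 ∷_) (swapAt-zeros j)

swapAt-zipWith : ∀ {n} j (v w : Vec ℕ n) → swapAt j (V.zipWith ℕ._+_ v w) ≡ V.zipWith ℕ._+_ (swapAt j v) (swapAt j w)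
swapAt-zipWith j [] [] = refl
swapAt-zipWith zero (a ∷ []) (b ∷ []) = refl
swapAt-zipWith zero (a ∷ a' ∷ v) (b ∷ b' ∷ w) = refl
swapAt-zipWith (suc j) (a ∷ v) (b ∷ w) = cong (_ ∷_) (swapAt-zipWith j v w)

swapAt-involutive : ∀ {n} j (v : Vec ℕ n) → swapAt j (swapAt j v) ≡ v
swapAt-involutive j [] = refl
swapAt-involutive zero (a ∷ []) = refl
swapAt-involutive zero (a ∷ b ∷ v) = refl
swapAt-involutive (suc j) (a ∷ v) = cong (a ∷_) (swapAt-involutive j v)

swapAt-braid : ∀ {n} j (v : Vec ℕ n) → suc (suc j) < n →
               swapAt j (swapAt (suc j) (swapAt j v)) ≡ swapAt (suc j) (swapAt j (swapAt (suc j) v))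
swapAt-braid zero (a ∷ b ∷ c ∷ v) lt = refl
swapAt-braid zero (a ∷ b ∷ []) (s≤s (s≤s ()))
swapAt-braid zero (a ∷ []) (s≤s ())
swapAt-braid (suc j) (a ∷ v) (s≤s lt) = cong (a ∷_) (swapAt-braid j v lt)

swapAt-far : ∀ {n} j k (v : Vec ℕ n) → suc (suc j) ≤ k → swapAt j (swapAt k v) ≡ swapAt k (swapAt j v)
swapAt-far j k [] le = refl
swapAt-far zero (suc (suc k)) (a ∷ []) le = refl
swapAt-far zero (suc zero) v (s≤s ())
swapAt-far zero (suc (suc k)) (a ∷ b ∷ v) le = refl
swapAt-far (suc j) (suc k) (a ∷ v) (s≤s le) = cong (a ∷_) (swapAt-far j k v le)

∷ʳ-zeros : ∀ n → zeros {n} V.∷ʳ 0 ≡ zeros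
∷ʳ-zeros zero = refl
∷ʳ-zeros (suc n) = cong (0 ∷_) (∷ʳ-zeros n)

∷ʳ-zipWith : ∀ {n} (v w : Vec ℕ n) a b → V.zipWith ℕ._+_ v w V.∷ʳ (a ℕ.+ b) ≡ V.zipWith ℕ._+_ (v V.∷ʳ a) (w V.∷ʳ b)
∷ʳ-zipWith [] [] a b = refl
∷ʳ-zipWith (c ∷ v) (d ∷ w) a b = cong (_ ∷_) (∷ʳ-zipWith v w a b)

rotMon-1 : ∀ {n} ε → rotMon {n} ε (0 , 0 , zeros) ≡ (0 , 0 , zeros)
rotMon-1 {zero} ε = refl
rotMon-1 {suc n} ε = cong₂ (λ a v → a , 0 , v) (ℕₚ.*-zeroʳ ε) (∷ʳ-zeros n)

rotMon-* : ∀ {n} ε (m k : Mon n) → rotMon ε (mulMon m k) ≡ mulMon (rotMon ε m) (rotMon ε k)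
rotMon-* ε (a , b , []) (a' , b' , []) = refl
rotMon-* ε (a , b , h ∷ w) (a' , b' , h' ∷ w') = cong₂ (λ a v → a , b ℕ.+ b' , v) q-exp (∷ʳ-zipWith w w' h h')
  where
  open ≡-Reasoning
  q-exp : (a ℕ.+ a') ℕ.+ ε ℕ.* (h ℕ.+ h') ≡ (a ℕ.+ ε ℕ.* h) ℕ.+ (a' ℕ.+ ε ℕ.* h')
  q-exp = begin
    (a ℕ.+ a') ℕ.+ ε ℕ.* (h ℕ.+ h') ≡⟨ cong ((a ℕ.+ a') ℕ.+_) (ℕₚ.*-distribˡ-+ ε h h') ⟩
    (a ℕ.+ a') ℕ.+ (ε ℕ.* h ℕ.+ ε ℕ.* h') ≡⟨ ℕₚ.+-assoc a a' _ ⟩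
    a ℕ.+ (a' ℕ.+ (ε ℕ.* h ℕ.+ ε ℕ.* h')) ≡⟨ cong (a ℕ.+_) (ℕₚ.+-assoc a' (ε ℕ.* h) _) ⟨
    a ℕ.+ ((a' ℕ.+ ε ℕ.* h) ℕ.+ ε ℕ.* h') ≡⟨ cong (λ z → a ℕ.+ (z ℕ.+ ε ℕ.* h')) (ℕₚ.+-comm a' (ε ℕ.* h)) ⟩
    a ℕ.+ ((ε ℕ.* h ℕ.+ a') ℕ.+ ε ℕ.* h') ≡⟨ cong (a ℕ.+_) (ℕₚ.+-assoc (ε ℕ.* h) a' _) ⟩
    a ℕ.+ (ε ℕ.* h ℕ.+ (a' ℕ.+ ε ℕ.* h')) ≡⟨ ℕₚ.+-assoc a (ε ℕ.* h) _ ⟨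
    (a ℕ.+ ε ℕ.* h) ℕ.+ (a' ℕ.+ ε ℕ.* h') ∎

unitV-swap : ∀ {n} j → suc j < n → swapAt j (unitV {n} j) ≡ unitV (suc j)
unitV-swap {suc zero} zero (s≤s ())
unitV-swap {suc (suc n)} zero lt = refl
unitV-swap {suc n} (suc j) (s≤s lt) = cong (0 ∷_) (unitV-swap j lt)

unitV-fixed : ∀ {n} j k → k ≢ j → k ≢ suc j → swapAt j (unitV {n} k) ≡ unitV k
unitV-fixed {zero} j k _ _ = refl
unitV-fixed {suc zero} zero zero k≢0 _ = ⊥-elim (k≢0 refl)
unitV-fixed {suc zero} zero (suc k) _ _ = refl
unitV-fixed {suc (suc n)} zero zero k≢0 _ = ⊥-elim (k≢0 refl)
unitV-fixed {suc (suc n)} zero (suc zero) _ k≢1 = ⊥-elim (k≢1 refl)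
unitV-fixed {suc (suc n)} zero (suc (suc k)) _ _ = refl
unitV-fixed {suc n} (suc j) zero _ _ = cong (1 ∷_) (swapAt-zeros j)
unitV-fixed {suc n} (suc j) (suc k) p q = cong (0 ∷_) (unitV-fixed j k (p ∘ cong suc) (q ∘ cong suc))

unitV-distinct : ∀ {n} j → suc j < n → unitV {n} j ≢ unitV (suc j)
unitV-distinct {suc n} zero _ ()
unitV-distinct {suc n} (suc j) (s≤s lt) e = unitV-distinct j lt (Vₚ.∷-injectiveʳ e)

unitV-last : ∀ n → zeros {n} V.∷ʳ 1 ≡ unitV n
unitV-last zero = refl
unitV-last (suc n) = cong (0 ∷_) (unitV-last n)

unitV-∷ʳ : ∀ {n} k → k < n → unitV {n} k V.∷ʳ 0 ≡ unitV k
unitV-∷ʳ {suc n} zero lt = cong (1 ∷_) (∷ʳ-zeros n)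
unitV-∷ʳ {suc n} (suc k) (s≤s lt) = cong (0 ∷_) (unitV-∷ʳ k lt)

swapAt-∷ʳ : ∀ {n} j (w : Vec ℕ n) h → suc j < n → swapAt j (w V.∷ʳ h) ≡ swapAt j w V.∷ʳ h
swapAt-∷ʳ zero (a ∷ b ∷ w) h lt = refl
swapAt-∷ʳ zero (a ∷ []) h (s≤s ())
swapAt-∷ʳ (suc j) (a ∷ w) h (s≤s lt) = cong (a ∷_) (swapAt-∷ʳ j w h lt)

swapAt-∷ʳ² : ∀ {n} (w : Vec ℕ n) h g → swapAt n ((w V.∷ʳ h) V.∷ʳ g) ≡ (w V.∷ʳ g) V.∷ʳ h
swapAt-∷ʳ² [] h g = refl
swapAt-∷ʳ² (a ∷ w) h g = cong (a ∷_) (swapAt-∷ʳ² w h g)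

opaque
  unfolding s

  s-hom : ∀ {n} j → Hom (s {n} j)
  s-hom j = mapMon-hom (swapMon j) (cong (λ v → 0 , 0 , v) (swapAt-zeros j))
    (λ { (a , b , v) (a' , b' , w) → cong (λ u → a ℕ.+ a' , b ℕ.+ b' , u) (swapAt-zipWith j v w) })

  ω-hom : ∀ {n} ε → Hom (ω {n} ε)
  ω-hom ε = mapMon-hom (rotMon ε) (rotMon-1 ε) (rotMon-* ε)

  spec-hom : ∀ {n} → Hom (spec {n})
  spec-hom = mapMon-hom specMon refl (λ _ _ → refl)

  ι-hom : ∀ {n} → Hom (ι {n})
  ι-hom = mapMon-hom embedMon refl
    (λ { (a , b , _) (a' , b' , _) → cong (λ u → a ℕ.+ a' , b ℕ.+ b' , u)
           (sym (Vₚ.zipWith-identityˡ ℕₚ.+-identityˡ zeros)) })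

  s-mono : ∀ {n} j (m : Mon n) → s j (mono m) ≋ mono (swapMon j m)
  s-mono j m = mk≋ λ F → refl
  ω-mono : ∀ {n} ε (m : Mon n) → ω ε (mono m) ≋ mono (rotMon ε m)
  ω-mono ε m = mk≋ λ F → refl
  spec-mono : ∀ {n} (m : Mon n) → spec (mono m) ≋ mono (specMon m)
  spec-mono m = mk≋ λ F → refl
  ι-mono : ∀ {n} (m : Mon 0) → ι {n} (mono m) ≋ mono (embedMon m)
  ι-mono m = mk≋ λ F → refl

private
  mono≡ : ∀ {n} {m k : Mon n} → m ≡ k → mono m ≋ mono k
  mono≡ refl = mk≋ λ F → refl

  infixr 4 _∙_
  _∙_ : ∀ {n} {p r u : Poly n} → p ≋ r → r ≋ u → p ≋ u
  e ∙ f = mk≋ λ F → trans (pair≡ e F) (pair≡ f F)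

sc-⊗ : ∀ {n} a b a' b' → sc {n} a b ⊗ sc a' b' ≋ sc (a ℕ.+ a') (b ℕ.+ b')
sc-⊗ a b a' b' = mono-⊗ (a , b , zeros) (a' , b' , zeros) ∙
  mono≡ (cong (λ u → a ℕ.+ a' , b ℕ.+ b' , u) (Vₚ.zipWith-identityˡ ℕₚ.+-identityˡ zeros))

s-sc : ∀ {n} j a b → s j (sc {n} a b) ≋ sc a b
s-sc j a b = s-mono j _ ∙ mono≡ (cong (λ v → a , b , v) (swapAt-zeros j))

s-x : ∀ {n} j → suc j < n → s {n} j (x j) ≋ x (suc j)
s-x j lt = s-mono j _ ∙ mono≡ (cong (λ v → 0 , 0 , v) (unitV-swap j lt))

s-x-suc : ∀ {n} j → suc j < n → s {n} j (x (suc j)) ≋ x j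
s-x-suc j lt = s-mono j _ ∙ mono≡ (cong (λ v → 0 , 0 , v)
  (trans (cong (swapAt j) (sym (unitV-swap j lt))) (swapAt-involutive j _)))

s-x-fixed : ∀ {n} j k → k ≢ j → k ≢ suc j → s {n} j (x k) ≋ x k
s-x-fixed j k p q = s-mono j _ ∙ mono≡ (cong (λ v → 0 , 0 , v) (unitV-fixed j k p q))

s-involutive : ∀ {n} j (f : Poly n) → s j (s j f) ≋ f
s-involutive j f = mk≋ λ F → trans (pair-s j (s j f) F) (trans (pair-s j f _)
  (pair-cong f (λ { (a , b , v) → cong (λ u → F (a , b , u)) (swapAt-involutive j v) })))

s-braid : ∀ {n} j (f : Poly n) → suc (suc j) < n → s j (s (suc j) (s j f)) ≋ s (suc j) (s j (s (suc j) f))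
s-braid j f lt = mk≋ λ F → trans (pair-s j _ F) (trans (pair-s (suc j) _ _) (trans (pair-s j f _)
  (trans (pair-cong f (λ { (a , b , v) → cong (λ u → F (a , b , u)) (swapAt-braid j v lt) }))
  (sym (trans (pair-s (suc j) _ F) (trans (pair-s j _ _) (pair-s (suc j) f _)))))))

s-far : ∀ {n} j k (f : Poly n) → suc (suc j) ≤ k → s j (s k f) ≋ s k (s j f)
s-far j k f le = mk≋ λ F → trans (pair-s j _ F) (trans (pair-s k f _)
  (trans (pair-cong f (λ { (a , b , v) → cong (λ u → F (a , b , u)) (swapAt-far j k v le) }))
  (sym (trans (pair-s k _ F) (pair-s j f _)))))

ω-sc : ∀ {n} ε a b → ω ε (sc {n} a b) ≋ sc a b
ω-sc {zero} ε a b = ω-mono ε _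
ω-sc {suc n} ε a b = ω-mono ε _ ∙
  mono≡ (cong₂ (λ a v → a , b , v) (trans (cong (a ℕ.+_) (ℕₚ.*-zeroʳ ε)) (ℕₚ.+-identityʳ a)) (∷ʳ-zeros n))

ω-x-suc : ∀ {n} ε k → suc k < n → ω {n} ε (x (suc k)) ≋ x k
ω-x-suc {suc n} ε k (s≤s lt) = ω-mono ε _ ∙ mono≡ (cong₂ (λ a v → a , 0 , v) (ℕₚ.*-zeroʳ ε) (unitV-∷ʳ k lt))

ω-x-0 : ∀ {n} ε → ω {suc n} ε (x 0) ≋ sc ε 0 ⊗ x n
ω-x-0 {n} ε = ω-mono ε _ ∙ mono≡ (cong₂ (λ a v → a , 0 , v) (trans (ℕₚ.*-identityʳ ε) (sym (ℕₚ.+-identityʳ ε)))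
    (trans (unitV-last n) (sym (Vₚ.zipWith-identityˡ ℕₚ.+-identityˡ (unitV n)))))
  ∙ mk≋ λ F → sym (pair≡ (mono-⊗ (ε , 0 , zeros) (0 , 0 , unitV n)) F)

ω-s : ∀ {n} ε j (f : Poly n) → suc (suc j) < n → s j (ω ε f) ≋ ω ε (s (suc j) f)
ω-s ε j f lt = mk≋ λ F → trans (pair-s j _ F) (trans (pair-ω ε f _)
  (trans (pair-cong f (λ { (a , b , []) → refl ; (a , b , h ∷ w) → cong (λ u → F (a ℕ.+ ε ℕ.* h , b , u)) (swapAt-∷ʳ j w h (ℕₚ.≤-pred lt)) }))
  (sym (trans (pair-ω ε _ F) (pair-s (suc j) f _)))))

ω-s² : ∀ {n} ε (f : Poly (suc (suc n))) → s n (ω ε (ω ε f)) ≋ ω ε (ω ε (s 0 f))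
ω-s² {n} ε f = mk≋ λ F → trans (pair-s n _ F) (trans (pair-ω ε _ _) (trans (pair-ω ε f _)
  (trans (pair-cong f (λ { (a , b , h ∷ g ∷ w) → cong₂ (λ c u → F (c , b , u)) (comm a h g) (swapAt-∷ʳ² w h g) }))
  (sym (trans (pair-ω ε _ F) (trans (pair-ω ε _ _) (pair-s 0 f _)))))))
  where
  comm : ∀ a h g → (a ℕ.+ ε ℕ.* h) ℕ.+ ε ℕ.* g ≡ (a ℕ.+ ε ℕ.* g) ℕ.+ ε ℕ.* h
  comm a h g = trans (ℕₚ.+-assoc a _ _) (trans (cong (a ℕ.+_) (ℕₚ.+-comm (ε ℕ.* h) (ε ℕ.* g))) (sym (ℕₚ.+-assoc a _ _)))

spec-s : ∀ {n} j (f : Poly n) → spec (s j f) ≋ s j (spec f)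
spec-s j f = mk≋ λ F → trans (pair-spec _ F) (trans (pair-s j f _) (sym (trans (pair-s j _ F) (pair-spec f _))))

spec-ω : ∀ {n} (f : Poly n) → spec (ω 1 f) ≋ ω 0 (spec f)
spec-ω f = mk≋ λ F → trans (pair-spec _ F) (trans (pair-ω 1 f _)
  (trans (pair-cong f (λ { (a , b , []) → refl ; (a , b , h ∷ w) → refl })) (sym (trans (pair-ω 0 _ F) (pair-spec f _)))))

spec-sc : ∀ {n} a b → spec (sc {n} a b) ≋ sc 0 b
spec-sc a b = spec-mono _

spec-x : ∀ {n} j → spec {n} (x j) ≋ x j
spec-x j = spec-mono _

spec-ι : ∀ {n} c → spec (ι {n} c) ≋ ι (spec c)
spec-ι c = mk≋ λ F → trans (pair-spec _ F) (trans (pair-ι c _) (sym (trans (pair-ι _ F) (pair-spec c _))))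

ι-sc : ∀ {n} a b → ι {n} (sc a b) ≋ sc a b
ι-sc a b = ι-mono _

s-ι : ∀ {n} j c → s j (ι {n} c) ≋ ι c
s-ι j c = mk≋ λ F → trans (pair-s j _ F) (trans (pair-ι c _)
  (trans (pair-cong c (λ { (a , b , _) → cong (λ u → F (a , b , u)) (swapAt-zeros j) })) (sym (pair-ι c F))))

ω-ι : ∀ {n} ε c → ω ε (ι {n} c) ≋ ι c
ω-ι {n} ε c = mk≋ λ F → trans (pair-ω ε _ F) (trans (pair-ι c _)
  (trans (pair-cong c (λ { (a , b , _) → cong F (rot0 n a b) })) (sym (pair-ι c F))))
  where
  rot0 : ∀ n a b → rotMon {n} ε (a , b , zeros) ≡ (a , b , zeros)
  rot0 zero a b = refl
  rot0 (suc n) a b = cong₂ (λ a v → a , b , v) (trans (cong (a ℕ.+_) (ℕₚ.*-zeroʳ ε)) (ℕₚ.+-identityʳ a)) (∷ʳ-zeros n)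

-- Divided differences

module PR {n : ℕ} = CommutativeRing (PolyRing n)
open PR using () renaming
  ( refl to ≋-refl; sym to ≋-sym; trans to ≋-trans; reflexive to ≋-reflexive
  ; +-cong to ⊕-cong; *-cong to ⊗-cong; +-congˡ to ⊕-congˡ; +-congʳ to ⊕-congʳ
  ; *-congˡ to ⊗-congˡ; *-congʳ to ⊗-congʳ; -‿cong to ⊟-cong
  ; zeroʳ to ⊗-zeroʳ; zeroˡ to ⊗-zeroˡ; *-comm to ⊗-comm; *-assoc to ⊗-assoc
  ; *-identityˡ to ⊗-identityˡ; +-identityʳ to ⊕-identityʳ; +-identityˡ to ⊕-identityˡ ) public
module ≋-Reasoning {n : ℕ} = SetoidReasoning (CommutativeRing.setoid (PolyRing n))
module PS {n : ℕ} = IntegerSolver (PolyRing n)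
open PS using (solve; :0; :1; _:+_; _:*_; :-_; _:-_; _:=_) public

infixl 6 _⊖′_
_⊖′_ : ∀ {n} → Poly n → Poly n → Poly n
p ⊖′ r = p ⊕ ⊟ r

⊖-cong : ∀ {n} {p p' r r' : Poly n} → p ≋ p' → r ≋ r' → p ⊖′ r ≋ p' ⊖′ r'
⊖-cong e f = ⊕-cong e (⊟-cong f)

⊖≋0⇒≋ : ∀ {n} {p r : Poly n} → p ⊖′ r ≋ 0p → p ≋ r
⊖≋0⇒≋ {n} {p} {r} e = ≋-trans (solve 2 (λ p r → p := (p :- r) :+ r) ≋-refl p r)
                        (≋-trans (⊕-congʳ e) (⊕-identityˡ r))

≋⇒⊖≋0 : ∀ {n} {p r : Poly n} → p ≋ r → p ⊖′ r ≋ 0p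
≋⇒⊖≋0 {n} {p} {r} e = ≋-trans (⊕-congʳ e) (PR.-‿inverseʳ r)

⊗-cancelˡ : ∀ {n} {c p r : Poly n} → ¬ c ≋ 0p → c ⊗ p ≋ c ⊗ r → p ≋ r
⊗-cancelˡ {c = c} {p} {r} c≢0 e = ⊖≋0⇒≋ (⊗-domain c≢0
  (≋-trans (solve 3 (λ c p r → c :* (p :- r) := c :* p :- c :* r) ≋-refl c p r) (≋⇒⊖≋0 e)))

⊗-≢0 : ∀ {n} {p r : Poly n} → ¬ p ≋ 0p → ¬ r ≋ 0p → ¬ p ⊗ r ≋ 0p
⊗-≢0 p≢0 r≢0 e = r≢0 (⊗-domain p≢0 e)

⊖-homo : ∀ {n k} {f : Poly n → Poly k} → Hom f → ∀ p r → f (p ⊖′ r) ≋ f p ⊖′ f r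
⊖-homo h p r = ≋-trans (⊕-homo h p (⊟ r)) (⊕-congˡ (⊟-homo h r))

unrotMon : ∀ {n} → ℕ → Mon (suc n) → Mon (suc n)
unrotMon ε (a , b , v) = a ∸ ε ℕ.* V.last v , b , V.last v ∷ V.init v

unrot-rot : ∀ {n} ε (m : Mon (suc n)) → unrotMon ε (rotMon ε m) ≡ m
unrot-rot ε (a , b , h ∷ w) rewrite Vₚ.last-∷ʳ h w | Vₚ.init-∷ʳ h w | ℕₚ.m+n∸n≡m a (ε ℕ.* h) = refl

opaque
  unfolding _⊕_
  pair-0p : ∀ {n} F → pair (0p {n}) F ≡ 0ℚ
  pair-0p F = refl
  pair-⊗ : ∀ {n} (p r : Poly n) F → pair (p ⊗ r) F ≡ pair p (λ m → pair r (λ m' → F (mulMon m m')))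
  pair-⊗ = pair-mul
  pair-⊕ : ∀ {n} (p r : Poly n) F → pair (p ⊕ r) F ≡ pair p F Q.+ pair r F
  pair-⊕ = pair-++
  pair-⊟ : ∀ {n} (p : Poly n) F → pair (⊟ p) F ≡ Q.- pair p F
  pair-⊟ = pair-neg

-- Functionals on the source are pulled back along `h⁻¹`, so a left inverse on monomials gives
-- injectivity on polynomials.
pair-injective : ∀ {n k} {f : Poly n} {g : Poly k} (h : Mon n → Mon k) (h⁻¹ : Mon k → Mon n) →
                 (∀ m → h⁻¹ (h m) ≡ m) → (∀ F → pair g F ≡ pair f (F ∘ h)) → g ≋ 0p → f ≋ 0p
pair-injective {f = f} {g} h h⁻¹ inv e g≋0 = mk≋ λ F →
  trans (pair-cong f (λ m → cong F (sym (inv m))))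
  (trans (sym (e (F ∘ h⁻¹))) (trans (pair≡ g≋0 _) (trans (pair-0p _) (sym (pair-0p F)))))

ω-injective : ∀ {n} ε {f : Poly n} → ω ε f ≋ 0p → f ≋ 0p
ω-injective {zero} ε {f} = pair-injective (rotMon ε) id (λ { (a , b , []) → refl }) (pair-ω ε f)
ω-injective {suc n} ε {f} = pair-injective (rotMon ε) (unrotMon ε) (unrot-rot ε) (pair-ω ε f)

ι-injective : ∀ {n} {c : Poly 0} → ι {n} c ≋ 0p → c ≋ 0p
ι-injective {c = c} = pair-injective embedMon (λ { (a , b , _) → a , b , [] }) (λ { (a , b , []) → refl }) (pair-ι c)

-- This is q^(εM) x₁ ω⁻¹ on monomials. By itself ω⁻¹ divides by q to the power ε times the last
-- exponent; a bound M on that exponent keeps the subtraction exact.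
raiseMon : ∀ {n} → ℕ → ℕ → Mon (suc n) → Mon (suc n)
raiseMon ε M (a , b , v) = a ℕ.+ ε ℕ.* (M ∸ V.last v) , b , suc (V.last v) ∷ V.init v

suc-last : ∀ {n} (v : Vec ℕ (suc n)) → V.init v V.∷ʳ suc (V.last v) ≡ V.zipWith ℕ._+_ (unitV n) v
suc-last (a ∷ []) = refl
suc-last (a ∷ v@(_ ∷ _)) = cong (a ∷_) (suc-last v)

rot-raise : ∀ {n} ε M (m : Mon (suc n)) → V.last (proj₂ (proj₂ m)) ≤ M →
            rotMon ε (raiseMon ε M m) ≡ mulMon (ε ℕ.* suc M , 0 , zeros) (mulMon (0 , 0 , unitV n) m)
rot-raise {n} ε M (a , b , v) le = cong₂ (λ a v → a , b , v) q-exp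
  (trans (suc-last v) (sym (Vₚ.zipWith-identityˡ ℕₚ.+-identityˡ _)))
  where
  open ≡-Reasoning
  l = V.last v
  q-exp : (a ℕ.+ ε ℕ.* (M ∸ l)) ℕ.+ ε ℕ.* suc l ≡ ε ℕ.* suc M ℕ.+ a
  q-exp = begin
    (a ℕ.+ ε ℕ.* (M ∸ l)) ℕ.+ ε ℕ.* suc l ≡⟨ ℕₚ.+-assoc a _ _ ⟩
    a ℕ.+ (ε ℕ.* (M ∸ l) ℕ.+ ε ℕ.* suc l) ≡⟨ cong (a ℕ.+_) (ℕₚ.*-distribˡ-+ ε (M ∸ l) (suc l)) ⟨
    a ℕ.+ ε ℕ.* ((M ∸ l) ℕ.+ suc l) ≡⟨ cong (λ z → a ℕ.+ ε ℕ.* z) (trans (ℕₚ.+-suc (M ∸ l) l) (cong suc (ℕₚ.m∸n+n≡m le))) ⟩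
    a ℕ.+ ε ℕ.* suc M ≡⟨ ℕₚ.+-comm a _ ⟩
    ε ℕ.* suc M ℕ.+ a ∎

pair-cong-All : ∀ {n} (p : Poly n) {F G} → All (λ cm → F (proj₂ cm) ≡ G (proj₂ cm)) p → pair p F ≡ pair p G
pair-cong-All [] [] = refl
pair-cong-All ((c , m) ∷ p) (e ∷ es) = cong₂ Q._+_ (cong (c Q.*_) e) (pair-cong-All p es)

bounded-exponents : ∀ {n} (p : Poly (suc n)) → ∃ λ M → All (λ cm → V.last (proj₂ (proj₂ (proj₂ cm))) ≤ M) p
bounded-exponents [] = 0 , []
bounded-exponents ((c , a , b , v) ∷ p) with bounded-exponents p
... | M , all = M ℕ.+ V.last v , ℕₚ.m≤n+m _ M ∷ All.map (λ le → ℕₚ.≤-trans le (ℕₚ.m≤m+n M _)) all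

raise : ∀ {n} ε (f : Poly (suc n)) → ∃ λ M → ∃ λ g → ω ε g ≋ sc M 0 ⊗ (x n ⊗ f)
raise {n} ε f with bounded-exponents f
... | M , all = ε ℕ.* suc M , mapMon (raiseMon ε M) f , mk≋ λ F →
  trans (pair-ω ε _ F) (trans (pair-mapMon (raiseMon ε M) f _)
  (trans (pair-cong-All f (All.map (λ {cm} le → cong F (rot-raise ε M (proj₂ cm) le)) all))
  (sym (trans (pair-mono-⊗ _ _ F) (pair-mono-⊗ _ f _)))))

Symmetric : ∀ {n} → Poly n → Set
Symmetric {n} f = ∀ j → suc j < n → s j f ≋ f

swaps : ∀ {n} → ℕ → ℕ → Vec ℕ n → Vec ℕ n
swaps zero    j v = v
swaps (suc k) j v = swaps k (suc j) (swapAt j v)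

swaps-∷ : ∀ {n} k j a (v : Vec ℕ n) → swaps k (suc j) (a ∷ v) ≡ a ∷ swaps k j v
swaps-∷ zero    j a v = refl
swaps-∷ (suc k) j a v = swaps-∷ k (suc j) a (swapAt j v)

swaps-rot : ∀ {n} h (w : Vec ℕ n) → swaps n 0 (h ∷ w) ≡ w V.∷ʳ h
swaps-rot h [] = refl
swaps-rot {suc n} h (y ∷ w) = trans (swaps-∷ n 0 y (h ∷ w)) (cong (y ∷_) (swaps-rot h w))

-- At ε = 0 ω is a plain cyclic shift of the variables, hence a product of adjacent transpositions,
-- each of which fixes f.
symmetric⇒ω : ∀ {n} {f : Poly n} → Symmetric f → ω 0 f ≋ f
symmetric⇒ω {zero} {f} _ = mk≋ λ F → trans (pair-ω 0 f F) (pair-cong f λ { (a , b , []) → refl })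
symmetric⇒ω {suc n} {f} sym-f = mk≋ λ F → trans (pair-ω 0 f F)
  (trans (pair-cong f (λ { (a , b , h ∷ w) → cong₂ (λ a v → F (a , b , v)) (ℕₚ.+-identityʳ a) (sym (swaps-rot h w)) }))
         (go n 0 F ℕₚ.≤-refl))
  where
  go : ∀ k j F → j ℕ.+ k ≤ n → pair f (λ { (a , b , v) → F (a , b , swaps k j v) }) ≡ pair f F
  go zero j F le = refl
  go (suc k) j F le =
    trans (sym (pair-s j f (λ { (a , b , v) → F (a , b , swaps k (suc j) v) })))
    (trans (pair≡ (sym-f j (s≤s (ℕₚ.≤-trans (s≤s (ℕₚ.m≤m+n j k)) le'))) _)
           (go k (suc j) F le'))
    where le' = subst (_≤ n) (ℕₚ.+-suc j k) le

d : ∀ {n} → ℕ → Poly n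
d j = x j ⊖′ x (suc j)

d≢0 : ∀ {n} j → suc j < n → ¬ d {n} j ≋ 0p
d≢0 j lt = mono-diff≢0 _ _ λ e → unitV-distinct j lt (cong (proj₂ ∘ proj₂) e)

Divisible : ∀ {n} → ℕ → Poly n → Set
Divisible j f = ∃ λ D → d j ⊗ D ≋ f ⊖′ s j f

module _ {n : ℕ} where
  open ≋-Reasoning {n}

  divisible-cong : ∀ j {f g : Poly n} → f ≋ g → Divisible j f → Divisible j g
  divisible-cong j e (D , eq) = D , ≋-trans eq (⊖-cong e (⟦⟧-cong (s-hom j) e))

  divisible-⊕ : ∀ j {f g : Poly n} → Divisible j f → Divisible j g → Divisible j (f ⊕ g)
  divisible-⊕ j {f} {g} (D , p) (E , q) = D ⊕ E , (begin
    d j ⊗ (D ⊕ E) ≈⟨ PR.distribˡ _ _ _ ⟩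
    d j ⊗ D ⊕ d j ⊗ E ≈⟨ ⊕-cong p q ⟩
    (f ⊖′ s j f) ⊕ (g ⊖′ s j g) ≈⟨ solve 4 (λ f f' g g' → (f :- f') :+ (g :- g') := (f :+ g) :- (f' :+ g')) ≋-refl f (s j f) g (s j g) ⟩
    (f ⊕ g) ⊖′ (s j f ⊕ s j g) ≈⟨ ⊖-cong ≋-refl (⊕-homo (s-hom j) f g) ⟨
    (f ⊕ g) ⊖′ s j (f ⊕ g) ∎)

  divisible-inv : ∀ j {c f : Poly n} → s j c ≋ c → Divisible j f → Divisible j (c ⊗ f)
  divisible-inv j {c} {f} inv (D , p) = c ⊗ D , (begin
    d j ⊗ (c ⊗ D) ≈⟨ solve 3 (λ d c D → d :* (c :* D) := c :* (d :* D)) ≋-refl (d j) c D ⟩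
    c ⊗ (d j ⊗ D) ≈⟨ ⊗-congˡ p ⟩
    c ⊗ (f ⊖′ s j f) ≈⟨ solve 3 (λ c f f' → c :* (f :- f') := c :* f :- c :* f') ≋-refl c f (s j f) ⟩
    c ⊗ f ⊖′ c ⊗ s j f ≈⟨ ⊖-cong ≋-refl (≋-trans (⊗-homo (s-hom j) c f) (⊗-congʳ inv)) ⟨
    c ⊗ f ⊖′ s j (c ⊗ f) ∎)

  -- If D is the quotient for f, a Leibniz expression in D and f is the quotient for x_k f. For k
  -- other than j and j + 1 the variable is invariant.
  divisible-x : ∀ j k {f : Poly n} → suc j < n → Divisible j f → Divisible j (x k ⊗ f)
  divisible-x j k {f} lt (D , p) with k ℕ.≟ j | k ℕ.≟ suc j
  ... | yes refl | _ = f ⊕ x (suc j) ⊗ D , (begin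
    d j ⊗ (f ⊕ x (suc j) ⊗ D)
      ≈⟨ solve 4 (λ x y f D → (x :- y) :* (f :+ y :* D) := (x :- y) :* f :+ y :* ((x :- y) :* D)) ≋-refl (x j) (x (suc j)) f D ⟩
    d j ⊗ f ⊕ x (suc j) ⊗ (d j ⊗ D) ≈⟨ ⊕-congˡ (⊗-congˡ p) ⟩
    d j ⊗ f ⊕ x (suc j) ⊗ (f ⊖′ s j f)
      ≈⟨ solve 4 (λ x y f f' → (x :- y) :* f :+ y :* (f :- f') := x :* f :- y :* f') ≋-refl (x j) (x (suc j)) f (s j f) ⟩
    x j ⊗ f ⊖′ x (suc j) ⊗ s j f ≈⟨ ⊖-cong ≋-refl (≋-trans (⊗-homo (s-hom j) _ f) (⊗-congʳ (s-x j lt))) ⟨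
    x j ⊗ f ⊖′ s j (x j ⊗ f) ∎)
  ... | no _ | yes refl = x j ⊗ D ⊖′ f , (begin
    d j ⊗ (x j ⊗ D ⊖′ f)
      ≈⟨ solve 4 (λ x y f D → (x :- y) :* (x :* D :- f) := x :* ((x :- y) :* D) :- (x :- y) :* f) ≋-refl (x j) (x (suc j)) f D ⟩
    x j ⊗ (d j ⊗ D) ⊖′ d j ⊗ f ≈⟨ ⊖-cong (⊗-congˡ p) ≋-refl ⟩
    x j ⊗ (f ⊖′ s j f) ⊖′ d j ⊗ f
      ≈⟨ solve 4 (λ x y f f' → x :* (f :- f') :- (x :- y) :* f := y :* f :- x :* f') ≋-refl (x j) (x (suc j)) f (s j f) ⟩
    x (suc j) ⊗ f ⊖′ x j ⊗ s j f ≈⟨ ⊖-cong ≋-refl (≋-trans (⊗-homo (s-hom j) _ f) (⊗-congʳ (s-x-suc j lt))) ⟨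
    x (suc j) ⊗ f ⊖′ s j (x (suc j) ⊗ f) ∎)
  ... | no k≢j | no k≢sj = divisible-inv j (s-x-fixed j k k≢j k≢sj) (D , p)

  divisible-invariant : ∀ j {f : Poly n} → s j f ≋ f → Divisible j f
  divisible-invariant j {f} inv = 0p , ≋-trans (⊗-zeroʳ _) (≋-sym (≋⇒⊖≋0 (≋-sym inv)))

zeros-or-unit : ∀ {n} (v : Vec ℕ n) → v ≡ zeros ⊎ (∃ λ k → ∃ λ w → v ≡ V.zipWith ℕ._+_ (unitV k) w × V.sum v ≡ suc (V.sum w))
zeros-or-unit [] = inj₁ refl
zeros-or-unit (suc a ∷ v) = inj₂ (0 , a ∷ v , cong (suc a ∷_) (sym (Vₚ.zipWith-identityˡ ℕₚ.+-identityˡ v)) , refl)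
zeros-or-unit (zero ∷ v) with zeros-or-unit v
... | inj₁ refl = inj₁ refl
... | inj₂ (k , w , e , f) = inj₂ (suc k , 0 ∷ w , cong (0 ∷_) e , f)

divisible-mono : ∀ {n} j → suc j < n → ∀ N a b (v : Vec ℕ n) → V.sum v ≤ N → Divisible j (mono (a , b , v))
divisible-mono j lt N a b v le with zeros-or-unit v
... | inj₁ refl = divisible-invariant j (s-sc j a b)
divisible-mono j lt zero a b v le | inj₂ (k , w , e , f) with subst (_≤ 0) f le
... | ()
divisible-mono {n} j lt (suc N) a b v le | inj₂ (k , w , refl , f) =
  divisible-cong j (mono-⊗ (0 , 0 , unitV k) (a , b , w))
    (divisible-x j k lt (divisible-mono j lt N a b w (ℕₚ.≤-pred (subst (_≤ suc N) f le))))

opaque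
  unfolding s
  term-⊗ : ∀ {n} c (m : Mon n) → ((c , 0 , 0 , zeros) ∷ []) ⊗ mono m ≋ (c , m) ∷ []
  term-⊗ c m@(a , b , v) = mk≋ λ F → trans (pair-⊗ ((c , 0 , 0 , zeros) ∷ []) (mono m) F)
    (trans (Qₚ.+-identityʳ _) (trans (cong (c Q.*_) (trans (Qₚ.+-identityʳ _) (Qₚ.*-identityˡ _)))
    (trans (cong (λ k → c Q.* F k) (mulMon-identityˡ m)) (sym (Qₚ.+-identityʳ _)))))

  term-inv : ∀ {n} j c → s {n} j ((c , 0 , 0 , zeros) ∷ []) ≋ (c , 0 , 0 , zeros) ∷ []
  term-inv j c = ≋-reflexive (cong (λ v → (c , 0 , 0 , v) ∷ []) (swapAt-zeros j))

  cons-⊕ : ∀ {n} c (m : Mon n) f → ((c , m) ∷ []) ⊕ f ≋ (c , m) ∷ f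
  cons-⊕ c m f = mk≋ λ F → trans (pair-⊕ ((c , m) ∷ []) f F) (cong (Q._+ pair f F) (Qₚ.+-identityʳ (c Q.* F m)))

divisible : ∀ {n} j → suc j < n → (f : Poly n) → Divisible j f
divisible j lt [] = divisible-cong j 0p≋[] (divisible-invariant j (0-homo (s-hom j)))
divisible j lt ((c , m@(a , b , v)) ∷ f) = divisible-cong j (cons-⊕ c m f)
  (divisible-⊕ j (divisible-cong j (term-⊗ c m) (divisible-inv j (term-inv j c) (divisible-mono j lt (V.sum v) a b v ℕₚ.≤-refl)))
                 (divisible j lt f))

-- Demazure–Lusztig operators

opaque
  -- The value 0 for j out of range permits plain natural numbers as indices; the laws carry the
  -- bound.
  ∂ : ∀ {n} → ℕ → Poly n → Poly n
  ∂ {n} j f with suc j ℕ.<? n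
  ... | yes lt = proj₁ (divisible j lt f)
  ... | no _   = 0p

  ∂-eq : ∀ {n} j (f : Poly n) → suc j < n → d j ⊗ ∂ j f ≋ f ⊖′ s j f
  ∂-eq {n} j f lt with suc j ℕ.<? n
  ... | yes lt′ = proj₂ (divisible j lt′ f)
  ... | no ¬lt  = ⊥-elim (¬lt lt)

t : ∀ {n} → Poly n
t = sc 0 1

-- The numerator of the coefficient in L, with indices from 0: `c j ⊗ ∂ j f` is L_{j+1} f with the
-- denominator already divided out.
c : ∀ {n} → ℕ → Poly n
c j = t ⊗ x j ⊖′ x (suc j)

-- τ j = t T_j⁻¹
T′ τ : ∀ {n} → ℕ → Poly n → Poly n
T′ j f = t ⊗ f ⊖′ c j ⊗ ∂ j f
τ j f = f ⊖′ c j ⊗ ∂ j f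

module _ {n : ℕ} where
  open ≋-Reasoning {n}

  s-cong : ∀ j {f g : Poly n} → f ≋ g → s j f ≋ s j g
  s-cong j = ⟦⟧-cong (s-hom j)

  s-⊗ : ∀ j (f g : Poly n) → s j (f ⊗ g) ≋ s j f ⊗ s j g
  s-⊗ j = ⊗-homo (s-hom j)

  s-⊖ : ∀ j (f g : Poly n) → s j (f ⊖′ g) ≋ s j f ⊖′ s j g
  s-⊖ j = ⊖-homo (s-hom j)

  s-d : ∀ j → suc j < n → s {n} j (d j) ≋ ⊟ d j
  s-d j lt = ≋-trans (s-⊖ j _ _) (≋-trans (⊖-cong (s-x j lt) (s-x-suc j lt))
    (solve 2 (λ x y → y :- x := :- (x :- y)) ≋-refl (x j) (x (suc j))))

  -- The quotient chosen by `divisible` depends on the list that presents f, so even `∂-cong` is not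
  -- automatic. Since `d j` can be cancelled, an identity for `∂` may be checked after
  -- multiplication by `d j`.
  ∂-unique : ∀ j {f g : Poly n} → suc j < n → d j ⊗ g ≋ f ⊖′ s j f → ∂ j f ≋ g
  ∂-unique j lt e = ⊗-cancelˡ (d≢0 j lt) (≋-trans (∂-eq j _ lt) (≋-sym e))

  ∂-cong : ∀ j {f g : Poly n} → suc j < n → f ≋ g → ∂ j f ≋ ∂ j g
  ∂-cong j {f} {g} lt e = ∂-unique j lt (≋-trans (∂-eq j g lt) (⊖-cong (≋-sym e) (s-cong j (≋-sym e))))

  ∂-⊖ : ∀ j (f g : Poly n) → suc j < n → ∂ j (f ⊖′ g) ≋ ∂ j f ⊖′ ∂ j g
  ∂-⊖ j f g lt = ∂-unique j lt (begin
    d j ⊗ (∂ j f ⊖′ ∂ j g) ≈⟨ solve 3 (λ d a b → d :* (a :- b) := d :* a :- d :* b) ≋-refl (d j) (∂ j f) (∂ j g) ⟩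
    d j ⊗ ∂ j f ⊖′ d j ⊗ ∂ j g ≈⟨ ⊖-cong (∂-eq j f lt) (∂-eq j g lt) ⟩
    (f ⊖′ s j f) ⊖′ (g ⊖′ s j g) ≈⟨ solve 4 (λ f f' g g' → (f :- f') :- (g :- g') := (f :- g) :- (f' :- g')) ≋-refl f (s j f) g (s j g) ⟩
    (f ⊖′ g) ⊖′ (s j f ⊖′ s j g) ≈⟨ ⊖-cong ≋-refl (s-⊖ j f g) ⟨
    (f ⊖′ g) ⊖′ s j (f ⊖′ g) ∎)

  ∂-⊕ : ∀ j (f g : Poly n) → suc j < n → ∂ j (f ⊕ g) ≋ ∂ j f ⊕ ∂ j g
  ∂-⊕ j f g lt = ∂-unique j lt (begin
    d j ⊗ (∂ j f ⊕ ∂ j g) ≈⟨ solve 3 (λ d a b → d :* (a :+ b) := d :* a :+ d :* b) ≋-refl (d j) (∂ j f) (∂ j g) ⟩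
    d j ⊗ ∂ j f ⊕ d j ⊗ ∂ j g ≈⟨ ⊕-cong (∂-eq j f lt) (∂-eq j g lt) ⟩
    (f ⊖′ s j f) ⊕ (g ⊖′ s j g) ≈⟨ solve 4 (λ f f' g g' → (f :- f') :+ (g :- g') := (f :+ g) :- (f' :+ g')) ≋-refl f (s j f) g (s j g) ⟩
    (f ⊕ g) ⊖′ (s j f ⊕ s j g) ≈⟨ ⊖-cong ≋-refl (⊕-homo (s-hom j) f g) ⟨
    (f ⊕ g) ⊖′ s j (f ⊕ g) ∎)

  -- The twisted product rule. Here a' = s_j a and k = ∂_j a are passed in closed form, so that no
  -- uncomputed quotient of a is left behind.
  ∂-leibniz : ∀ j {a a' k : Poly n} g → suc j < n → s j a ≋ a' → a ⊖′ a' ≋ d j ⊗ k →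
              ∂ j (a ⊗ g) ≋ k ⊗ g ⊕ a' ⊗ ∂ j g
  ∂-leibniz j {a} {a'} {k} g lt sa ka = ∂-unique j lt (begin
    d j ⊗ (k ⊗ g ⊕ a' ⊗ ∂ j g) ≈⟨ solve 5 (λ d k g a' D → d :* (k :* g :+ a' :* D) := (d :* k) :* g :+ a' :* (d :* D)) ≋-refl (d j) k g a' (∂ j g) ⟩
    (d j ⊗ k) ⊗ g ⊕ a' ⊗ (d j ⊗ ∂ j g) ≈⟨ ⊕-cong (⊗-congʳ (≋-sym ka)) (⊗-congˡ (∂-eq j g lt)) ⟩
    (a ⊖′ a') ⊗ g ⊕ a' ⊗ (g ⊖′ s j g) ≈⟨ solve 4 (λ a a' g h → (a :- a') :* g :+ a' :* (g :- h) := a :* g :- a' :* h) ≋-refl a a' g (s j g) ⟩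
    a ⊗ g ⊖′ a' ⊗ s j g ≈⟨ ⊖-cong ≋-refl (≋-trans (s-⊗ j a g) (⊗-congʳ sa)) ⟨
    a ⊗ g ⊖′ s j (a ⊗ g) ∎)

  ∂-linear : ∀ j {a : Poly n} g → suc j < n → s j a ≋ a → ∂ j (a ⊗ g) ≋ a ⊗ ∂ j g
  ∂-linear j {a} g lt sa = ≋-trans (∂-leibniz j {a} {a} {0p} g lt sa (≋-trans (≋⇒⊖≋0 ≋-refl) (≋-sym (⊗-zeroʳ _))))
    (≋-trans (⊕-congʳ (⊗-zeroˡ g)) (⊕-identityˡ _))

  ∂-invariant : ∀ j {f : Poly n} → suc j < n → s j f ≋ f → ∂ j f ≋ 0p
  ∂-invariant j lt e = ∂-unique j lt (≋-trans (⊗-zeroʳ _) (≋-sym (≋⇒⊖≋0 (≋-sym e))))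

  s-∂ : ∀ j (f : Poly n) → suc j < n → s j (∂ j f) ≋ ∂ j f
  s-∂ j f lt = ⊗-cancelˡ (d≢0 j lt) (begin
    d j ⊗ s j (∂ j f) ≈⟨ solve 2 (λ d f → d :* f := :- ((:- d) :* f)) ≋-refl (d j) (s j (∂ j f)) ⟩
    ⊟ (⊟ d j ⊗ s j (∂ j f)) ≈⟨ ⊟-cong (≋-trans (s-⊗ j _ _) (⊗-congʳ (s-d j lt))) ⟨
    ⊟ s j (d j ⊗ ∂ j f) ≈⟨ ⊟-cong (≋-trans (s-cong j (∂-eq j f lt)) (≋-trans (s-⊖ j f _) (⊖-cong ≋-refl (s-involutive j f)))) ⟩
    ⊟ (s j f ⊖′ f) ≈⟨ solve 2 (λ f g → :- (g :- f) := f :- g) ≋-refl f (s j f) ⟩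
    f ⊖′ s j f ≈⟨ ∂-eq j f lt ⟨
    d j ⊗ ∂ j f ∎)

  ∂∂ : ∀ j (f : Poly n) → suc j < n → ∂ j (∂ j f) ≋ 0p
  ∂∂ j f lt = ∂-invariant j lt (s-∂ j f lt)

  s-t : ∀ j → s {n} j t ≋ t
  s-t j = s-sc j 0 1

  s-c : ∀ j → suc j < n → s {n} j (c j) ≋ t ⊗ x (suc j) ⊖′ x j
  s-c j lt = ≋-trans (s-⊖ j _ _) (⊖-cong (≋-trans (s-⊗ j _ _) (⊗-cong (s-t j) (s-x j lt))) (s-x-suc j lt))

  -- ∂_j c_j = t + 1, and ∂_j g is s_j-invariant, so the second Leibniz term drops out. This is the
  -- source of the Hecke relation (T_j - t) (T_j + 1) = 0.
  ∂-c : ∀ j g → suc j < n → ∂ {n} j (c j ⊗ ∂ j g) ≋ (t ⊕ 1p) ⊗ ∂ j g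
  ∂-c j g lt = begin
    ∂ j (c j ⊗ ∂ j g) ≈⟨ ∂-leibniz j (∂ j g) lt (s-c j lt)
      (solve 3 (λ t x y → (t :* x :- y) :- (t :* y :- x) := (x :- y) :* (t :+ :1)) ≋-refl t (x j) (x (suc j))) ⟩
    (t ⊕ 1p) ⊗ ∂ j g ⊕ (t ⊗ x (suc j) ⊖′ x j) ⊗ ∂ j (∂ j g) ≈⟨ ⊕-congˡ (≋-trans (⊗-congˡ (∂∂ j g lt)) (⊗-zeroʳ _)) ⟩
    (t ⊕ 1p) ⊗ ∂ j g ⊕ 0p ≈⟨ ⊕-identityʳ _ ⟩
    (t ⊕ 1p) ⊗ ∂ j g ∎

  T-cong : ∀ j {f g : Poly n} → suc j < n → f ≋ g → T′ j f ≋ T′ j g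
  T-cong j lt e = ⊖-cong (⊗-congˡ e) (⊗-congˡ (∂-cong j lt e))

  τ-cong : ∀ j {f g : Poly n} → suc j < n → f ≋ g → τ j f ≋ τ j g
  τ-cong j lt e = ⊖-cong e (⊗-congˡ (∂-cong j lt e))

  τ-T : ∀ j (f : Poly n) → τ j f ≋ T′ j f ⊕ (1p ⊖′ t) ⊗ f
  τ-T j f = solve 3 (λ t f b → f :- b := (t :* f :- b) :+ (:1 :- t) :* f) ≋-refl t f (c j ⊗ ∂ j f)

  ∂-T : ∀ j (f : Poly n) → suc j < n → ∂ j (T′ j f) ≋ ⊟ ∂ j f
  ∂-T j f lt = begin
    ∂ j (t ⊗ f ⊖′ c j ⊗ ∂ j f) ≈⟨ ∂-⊖ j _ _ lt ⟩
    ∂ j (t ⊗ f) ⊖′ ∂ j (c j ⊗ ∂ j f) ≈⟨ ⊖-cong (∂-linear j f lt (s-t j)) (∂-c j f lt) ⟩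
    t ⊗ ∂ j f ⊖′ (t ⊕ 1p) ⊗ ∂ j f ≈⟨ solve 2 (λ t D → t :* D :- (t :+ :1) :* D := :- D) ≋-refl t (∂ j f) ⟩
    ⊟ ∂ j f ∎

  T-quadratic : ∀ j (f : Poly n) → suc j < n → T′ j (T′ j f) ≋ (t ⊖′ 1p) ⊗ T′ j f ⊕ t ⊗ f
  T-quadratic j f lt = ≋-trans (⊖-cong ≋-refl (⊗-congˡ (∂-T j f lt)))
    (solve 4 (λ t f c D → t :* (t :* f :- c :* D) :- c :* (:- D) := (t :- :1) :* (t :* f :- c :* D) :+ t :* f)
      ≋-refl t f (c j) (∂ j f))

  T-linear : ∀ j {a : Poly n} f → suc j < n → s j a ≋ a → T′ j (a ⊗ f) ≋ a ⊗ T′ j f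
  T-linear j {a} f lt sa = ≋-trans (⊖-cong ≋-refl (⊗-congˡ (∂-linear j f lt sa)))
    (solve 5 (λ t a f c D → t :* (a :* f) :- c :* (a :* D) := a :* (t :* f :- c :* D)) ≋-refl t a f (c j) (∂ j f))

  τ-linear : ∀ j {a : Poly n} f → suc j < n → s j a ≋ a → τ j (a ⊗ f) ≋ a ⊗ τ j f
  τ-linear j {a} f lt sa = ≋-trans (⊖-cong ≋-refl (⊗-congˡ (∂-linear j f lt sa)))
    (solve 4 (λ a f c D → a :* f :- c :* (a :* D) := a :* (f :- c :* D)) ≋-refl a f (c j) (∂ j f))

  T-⊕ : ∀ j (f g : Poly n) → suc j < n → T′ j (f ⊕ g) ≋ T′ j f ⊕ T′ j g
  T-⊕ j f g lt = ≋-trans (⊖-cong ≋-refl (⊗-congˡ (∂-⊕ j f g lt)))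
    (solve 6 (λ t f g c D E → t :* (f :+ g) :- c :* (D :+ E) := (t :* f :- c :* D) :+ (t :* g :- c :* E))
      ≋-refl t f g (c j) (∂ j f) (∂ j g))

  T-τ : ∀ j (f : Poly n) → suc j < n → T′ j (τ j f) ≋ t ⊗ f
  T-τ j f lt = ≋-trans (⊖-cong ≋-refl (⊗-congˡ (≋-trans (∂-⊖ j _ _ lt) (⊖-cong ≋-refl (∂-c j f lt)))))
    (solve 4 (λ t f c D → t :* (f :- c :* D) :- c :* (D :- (t :+ :1) :* D) := t :* f) ≋-refl t f (c j) (∂ j f))

  -- With `τ-x` this is the exchange rule between Hecke generators and variables: a variable that
  -- crosses T_j moves by one index and turns T_j into t T_j⁻¹, or back.
  T-x : ∀ j (f : Poly n) → suc j < n → T′ j (x j ⊗ f) ≋ x (suc j) ⊗ τ j f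
  T-x j f lt = ≋-trans (⊖-cong ≋-refl (⊗-congˡ (∂-leibniz j {x j} {x (suc j)} {1p} f lt (s-x j lt)
      (solve 2 (λ x y → x :- y := (x :- y) :* :1) ≋-refl (x j) (x (suc j))))))
    (solve 5 (λ t x y f D → t :* (x :* f) :- (t :* x :- y) :* (:1 :* f :+ y :* D) := y :* (f :- (t :* x :- y) :* D))
      ≋-refl t (x j) (x (suc j)) f (∂ j f))

  τ-x : ∀ j (f : Poly n) → suc j < n → τ j (x (suc j) ⊗ f) ≋ x j ⊗ T′ j f
  τ-x j f lt = ≋-trans (⊖-cong ≋-refl (⊗-congˡ (∂-leibniz j {x (suc j)} {x j} {⊟ 1p} f lt (s-x-suc j lt)
      (solve 2 (λ x y → y :- x := (x :- y) :* (:- :1)) ≋-refl (x j) (x (suc j))))))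
    (solve 5 (λ t x y f D → y :* f :- (t :* x :- y) :* ((:- :1) :* f :+ x :* D) := x :* (t :* f :- (t :* x :- y) :* D))
      ≋-refl t (x j) (x (suc j)) f (∂ j f))

  s-x-far : ∀ j k → suc (suc j) ≤ k → s {n} j (x k) ≋ x k
  s-x-far j k le = s-x-fixed j k (λ { refl → ℕₚ.<-irrefl refl (ℕₚ.<⇒≤ le) }) (λ { refl → ℕₚ.<-irrefl refl le })

  s-x-below : ∀ j k → suc k ≤ j → s {n} j (x k) ≋ x k
  s-x-below j k le = s-x-fixed j k (λ { refl → ℕₚ.<-irrefl refl le }) (λ { refl → ℕₚ.<-irrefl refl (ℕₚ.<⇒≤ le) })

  -- ∂_p ∂_q ∂_p times the Vandermonde product is the antisymmetriser over S₃, which is symmetric in p and q.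
  ∂-antisym : ∀ p q (e f : Poly n) → suc p < n → suc q < n → e ≋ d p ⊕ d q →
              s q (d p) ≋ e → s p (d q) ≋ e → s p e ≋ d q →
              (d p ⊗ d q ⊗ e) ⊗ ∂ p (∂ q (∂ p f)) ≋
              ((f ⊖′ s p f) ⊖′ s q f ⊕ s q (s p f)) ⊕ s p (s q f) ⊖′ s p (s q (s p f))
  ∂-antisym p q e f ltp ltq e≋ qdp pdq pe = ⊗-cancelˡ (d≢0 p ltp) (begin
    d p ⊗ ((d p ⊗ d q ⊗ e) ⊗ ∂ p b)
      ≈⟨ solve 4 (λ u v e h → u :* ((u :* v :* e) :* h) := (u :* v :* e) :* (u :* h)) ≋-refl (d p) (d q) e (∂ p b) ⟩
    (d p ⊗ d q ⊗ e) ⊗ (d p ⊗ ∂ p b) ≈⟨ ⊗-congˡ (∂-eq p b ltp) ⟩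
    (d p ⊗ d q ⊗ e) ⊗ (b ⊖′ s p b)
      ≈⟨ solve 5 (λ u v e b b' → (u :* v :* e) :* (b :- b') := (u :* v :* e) :* b :+ ((:- u) :* e :* v) :* b') ≋-refl (d p) (d q) e b (s p b) ⟩
    (d p ⊗ d q ⊗ e) ⊗ b ⊕ (⊟ d p ⊗ e ⊗ d q) ⊗ s p b ≈⟨ ⊕-cong eq4 eq5 ⟩
    (e ⊗ (f ⊖′ f1) ⊖′ d p ⊗ (f2 ⊖′ f21)) ⊕ (d q ⊗ (f1 ⊖′ f) ⊖′ ⊟ d p ⊗ (f12 ⊖′ f121))
      ≈⟨ ⊕-congʳ (⊖-cong (⊗-congʳ e≋) ≋-refl) ⟩
    ((d p ⊕ d q) ⊗ (f ⊖′ f1) ⊖′ d p ⊗ (f2 ⊖′ f21)) ⊕ (d q ⊗ (f1 ⊖′ f) ⊖′ ⊟ d p ⊗ (f12 ⊖′ f121))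
      ≈⟨ solve 8 (λ u v f f1 f2 f21 f12 f121 →
           ((u :+ v) :* (f :- f1) :- u :* (f2 :- f21)) :+ (v :* (f1 :- f) :- (:- u) :* (f12 :- f121)) :=
           u :* (((f :- f1) :- f2 :+ f21) :+ f12 :- f121)) ≋-refl (d p) (d q) f f1 f2 f21 f12 f121 ⟩
    d p ⊗ (((f ⊖′ f1) ⊖′ f2 ⊕ f21) ⊕ f12 ⊖′ f121) ∎)
    where
    a = ∂ p f
    b = ∂ q a
    f1 = s p f
    f2 = s q f
    f21 = s q (s p f)
    f12 = s p (s q f)
    f121 = s p (s q (s p f))
    eq2 : e ⊗ s q a ≋ f2 ⊖′ f21
    eq2 = ≋-trans (⊗-congʳ (≋-sym qdp)) (≋-trans (≋-sym (s-⊗ q _ _)) (≋-trans (s-cong q (∂-eq p f ltp)) (s-⊖ q f f1)))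
    eq4 : (d p ⊗ d q ⊗ e) ⊗ b ≋ e ⊗ (f ⊖′ f1) ⊖′ d p ⊗ (f2 ⊖′ f21)
    eq4 = begin
      (d p ⊗ d q ⊗ e) ⊗ b ≈⟨ solve 4 (λ u v e b → (u :* v :* e) :* b := (u :* e) :* (v :* b)) ≋-refl (d p) (d q) e b ⟩
      (d p ⊗ e) ⊗ (d q ⊗ b) ≈⟨ ⊗-congˡ (∂-eq q a ltq) ⟩
      (d p ⊗ e) ⊗ (a ⊖′ s q a) ≈⟨ solve 4 (λ u e a a' → (u :* e) :* (a :- a') := e :* (u :* a) :- u :* (e :* a')) ≋-refl (d p) e a (s q a) ⟩
      e ⊗ (d p ⊗ a) ⊖′ d p ⊗ (e ⊗ s q a) ≈⟨ ⊖-cong (⊗-congˡ (∂-eq p f ltp)) (⊗-congˡ eq2) ⟩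
      e ⊗ (f ⊖′ f1) ⊖′ d p ⊗ (f2 ⊖′ f21) ∎
    -- This is `eq4` under s_p, which negates `d p` and exchanges `d q` with e.
    eq5 : (⊟ d p ⊗ e ⊗ d q) ⊗ s p b ≋ d q ⊗ (f1 ⊖′ f) ⊖′ ⊟ d p ⊗ (f12 ⊖′ f121)
    eq5 = begin
      (⊟ d p ⊗ e ⊗ d q) ⊗ s p b ≈⟨ ⊗-congʳ (⊗-cong (⊗-cong (s-d p ltp) pdq) pe) ⟨
      (s p (d p) ⊗ s p (d q) ⊗ s p e) ⊗ s p b ≈⟨ ⊗-congʳ (≋-trans (s-⊗ p _ e) (⊗-congʳ (s-⊗ p _ _))) ⟨
      s p (d p ⊗ d q ⊗ e) ⊗ s p b ≈⟨ s-⊗ p _ b ⟨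
      s p ((d p ⊗ d q ⊗ e) ⊗ b) ≈⟨ s-cong p eq4 ⟩
      s p (e ⊗ (f ⊖′ f1) ⊖′ d p ⊗ (f2 ⊖′ f21)) ≈⟨ ≋-trans (s-⊖ p _ _) (⊖-cong (s-⊗ p _ _) (s-⊗ p _ _)) ⟩
      s p e ⊗ s p (f ⊖′ f1) ⊖′ s p (d p) ⊗ s p (f2 ⊖′ f21)
        ≈⟨ ⊖-cong (⊗-cong pe (≋-trans (s-⊖ p _ _) (⊖-cong ≋-refl (s-involutive p f)))) (⊗-cong (s-d p ltp) (s-⊖ p _ _)) ⟩
      d q ⊗ (f1 ⊖′ f) ⊖′ ⊟ d p ⊗ (f12 ⊖′ f121) ∎

  module Braid (j : ℕ) (lt₂ : suc (suc j) < n) where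
    private
      k = suc j
      lt₁ : suc j < n
      lt₁ = ℕₚ.<⇒≤ lt₂
      X Y Z e c₁₃ : Poly n
      X = x j
      Y = x k
      Z = x (suc k)
      e = X ⊖′ Z
      c₁₃ = t ⊗ X ⊖′ Z
      sjZ : s j Z ≋ Z
      sjZ = s-x-far j (suc k) ℕₚ.≤-refl
      skX : s k X ≋ X
      skX = s-x-below k j ℕₚ.≤-refl
      e≢0 : ¬ e ≋ 0p
      e≢0 e≋0 = d≢0 j lt₁ (≋-trans (≋-sym (≋-trans (s-⊖ k X Z) (⊖-cong skX (s-x-suc k lt₂)))) (≋-trans (s-cong k e≋0) (0-homo (s-hom k))))

    ∂-braid : ∀ f → ∂ j (∂ k (∂ j f)) ≋ ∂ k (∂ j (∂ k f))
    ∂-braid f = ⊗-cancelˡ (⊗-≢0 (⊗-≢0 (d≢0 j lt₁) (d≢0 k lt₂)) e≢0) (begin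
      (d j ⊗ d k ⊗ e) ⊗ ∂ j (∂ k (∂ j f))
        ≈⟨ ∂-antisym j k e f lt₁ lt₂ (solve 3 (λ x y z → x :- z := (x :- y) :+ (y :- z)) ≋-refl X Y Z)
             (≋-trans (s-⊖ k X Y) (⊖-cong skX (s-x k lt₂)))
             (≋-trans (s-⊖ j Y Z) (⊖-cong (s-x-suc j lt₁) sjZ))
             (≋-trans (s-⊖ j X Z) (⊖-cong (s-x j lt₁) sjZ)) ⟩
      ((f ⊖′ s j f) ⊖′ s k f ⊕ s k (s j f)) ⊕ s j (s k f) ⊖′ s j (s k (s j f))
        ≈⟨ ⊖-cong (solve 5 (λ f a b c d → ((f :- a) :- b :+ c) :+ d := ((f :- b) :- a :+ d) :+ c) ≋-refl f (s j f) (s k f) (s k (s j f)) (s j (s k f)))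
                  (s-braid j f lt₂) ⟩
      ((f ⊖′ s k f) ⊖′ s j f ⊕ s j (s k f)) ⊕ s k (s j f) ⊖′ s k (s j (s k f))
        ≈⟨ ∂-antisym k j e f lt₂ lt₁ (solve 3 (λ x y z → x :- z := (y :- z) :+ (x :- y)) ≋-refl X Y Z)
             (≋-trans (s-⊖ j Y Z) (⊖-cong (s-x-suc j lt₁) sjZ))
             (≋-trans (s-⊖ k X Y) (⊖-cong skX (s-x k lt₂)))
             (≋-trans (s-⊖ k X Z) (⊖-cong skX (s-x-suc k lt₂))) ⟨
      (d k ⊗ d j ⊗ e) ⊗ ∂ k (∂ j (∂ k f))
        ≈⟨ ⊗-congʳ (⊗-congʳ (⊗-comm (d k) (d j))) ⟩
      (d j ⊗ d k ⊗ e) ⊗ ∂ k (∂ j (∂ k f)) ∎)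

    private
      ∂j-ck : ∀ g → ∂ j (c k ⊗ g) ≋ ⊟ t ⊗ g ⊕ c₁₃ ⊗ ∂ j g
      ∂j-ck g = ∂-leibniz j g lt₁ (≋-trans (s-⊖ j _ Z) (⊖-cong (≋-trans (s-⊗ j _ _) (⊗-cong (s-t j) (s-x-suc j lt₁))) sjZ))
        (solve 4 (λ t x y z → (t :* y :- z) :- (t :* x :- z) := (x :- y) :* (:- t)) ≋-refl t X Y Z)

      ∂k-cj : ∀ g → ∂ k (c j ⊗ g) ≋ ⊟ 1p ⊗ g ⊕ c₁₃ ⊗ ∂ k g
      ∂k-cj g = ∂-leibniz k g lt₂ (≋-trans (s-⊖ k _ Y) (⊖-cong (≋-trans (s-⊗ k _ _) (⊗-cong (s-t k) skX)) (s-x k lt₂)))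
        (solve 4 (λ t x y z → (t :* x :- y) :- (t :* x :- z) := (y :- z) :* (:- :1)) ≋-refl t X Y Z)

      ∂j-c₁₃ : ∀ g → ∂ j (c₁₃ ⊗ g) ≋ t ⊗ g ⊕ c k ⊗ ∂ j g
      ∂j-c₁₃ g = ∂-leibniz j g lt₁ (≋-trans (s-⊖ j _ Z) (⊖-cong (≋-trans (s-⊗ j _ _) (⊗-cong (s-t j) (s-x j lt₁))) sjZ))
        (solve 4 (λ t x y z → (t :* x :- z) :- (t :* y :- z) := (x :- y) :* t) ≋-refl t X Y Z)

      ∂k-c₁₃ : ∀ g → ∂ k (c₁₃ ⊗ g) ≋ 1p ⊗ g ⊕ c j ⊗ ∂ k g
      ∂k-c₁₃ g = ∂-leibniz k g lt₂ (≋-trans (s-⊖ k _ Z) (⊖-cong (≋-trans (s-⊗ k _ _) (⊗-cong (s-t k) skX)) (s-x-suc k lt₂)))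
        (solve 4 (λ t x y z → (t :* x :- z) :- (t :* x :- y) := (y :- z) :* :1) ≋-refl t X Y Z)

    module _ (f : Poly n) where
      private
        A₁ A₂ A₂₁ A₁₂ A₁₂₁ A₂₁₂ h h' : Poly n
        A₁ = ∂ j f
        A₂ = ∂ k f
        A₂₁ = ∂ k A₁
        A₁₂ = ∂ j A₂
        A₁₂₁ = ∂ j A₂₁
        A₂₁₂ = ∂ k A₁₂
        h = t ⊗ A₂ ⊖′ (⊟ 1p ⊗ A₁ ⊕ c₁₃ ⊗ A₂₁)
        h' = t ⊗ A₁ ⊖′ (⊟ t ⊗ A₂ ⊕ c₁₃ ⊗ A₁₂)

        ∂kTj : ∂ k (T′ j f) ≋ h
        ∂kTj = ≋-trans (∂-⊖ k _ _ lt₂) (⊖-cong (∂-linear k f lt₂ (s-t k)) (∂k-cj A₁))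

        ∂jTk : ∂ j (T′ k f) ≋ h'
        ∂jTk = ≋-trans (∂-⊖ j _ _ lt₁) (⊖-cong (∂-linear j f lt₁ (s-t j)) (∂j-ck A₂))

        ∂h : ∂ j h ≋ t ⊗ A₁₂ ⊖′ (⊟ 1p ⊗ 0p ⊕ (t ⊗ A₂₁ ⊕ c k ⊗ A₁₂₁))
        ∂h = ≋-trans (∂-⊖ j _ _ lt₁) (⊖-cong (∂-linear j A₂ lt₁ (s-t j))
          (≋-trans (∂-⊕ j _ _ lt₁) (⊕-cong (≋-trans (∂-linear j A₁ lt₁ (≋-trans (⊟-homo (s-hom j) 1p) (⊟-cong (1-homo (s-hom j)))))
                                                    (⊗-congˡ (∂∂ j f lt₁)))
                                           (∂j-c₁₃ A₂₁))))

        ∂h' : ∂ k h' ≋ t ⊗ A₂₁ ⊖′ (⊟ t ⊗ 0p ⊕ (1p ⊗ A₁₂ ⊕ c j ⊗ A₂₁₂))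
        ∂h' = ≋-trans (∂-⊖ k _ _ lt₂) (⊖-cong (∂-linear k A₁ lt₂ (s-t k))
          (≋-trans (∂-⊕ k _ _ lt₂) (⊕-cong (≋-trans (∂-linear k A₂ lt₂ (≋-trans (⊟-homo (s-hom k) t) (⊟-cong (s-t k))))
                                                    (⊗-congˡ (∂∂ k f lt₂)))
                                           (∂k-c₁₃ A₁₂))))

        kT : T′ k (T′ j f) ≋ t ⊗ T′ j f ⊖′ c k ⊗ h
        kT = ⊖-cong ≋-refl (⊗-congˡ ∂kTj)

        jT : T′ j (T′ k f) ≋ t ⊗ T′ k f ⊖′ c j ⊗ h'
        jT = ⊖-cong ≋-refl (⊗-congˡ ∂jTk)

        ∂kT : ∂ j (t ⊗ T′ j f ⊖′ c k ⊗ h) ≋ t ⊗ ⊟ A₁ ⊖′ (⊟ t ⊗ h ⊕ c₁₃ ⊗ ∂ j h)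
        ∂kT = ≋-trans (∂-⊖ j _ _ lt₁) (⊖-cong (≋-trans (∂-linear j _ lt₁ (s-t j)) (⊗-congˡ (∂-T j f lt₁))) (∂j-ck h))

        ∂jT : ∂ k (t ⊗ T′ k f ⊖′ c j ⊗ h') ≋ t ⊗ ⊟ A₂ ⊖′ (⊟ 1p ⊗ h' ⊕ c₁₃ ⊗ ∂ k h')
        ∂jT = ≋-trans (∂-⊖ k _ _ lt₂) (⊖-cong (≋-trans (∂-linear k _ lt₂ (s-t k)) (⊗-congˡ (∂-T k f lt₂))) (∂k-cj h'))

        -- The common value of both sides, expanded in the words in ∂_j and ∂_k with coefficients on
        -- the left. The longest word has two spellings, which `∂-braid` identifies.
        normal : Poly n
        normal = (t ⊗ t ⊗ t ⊗ f ⊖′ t ⊗ t ⊗ c j ⊗ A₁) ⊖′ t ⊗ c k ⊗ (t ⊗ A₂ ⊕ A₁ ⊖′ c₁₃ ⊗ A₂₁)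
               ⊖′ c j ⊗ (t ⊗ t ⊗ A₂ ⊖′ t ⊗ c₁₃ ⊗ A₁₂ ⊕ c₁₃ ⊗ c k ⊗ A₁₂₁)

        lhs : T′ j (T′ k (T′ j f)) ≋ normal
        lhs = ≋-trans (T-cong j lt₁ kT) (≋-trans (⊖-cong ≋-refl (⊗-congˡ (≋-trans ∂kT (⊖-cong ≋-refl (⊕-congˡ (⊗-congˡ ∂h))))))
          (solve 10 (λ t f cj ck c₁₃ A₁ A₂ A₂₁ A₁₂ A₁₂₁ →
             let h = t :* A₂ :- ((:- :1) :* A₁ :+ c₁₃ :* A₂₁) in
             t :* (t :* (t :* f :- cj :* A₁) :- ck :* h)
               :- cj :* (t :* (:- A₁) :- ((:- t) :* h :+ c₁₃ :* (t :* A₁₂ :- ((:- :1) :* :0 :+ (t :* A₂₁ :+ ck :* A₁₂₁)))))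
             := (t :* t :* t :* f :- t :* t :* cj :* A₁) :- t :* ck :* (t :* A₂ :+ A₁ :- c₁₃ :* A₂₁)
               :- cj :* (t :* t :* A₂ :- t :* c₁₃ :* A₁₂ :+ c₁₃ :* ck :* A₁₂₁))
             ≋-refl t f (c j) (c k) c₁₃ A₁ A₂ A₂₁ A₁₂ A₁₂₁))

        rhs : T′ k (T′ j (T′ k f)) ≋ normal
        rhs = ≋-trans (T-cong k lt₂ jT) (≋-trans (⊖-cong ≋-refl (⊗-congˡ (≋-trans ∂jT (⊖-cong ≋-refl (⊕-congˡ (⊗-congˡ
            (≋-trans ∂h' (⊖-cong ≋-refl (⊕-congˡ (⊕-congˡ (⊗-congˡ (≋-sym (∂-braid f)))))))))))))
          (solve 10 (λ t f cj ck c₁₃ A₁ A₂ A₂₁ A₁₂ A₁₂₁ →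
             let h' = t :* A₁ :- ((:- t) :* A₂ :+ c₁₃ :* A₁₂) in
             t :* (t :* (t :* f :- ck :* A₂) :- cj :* h')
               :- ck :* (t :* (:- A₂) :- ((:- :1) :* h' :+ c₁₃ :* (t :* A₂₁ :- ((:- t) :* :0 :+ (:1 :* A₁₂ :+ cj :* A₁₂₁)))))
             := (t :* t :* t :* f :- t :* t :* cj :* A₁) :- t :* ck :* (t :* A₂ :+ A₁ :- c₁₃ :* A₂₁)
               :- cj :* (t :* t :* A₂ :- t :* c₁₃ :* A₁₂ :+ c₁₃ :* ck :* A₁₂₁))
             ≋-refl t f (c j) (c k) c₁₃ A₁ A₂ A₂₁ A₁₂ A₁₂₁))

      T-braid : T′ j (T′ k (T′ j f)) ≋ T′ k (T′ j (T′ k f))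
      T-braid = ≋-trans lhs (≋-sym rhs)

  open Braid public using (T-braid)

  -- T_k commutes past τ_j τ_k as it does past T_j⁻¹ T_k⁻¹.
  T-τ-braid : ∀ j f → suc (suc j) < n → T′ (suc j) (τ j (τ (suc j) f)) ≋ τ j (τ (suc j) (T′ j f))
  T-τ-braid j f lt₂ = begin
    B (τ j (τ k f)) ≈⟨ T-cong k lt₂ (expand f) ⟩
    B (A (B f) ⊕ u ⊗ A f ⊕ u ⊗ (B f ⊕ u ⊗ f)) ≈⟨ ≋-trans (T-⊕ k _ _ lt₂) (⊕-cong (≋-trans (T-⊕ k _ _ lt₂) (⊕-congˡ (lin k lt₂ (A f)))) (≋-trans (lin k lt₂ _) (⊗-congˡ (≋-trans (T-⊕ k _ _ lt₂) (⊕-congˡ (lin k lt₂ f)))))) ⟩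
    B (A (B f)) ⊕ u ⊗ B (A f) ⊕ u ⊗ (B (B f) ⊕ u ⊗ B f) ≈⟨ ⊕-cong (⊕-congʳ (≋-sym (T-braid j lt₂ f))) (⊗-congˡ (⊕-congʳ (T-quadratic k f lt₂))) ⟩
    A (B (A f)) ⊕ u ⊗ B (A f) ⊕ u ⊗ (((t ⊖′ 1p) ⊗ B f ⊕ t ⊗ f) ⊕ u ⊗ B f)
      ≈⟨ solve 6 (λ t p q a b f → p :+ (:1 :- t) :* q :+ (:1 :- t) :* (((t :- :1) :* b :+ t :* f) :+ (:1 :- t) :* b)
                  := p :+ (:1 :- t) :* ((t :- :1) :* a :+ t :* f) :+ (:1 :- t) :* (q :+ (:1 :- t) :* a)) ≋-refl t (A (B (A f))) (B (A f)) (A f) (B f) f ⟩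
    A (B (A f)) ⊕ u ⊗ ((t ⊖′ 1p) ⊗ A f ⊕ t ⊗ f) ⊕ u ⊗ (B (A f) ⊕ u ⊗ A f)
      ≈⟨ ⊕-congʳ (⊕-congˡ (⊗-congˡ (T-quadratic j f lt₁))) ⟨
    A (B (A f)) ⊕ u ⊗ A (A f) ⊕ u ⊗ (B (A f) ⊕ u ⊗ A f) ≈⟨ expand (A f) ⟨
    τ j (τ k (A f)) ∎
    where
    k = suc j
    lt₁ : suc j < n
    lt₁ = ℕₚ.<⇒≤ lt₂
    A B : Poly n → Poly n
    A = T′ j
    B = T′ k
    u : Poly n
    u = 1p ⊖′ t
    su : ∀ i → s i u ≋ u
    su i = ≋-trans (s-⊖ i 1p t) (⊖-cong (1-homo (s-hom i)) (s-t i))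
    lin : ∀ i → suc i < n → ∀ g → T′ i (u ⊗ g) ≋ u ⊗ T′ i g
    lin i lt g = T-linear i g lt (su i)
    expand : ∀ g → τ j (τ k g) ≋ A (B g) ⊕ u ⊗ A g ⊕ u ⊗ (B g ⊕ u ⊗ g)
    expand g = ≋-trans (τ-T j (τ k g)) (⊕-cong (≋-trans (T-cong j lt₁ (τ-T k g)) (≋-trans (T-⊕ j _ _ lt₁) (⊕-congˡ (lin j lt₁ g))))
                                              (⊗-congˡ (τ-T k g)))

  s-d-far : ∀ j k → suc (suc j) ≤ k → s {n} j (d k) ≋ d k
  s-d-far j k le = ≋-trans (s-⊖ j _ _) (⊖-cong (s-x-far j k le) (s-x-far j (suc k) (ℕₚ.m≤n⇒m≤1+n le)))

  s-d-far′ : ∀ j k → suc (suc j) ≤ k → s {n} k (d j) ≋ d j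
  s-d-far′ j k le = ≋-trans (s-⊖ k _ _) (⊖-cong (s-x-below k j (ℕₚ.<⇒≤ le)) (s-x-below k (suc j) le))

  s-c-far : ∀ j k → suc (suc j) ≤ k → s {n} j (c k) ≋ c k
  s-c-far j k le = ≋-trans (s-⊖ j _ _) (⊖-cong (≋-trans (s-⊗ j _ _) (⊗-cong (s-t j) (s-x-far j k le))) (s-x-far j (suc k) (ℕₚ.m≤n⇒m≤1+n le)))

  s-c-far′ : ∀ j k → suc (suc j) ≤ k → s {n} k (c j) ≋ c j
  s-c-far′ j k le = ≋-trans (s-⊖ k _ _) (⊖-cong (≋-trans (s-⊗ k _ _) (⊗-cong (s-t k) (s-x-below k j (ℕₚ.<⇒≤ le)))) (s-x-below k (suc j) le))

  ∂-far : ∀ j k (f : Poly n) → suc (suc j) ≤ k → suc k < n → ∂ j (∂ k f) ≋ ∂ k (∂ j f)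
  ∂-far j k f le ltk = ⊗-cancelˡ (⊗-≢0 (d≢0 j ltj) (d≢0 k ltk)) (begin
    (d j ⊗ d k) ⊗ ∂ j (∂ k f) ≈⟨ ≋-trans (⊗-congʳ (⊗-comm _ _)) (⊗-assoc _ _ _) ⟩
    d k ⊗ (d j ⊗ ∂ j (∂ k f)) ≈⟨ ⊗-congˡ (∂-eq j _ ltj) ⟩
    d k ⊗ (∂ k f ⊖′ s j (∂ k f)) ≈⟨ solve 3 (λ d a b → d :* (a :- b) := d :* a :- d :* b) ≋-refl _ _ _ ⟩
    d k ⊗ ∂ k f ⊖′ d k ⊗ s j (∂ k f) ≈⟨ ⊖-cong (∂-eq k f ltk) (≋-trans (⊗-congʳ (≋-sym (s-d-far j k le))) (≋-trans (≋-sym (s-⊗ j _ _)) (≋-trans (s-cong j (∂-eq k f ltk)) (s-⊖ j _ _)))) ⟩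
    (f ⊖′ s k f) ⊖′ (s j f ⊖′ s j (s k f)) ≈⟨ ⊖-cong ≋-refl (⊖-cong ≋-refl (s-far j k f le)) ⟩
    (f ⊖′ s k f) ⊖′ (s j f ⊖′ s k (s j f)) ≈⟨ solve 4 (λ a b c d → (a :- b) :- (c :- d) := (a :- c) :- (b :- d)) ≋-refl _ _ _ _ ⟩
    (f ⊖′ s j f) ⊖′ (s k f ⊖′ s k (s j f)) ≈⟨ ⊖-cong (∂-eq j f ltj) (≋-trans (⊗-congʳ (≋-sym (s-d-far′ j k le))) (≋-trans (≋-sym (s-⊗ k _ _)) (≋-trans (s-cong k (∂-eq j f ltj)) (s-⊖ k _ _)))) ⟨
    d j ⊗ ∂ j f ⊖′ d j ⊗ s k (∂ j f) ≈⟨ solve 3 (λ d a b → d :* (a :- b) := d :* a :- d :* b) ≋-refl _ _ _ ⟨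
    d j ⊗ (∂ j f ⊖′ s k (∂ j f)) ≈⟨ ⊗-congˡ (∂-eq k _ ltk) ⟨
    d j ⊗ (d k ⊗ ∂ k (∂ j f)) ≈⟨ ⊗-assoc _ _ _ ⟨
    (d j ⊗ d k) ⊗ ∂ k (∂ j f) ∎)
    where ltj = ℕₚ.<⇒≤ (ℕₚ.≤-<-trans le (ℕₚ.<⇒≤ ltk))

  T-far : ∀ j k (f : Poly n) → suc (suc j) ≤ k → suc k < n → T′ j (T′ k f) ≋ T′ k (T′ j f)
  T-far j k f le ltk = begin
    t ⊗ T′ k f ⊖′ c j ⊗ ∂ j (T′ k f)
      ≈⟨ ⊖-cong ≋-refl (⊗-congˡ (≋-trans (∂-⊖ j _ _ ltj) (⊖-cong (∂-linear j f ltj (s-t j)) (≋-trans (∂-linear j _ ltj (s-c-far j k le)) (⊗-congˡ (∂-far j k f le ltk)))))) ⟩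
    t ⊗ T′ k f ⊖′ c j ⊗ (t ⊗ ∂ j f ⊖′ c k ⊗ ∂ k (∂ j f))
      ≈⟨ solve 7 (λ t f a b p q r → t :* (t :* f :- b :* q) :- a :* (t :* p :- b :* r) := t :* (t :* f :- a :* p) :- b :* (t :* q :- a :* r)) ≋-refl t f (c j) (c k) (∂ j f) (∂ k f) (∂ k (∂ j f)) ⟩
    t ⊗ T′ j f ⊖′ c k ⊗ (t ⊗ ∂ k f ⊖′ c j ⊗ ∂ k (∂ j f))
      ≈⟨ ⊖-cong ≋-refl (⊗-congˡ (≋-trans (∂-⊖ k _ _ ltk) (⊖-cong (∂-linear k f ltk (s-t k)) (∂-linear k _ ltk (s-c-far′ j k le))))) ⟨
    t ⊗ T′ j f ⊖′ c k ⊗ ∂ k (T′ j f) ∎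
    where ltj = ℕₚ.<⇒≤ (ℕₚ.≤-<-trans le (ℕₚ.<⇒≤ ltk))

  T-τ-far : ∀ j k (f : Poly n) → suc (suc j) ≤ k → suc k < n → T′ j (τ k f) ≋ τ k (T′ j f)
  T-τ-far j k f le ltk = ≋-trans (T-cong j ltj (τ-T k f)) (≋-trans (T-⊕ j _ _ ltj)
    (≋-trans (⊕-cong (T-far j k f le ltk) (T-linear j f ltj (≋-trans (s-⊖ j 1p t) (⊖-cong (1-homo (s-hom j)) (s-t j)))))
             (≋-sym (τ-T k (T′ j f)))))
    where ltj = ℕₚ.<⇒≤ (ℕₚ.≤-<-trans le (ℕₚ.<⇒≤ ltk))

  τ-T-far : ∀ j k (f : Poly n) → suc (suc j) ≤ k → suc k < n → T′ k (τ j f) ≋ τ j (T′ k f)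
  τ-T-far j k f le ltk = ≋-trans (T-cong k ltk (τ-T j f)) (≋-trans (T-⊕ k _ _ ltk)
    (≋-trans (⊕-cong (≋-sym (T-far j k f le ltk)) (T-linear k f ltk (≋-trans (s-⊖ k 1p t) (⊖-cong (1-homo (s-hom k)) (s-t k)))))
             (≋-sym (τ-T j (T′ k f)))))

  ∂-spec : ∀ j (f : Poly n) → suc j < n → ∂ j (spec f) ≋ spec (∂ j f)
  ∂-spec j f lt = ∂-unique j lt (begin
    d j ⊗ spec (∂ j f) ≈⟨ ⊗-congʳ (≋-trans (⊖-homo spec-hom _ _) (⊖-cong (spec-x j) (spec-x (suc j)))) ⟨
    spec (d j) ⊗ spec (∂ j f) ≈⟨ ⊗-homo spec-hom _ _ ⟨
    spec (d j ⊗ ∂ j f) ≈⟨ ⟦⟧-cong spec-hom (∂-eq j f lt) ⟩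
    spec (f ⊖′ s j f) ≈⟨ ≋-trans (⊖-homo spec-hom _ _) (⊖-cong ≋-refl (spec-s j f)) ⟩
    spec f ⊖′ s j (spec f) ∎)

  spec-t : spec {n} t ≋ t
  spec-t = spec-sc 0 1

  spec-c : ∀ j → spec {n} (c j) ≋ c j
  spec-c j = ≋-trans (⊖-homo spec-hom _ _) (⊖-cong (≋-trans (⊗-homo spec-hom _ _) (⊗-cong spec-t (spec-x j))) (spec-x (suc j)))

  spec-c∂ : ∀ j (f : Poly n) → suc j < n → spec (c j ⊗ ∂ j f) ≋ c j ⊗ ∂ j (spec f)
  spec-c∂ j f lt = ≋-trans (⊗-homo spec-hom _ _) (⊗-cong (spec-c j) (≋-sym (∂-spec j f lt)))

  spec-T : ∀ j (f : Poly n) → suc j < n → spec (T′ j f) ≋ T′ j (spec f)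
  spec-T j f lt = ≋-trans (⊖-homo spec-hom _ _) (⊖-cong (≋-trans (⊗-homo spec-hom _ _) (⊗-congʳ spec-t)) (spec-c∂ j f lt))

  spec-τ : ∀ j (f : Poly n) → suc j < n → spec (τ j f) ≋ τ j (spec f)
  spec-τ j f lt = ≋-trans (⊖-homo spec-hom _ _) (⊖-cong ≋-refl (spec-c∂ j f lt))

  module _ (ε : ℕ) where
    ω-⊗ : ∀ (f g : Poly n) → ω ε (f ⊗ g) ≋ ω ε f ⊗ ω ε g
    ω-⊗ = ⊗-homo (ω-hom ε)

    ω-⊖ : ∀ (f g : Poly n) → ω ε (f ⊖′ g) ≋ ω ε f ⊖′ ω ε g
    ω-⊖ = ⊖-homo (ω-hom ε)

    ω-cong : ∀ {f g : Poly n} → f ≋ g → ω ε f ≋ ω ε g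
    ω-cong = ⟦⟧-cong (ω-hom ε)

    ω-t : ω {n} ε t ≋ t
    ω-t = ω-sc ε 0 1

    ω-d : ∀ j → suc (suc j) < n → ω {n} ε (d (suc j)) ≋ d j
    ω-d j lt = ≋-trans (ω-⊖ _ _) (⊖-cong (ω-x-suc ε j (ℕₚ.<⇒≤ lt)) (ω-x-suc ε (suc j) lt))

    ω-c : ∀ j → suc (suc j) < n → ω {n} ε (c (suc j)) ≋ c j
    ω-c j lt = ≋-trans (ω-⊖ _ _) (⊖-cong (≋-trans (ω-⊗ _ _) (⊗-cong ω-t (ω-x-suc ε j (ℕₚ.<⇒≤ lt)))) (ω-x-suc ε (suc j) lt))

    ∂-ω : ∀ j (f : Poly n) → suc (suc j) < n → ∂ j (ω ε f) ≋ ω ε (∂ (suc j) f)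
    ∂-ω j f lt = ∂-unique j (ℕₚ.<⇒≤ lt) (begin
      d j ⊗ ω ε (∂ (suc j) f) ≈⟨ ⊗-congʳ (ω-d j lt) ⟨
      ω ε (d (suc j)) ⊗ ω ε (∂ (suc j) f) ≈⟨ ω-⊗ _ _ ⟨
      ω ε (d (suc j) ⊗ ∂ (suc j) f) ≈⟨ ω-cong (∂-eq (suc j) f lt) ⟩
      ω ε (f ⊖′ s (suc j) f) ≈⟨ ≋-trans (ω-⊖ _ _) (⊖-cong ≋-refl (≋-sym (ω-s ε j f lt))) ⟩
      ω ε f ⊖′ s j (ω ε f) ∎)

    c∂-ω : ∀ j (f : Poly n) → suc (suc j) < n → c j ⊗ ∂ j (ω ε f) ≋ ω ε (c (suc j) ⊗ ∂ (suc j) f)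
    c∂-ω j f lt = ≋-trans (⊗-cong (≋-sym (ω-c j lt)) (∂-ω j f lt)) (≋-sym (ω-⊗ _ _))

    T-ω : ∀ j (f : Poly n) → suc (suc j) < n → T′ j (ω ε f) ≋ ω ε (T′ (suc j) f)
    T-ω j f lt = ≋-sym (≋-trans (ω-⊖ _ _) (⊖-cong (≋-trans (ω-⊗ _ _) (⊗-congʳ ω-t)) (≋-sym (c∂-ω j f lt))))

    τ-ω : ∀ j (f : Poly n) → suc (suc j) < n → τ j (ω ε f) ≋ ω ε (τ (suc j) f)
    τ-ω j f lt = ≋-sym (≋-trans (ω-⊖ _ _) (⊖-cong ≋-refl (≋-sym (c∂-ω j f lt))))

module _ {n : ℕ} (ε : ℕ) where
  open ≋-Reasoning {suc (suc n)}
  private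
    m = suc (suc n)
    Ω : Poly m → Poly m
    Ω f = ω ε (ω ε f)
    q : Poly m
    q = sc ε 0
    Ω-⊗ : ∀ f g → Ω (f ⊗ g) ≋ Ω f ⊗ Ω g
    Ω-⊗ f g = ≋-trans (ω-cong ε (ω-⊗ ε f g)) (ω-⊗ ε _ _)
    Ω-⊖ : ∀ f g → Ω (f ⊖′ g) ≋ Ω f ⊖′ Ω g
    Ω-⊖ f g = ≋-trans (ω-cong ε (ω-⊖ ε f g)) (ω-⊖ ε _ _)
    Ω-t : Ω t ≋ t
    Ω-t = ≋-trans (ω-cong ε (ω-t ε)) (ω-t ε)
    Ω-x0 : Ω (x 0) ≋ q ⊗ x n
    Ω-x0 = ≋-trans (ω-cong ε (ω-x-0 ε)) (≋-trans (ω-⊗ ε _ _) (⊗-cong (ω-sc ε ε 0) (ω-x-suc ε n ℕₚ.≤-refl)))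
    Ω-x1 : Ω (x 1) ≋ q ⊗ x (suc n)
    Ω-x1 = ≋-trans (ω-cong ε (ω-x-suc ε 0 (s≤s (s≤s z≤n)))) (ω-x-0 ε)
    Ω-d : Ω (d 0) ≋ q ⊗ d n
    Ω-d = ≋-trans (Ω-⊖ _ _) (≋-trans (⊖-cong Ω-x0 Ω-x1) (solve 3 (λ q x y → q :* x :- q :* y := q :* (x :- y)) ≋-refl q (x n) (x (suc n))))
    Ω-c : Ω (c 0) ≋ q ⊗ c n
    Ω-c = ≋-trans (Ω-⊖ _ _) (≋-trans (⊖-cong (≋-trans (Ω-⊗ _ _) (⊗-cong Ω-t Ω-x0)) Ω-x1)
      (solve 4 (λ t q x y → t :* (q :* x) :- q :* y := q :* (t :* x :- y)) ≋-refl t q (x n) (x (suc n))))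
    ∂-Ω : ∀ f → ∂ n (Ω f) ≋ q ⊗ Ω (∂ 0 f)
    ∂-Ω f = ∂-unique n ℕₚ.≤-refl (begin
      d n ⊗ (q ⊗ Ω (∂ 0 f)) ≈⟨ solve 3 (λ d q f → d :* (q :* f) := (q :* d) :* f) ≋-refl (d n) q _ ⟩
      (q ⊗ d n) ⊗ Ω (∂ 0 f) ≈⟨ ⊗-congʳ Ω-d ⟨
      Ω (d 0) ⊗ Ω (∂ 0 f) ≈⟨ Ω-⊗ _ _ ⟨
      Ω (d 0 ⊗ ∂ 0 f) ≈⟨ ω-cong ε (ω-cong ε (∂-eq 0 f (s≤s (s≤s z≤n)))) ⟩
      Ω (f ⊖′ s 0 f) ≈⟨ ≋-trans (Ω-⊖ _ _) (⊖-cong ≋-refl (≋-sym (ω-s² ε f))) ⟩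
      Ω f ⊖′ s n (Ω f) ∎)

  -- A single ω tears the pair x₁, x₂ apart; ω² carries it to the last pair. Both variables pick up
  -- the same q^ε, which cancels between `c` and `d`.
  T-ω² : ∀ (f : Poly (suc (suc n))) → T′ n (ω ε (ω ε f)) ≋ ω ε (ω ε (T′ 0 f))
  T-ω² f = begin
    t ⊗ Ω f ⊖′ c n ⊗ ∂ n (Ω f) ≈⟨ ⊖-cong ≋-refl (⊗-congˡ (∂-Ω f)) ⟩
    t ⊗ Ω f ⊖′ c n ⊗ (q ⊗ Ω (∂ 0 f)) ≈⟨ ⊖-cong ≋-refl (solve 3 (λ c q f → c :* (q :* f) := (q :* c) :* f) ≋-refl (c n) q _) ⟩
    t ⊗ Ω f ⊖′ (q ⊗ c n) ⊗ Ω (∂ 0 f) ≈⟨ ⊖-cong (⊗-congʳ Ω-t) (⊗-congʳ Ω-c) ⟨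
    Ω t ⊗ Ω f ⊖′ Ω (c 0) ⊗ Ω (∂ 0 f) ≈⟨ ≋-trans (Ω-⊖ _ _) (⊖-cong (Ω-⊗ _ _) (Ω-⊗ _ _)) ⟨
    Ω (t ⊗ f ⊖′ c 0 ⊗ ∂ 0 f) ∎

-- Cherednik operators and intertwiners

up : ∀ {n} → ℕ → Poly n → Poly n
up zero    f = f
up (suc k) f = up k (T′ k f)

down : ∀ {n} → ℕ → ℕ → Poly n → Poly n
down a zero    f = f
down a (suc m) f = τ a (down (suc a) m f)

-- Z ε k is t^{n-1} Y_{k+1}, with q replaced by q^ε.
Z : ∀ {n} → ℕ → ℕ → Poly n → Poly n
Z {n} ε k f = down k (n ∸ suc k) (ω ε (up k f))

-- The same kind of product as `up`, but peeled off at its left end; `up` follows the recursion of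
-- `Tup` and peels off at the right end.
chain : ∀ {n} → ℕ → ℕ → Poly n → Poly n
chain a zero    f = f
chain a (suc m) f = T′ a (chain (suc a) m f)

chain-snoc : ∀ {n} a m (f : Poly n) → chain a (suc m) f ≡ chain a m (T′ (a ℕ.+ m) f)
chain-snoc a zero    f = cong (λ i → T′ i f) (sym (ℕₚ.+-identityʳ a))
chain-snoc a (suc m) f = cong (T′ a) (trans (chain-snoc (suc a) m f) (cong (λ i → chain (suc a) m (T′ i f)) (sym (ℕₚ.+-suc a m))))

up-chain : ∀ {n} k (f : Poly n) → up k f ≡ chain 0 k f
up-chain zero    f = refl
up-chain (suc k) f = trans (up-chain k (T′ k f)) (sym (chain-snoc 0 k f))

down-snoc : ∀ {n} a m (f : Poly n) → down a (suc m) f ≡ down a m (τ (a ℕ.+ m) f)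
down-snoc a zero    f = cong (λ i → τ i f) (sym (ℕₚ.+-identityʳ a))
down-snoc a (suc m) f = cong (τ a) (trans (down-snoc (suc a) m f) (cong (λ i → down (suc a) m (τ i f)) (sym (ℕₚ.+-suc a m))))

tail-< : ∀ a {m n} → a ℕ.+ suc m < n → suc a ℕ.+ m < n
tail-< a {m} {n} lt = subst (_< n) (ℕₚ.+-suc a m) lt

head-< : ∀ a {m n} → a ℕ.+ suc m < n → suc a < n
head-< a lt = ℕₚ.≤-<-trans (s≤s (ℕₚ.m≤m+n a _)) (tail-< a lt)

suc[k+[n∸suc-k]]≡n : ∀ {n k} → k < n → suc (k ℕ.+ (n ∸ suc k)) ≡ n
suc[k+[n∸suc-k]]≡n = ℕₚ.m+[n∸m]≡n

module _ {n : ℕ} where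
  open ≋-Reasoning {n}

  up-cong : ∀ k {f g : Poly n} → k < n → f ≋ g → up k f ≋ up k g
  up-cong zero    lt e = e
  up-cong (suc k) lt e = up-cong k (ℕₚ.<⇒≤ lt) (T-cong k lt e)

  down-cong : ∀ a m {f g : Poly n} → a ℕ.+ m < n → f ≋ g → down a m f ≋ down a m g
  down-cong a zero    lt e = e
  down-cong a (suc m) lt e = τ-cong a (ℕₚ.≤-<-trans (s≤s (ℕₚ.m≤m+n a m)) (tail-< a lt)) (down-cong (suc a) m (tail-< a lt) e)

  up-linear : ∀ k {a : Poly n} f → k < n → (∀ j → j < k → s j a ≋ a) → up k (a ⊗ f) ≋ a ⊗ up k f
  up-linear zero    f lt inv = ≋-refl
  up-linear (suc k) f lt inv = ≋-trans (up-cong k (ℕₚ.<⇒≤ lt) (T-linear k f lt (inv k ℕₚ.≤-refl)))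
    (up-linear k (T′ k f) (ℕₚ.<⇒≤ lt) (λ j j<k → inv j (ℕₚ.m≤n⇒m≤1+n j<k)))

  down-linear : ∀ a m {b : Poly n} f → a ℕ.+ m < n → (∀ j → j < a ℕ.+ m → s j b ≋ b) → down a m (b ⊗ f) ≋ b ⊗ down a m f
  down-linear a zero    f lt inv = ≋-refl
  down-linear a (suc m) {b} f lt inv =
    ≋-trans (τ-cong a (head-< a lt) (down-linear (suc a) m f (tail-< a lt) (λ j j< → inv j (subst (j <_) (sym (ℕₚ.+-suc a m)) j<))))
            (τ-linear a _ (head-< a lt) (inv a (ℕₚ.m<m+n a (s≤s z≤n))))

  τ-⊕ : ∀ j (f g : Poly n) → suc j < n → τ j (f ⊕ g) ≋ τ j f ⊕ τ j g
  τ-⊕ j f g lt = ≋-trans (⊖-cong ≋-refl (⊗-congˡ (∂-⊕ j f g lt)))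
    (solve 5 (λ f g c D E → (f :+ g) :- c :* (D :+ E) := (f :- c :* D) :+ (g :- c :* E)) ≋-refl f g (c j) (∂ j f) (∂ j g))

  up-⊕ : ∀ k (f g : Poly n) → k < n → up k (f ⊕ g) ≋ up k f ⊕ up k g
  up-⊕ zero    f g lt = ≋-refl
  up-⊕ (suc k) f g lt = ≋-trans (up-cong k (ℕₚ.<⇒≤ lt) (T-⊕ k f g lt)) (up-⊕ k _ _ (ℕₚ.<⇒≤ lt))

  down-⊕ : ∀ a m (f g : Poly n) → a ℕ.+ m < n → down a m (f ⊕ g) ≋ down a m f ⊕ down a m g
  down-⊕ a zero    f g lt = ≋-refl
  down-⊕ a (suc m) f g lt = ≋-trans (τ-cong a (head-< a lt) (down-⊕ (suc a) m f g (tail-< a lt))) (τ-⊕ a _ _ (head-< a lt))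

  T-down-far : ∀ i a m (f : Poly n) → suc (suc i) ≤ a → a ℕ.+ m < n → T′ i (down a m f) ≋ down a m (T′ i f)
  T-down-far i a zero    f le lt = ≋-refl
  T-down-far i a (suc m) f le lt = ≋-trans (T-τ-far i a _ le (head-< a lt))
    (τ-cong a (head-< a lt) (T-down-far i (suc a) m f (ℕₚ.m≤n⇒m≤1+n le) (tail-< a lt)))

  -- T_{i+1} passes the factors to the left of τ_i unchanged, becomes T_i by `T-τ-braid` at τ_i
  -- τ_{i+1}, and passes the rest unchanged.
  T-down : ∀ i a m (f : Poly n) → a ≤ i → suc i < a ℕ.+ m → a ℕ.+ m < n → T′ (suc i) (down a m f) ≋ down a m (T′ i f)
  T-down i a zero f a≤i i< lt = ⊥-elim (ℕₚ.<-irrefl refl (ℕₚ.<-≤-trans i< (ℕₚ.≤-trans (ℕₚ.≤-reflexive (ℕₚ.+-identityʳ a)) (ℕₚ.m≤n⇒m≤1+n a≤i))))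
  T-down i a (suc m) f a≤i i< lt with ℕₚ.m≤n⇒m<n∨m≡n a≤i
  ... | inj₁ a<i = ≋-trans (τ-T-far a (suc i) _ (s≤s a<i) (ℕₚ.≤-<-trans i<′ lt′))
                   (τ-cong a lt-a (T-down i (suc a) m f a<i i<′ lt′))
    where
    lt′ = subst (_< n) (ℕₚ.+-suc a m) lt
    i<′ = subst (suc i <_) (ℕₚ.+-suc a m) i<
    lt-a = ℕₚ.≤-<-trans (s≤s (ℕₚ.m≤m+n a m)) lt′
  T-down i .i (suc zero) f a≤i i< lt | inj₂ refl = ⊥-elim (ℕₚ.<-irrefl refl (subst (suc i <_) (trans (ℕₚ.+-suc i 0) (cong suc (ℕₚ.+-identityʳ i))) i<))
  T-down i .i (suc (suc m)) f a≤i i< lt | inj₂ refl = ≋-trans (T-τ-braid i _ ltb)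
    (τ-cong i (ℕₚ.<⇒≤ ltb) (τ-cong (suc i) ltb (T-down-far i (suc (suc i)) m f ℕₚ.≤-refl lt″)))
    where
    lt″ : suc (suc i) ℕ.+ m < n
    lt″ = subst (_< n) (trans (ℕₚ.+-suc i (suc m)) (cong suc (ℕₚ.+-suc i m))) lt
    ltb : suc (suc i) < n
    ltb = ℕₚ.≤-<-trans (s≤s (s≤s (ℕₚ.m≤m+n i m))) lt″

  T-up-far : ∀ i k (f : Poly n) → k < i → suc i < n → T′ i (up k f) ≋ up k (T′ i f)
  T-up-far i zero    f lt lti = ≋-refl
  T-up-far i (suc k) f lt lti = ≋-trans (T-up-far i k _ (ℕₚ.<⇒≤ lt) lti)
    (up-cong k (ℕₚ.<-trans (ℕₚ.<⇒≤ lt) (ℕₚ.<⇒≤ lti)) (≋-sym (T-far k i f lt lti)))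

  T-up : ∀ i k (f : Poly n) → suc i < k → k < n → T′ (suc i) (up k f) ≋ up k (T′ i f)
  T-up i (suc k) f (s≤s i<k) lt with ℕₚ.m≤n⇒m<n∨m≡n i<k
  ... | inj₁ si<k = ≋-trans (T-up i k (T′ k f) si<k (ℕₚ.<⇒≤ lt)) (up-cong k (ℕₚ.<⇒≤ lt) (T-far i k f si<k lt))
  ... | inj₂ refl = ≋-trans (T-up-far (suc i) i _ ℕₚ.≤-refl lt)
                            (up-cong i (ℕₚ.<⇒≤ (ℕₚ.<⇒≤ lt)) (≋-sym (T-braid i lt f)))

  module _ (ε : ℕ) where
    Z-cong : ∀ k {f g : Poly n} → k < n → f ≋ g → Z ε k f ≋ Z ε k g
    Z-cong k lt e = down-cong k _ (ℕₚ.≤-reflexive (suc[k+[n∸suc-k]]≡n lt)) (ω-cong ε (up-cong k lt e))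

    -- The factors that pass through every operator: polynomials in q and t, and at ε = 0 also the
    -- symmetric polynomials, by `symmetric⇒ω`.
    record Scalar (a : Poly n) : Set where
      field
        s-scalar : Symmetric a
        ω-scalar : ω ε a ≋ a
    open Scalar public

    scalar-sc : ∀ a b → Scalar (sc a b)
    scalar-sc a b = record { s-scalar = λ j _ → s-sc j a b ; ω-scalar = ω-sc ε a b }

    scalar-ι : ∀ a → Scalar (ι a)
    scalar-ι a = record { s-scalar = λ j _ → s-ι j a ; ω-scalar = ω-ι ε a }

    scalar-1 : Scalar 1p
    scalar-1 = record { s-scalar = λ j _ → 1-homo (s-hom j) ; ω-scalar = 1-homo (ω-hom ε) }

    scalar-⊟ : ∀ {a} → Scalar a → Scalar (⊟ a)
    scalar-⊟ A = record { s-scalar = λ j lt → ≋-trans (⊟-homo (s-hom j) _) (⊟-cong (s-scalar A j lt))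
                        ; ω-scalar = ≋-trans (⊟-homo (ω-hom ε) _) (⊟-cong (ω-scalar A)) }

    scalar-⊖ : ∀ {a b} → Scalar a → Scalar b → Scalar (a ⊖′ b)
    scalar-⊖ A B = record { s-scalar = λ j lt → ≋-trans (s-⊖ j _ _) (⊖-cong (s-scalar A j lt) (s-scalar B j lt))
                          ; ω-scalar = ≋-trans (ω-⊖ ε _ _) (⊖-cong (ω-scalar A) (ω-scalar B)) }

    scalar-⊗ : ∀ {a b} → Scalar a → Scalar b → Scalar (a ⊗ b)
    scalar-⊗ A B = record { s-scalar = λ j lt → ≋-trans (s-⊗ j _ _) (⊗-cong (s-scalar A j lt) (s-scalar B j lt))
                          ; ω-scalar = ≋-trans (ω-⊗ ε _ _) (⊗-cong (ω-scalar A) (ω-scalar B)) }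

    Z-scalar : ∀ k {a : Poly n} f → k < n → Scalar a → Z ε k (a ⊗ f) ≋ a ⊗ Z ε k f
    Z-scalar k f lt A = ≋-trans (down-cong k _ lt′ (≋-trans (ω-cong ε (up-linear k f lt (λ j j<k → s-scalar A j (ℕₚ.≤-<-trans j<k lt))))
                                                          (≋-trans (ω-⊗ ε _ _) (⊗-congʳ (ω-scalar A)))))
      (down-linear k _ _ lt′ (λ j j< → s-scalar A j (ℕₚ.≤-<-trans j< lt′)))
      where lt′ = ℕₚ.≤-reflexive (suc[k+[n∸suc-k]]≡n lt)

    Z-⊕ : ∀ k (f g : Poly n) → k < n → Z ε k (f ⊕ g) ≋ Z ε k f ⊕ Z ε k g
    Z-⊕ k f g lt = ≋-trans (down-cong k _ lt′ (≋-trans (ω-cong ε (up-⊕ k f g lt)) (⊕-homo (ω-hom ε) _ _)))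
      (down-⊕ k _ _ _ lt′)
      where lt′ = ℕₚ.≤-reflexive (suc[k+[n∸suc-k]]≡n lt)

    T-Z-below : ∀ i k (f : Poly n) → suc i < k → k < n → T′ i (Z ε k f) ≋ Z ε k (T′ i f)
    T-Z-below i k f lt ltk = ≋-trans (T-down-far i k _ _ lt lt′)
      (down-cong k _ lt′ (≋-trans (T-ω ε i _ (ℕₚ.≤-<-trans lt ltk)) (ω-cong ε (T-up i k f lt ltk))))
      where lt′ = ℕₚ.≤-reflexive (suc[k+[n∸suc-k]]≡n ltk)

    T-Z-above : ∀ i k (f : Poly n) → k < i → suc i < n → T′ i (Z ε k f) ≋ Z ε k (T′ i f)
    T-Z-above (suc i) k f (s≤s k≤i) lti = ≋-trans (T-down i k _ _ k≤i (ℕₚ.≤-pred (subst (suc (suc i) <_) (sym (suc[k+[n∸suc-k]]≡n ltk)) lti)) lt′)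
      (down-cong k _ lt′ (≋-trans (T-ω ε i _ lti) (ω-cong ε (T-up-far (suc i) k f (s≤s k≤i) lti))))
      where
      ltk : k < n
      ltk = ℕₚ.≤-<-trans k≤i (ℕₚ.<⇒≤ (ℕₚ.<⇒≤ lti))
      lt′ = ℕₚ.≤-reflexive (suc[k+[n∸suc-k]]≡n ltk)

    -- Z_i = τ_i W and Z_{i+1} = W T_i
    W : ℕ → Poly n → Poly n
    W i f = down (suc i) (n ∸ suc (suc i)) (ω ε (up i f))

    Z-W : ∀ i (f : Poly n) → suc i < n → Z ε i f ≡ τ i (W i f)
    Z-W i f lt = cong (λ m → down i m (ω ε (up i f))) (ℕₚ.+-cancelˡ-≡ (suc i) _ _
      (trans (suc[k+[n∸suc-k]]≡n (ℕₚ.<⇒≤ lt)) (sym (trans (ℕₚ.+-suc (suc i) _) (suc[k+[n∸suc-k]]≡n lt)))))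

    W-cong : ∀ i {f g : Poly n} → suc i < n → f ≋ g → W i f ≋ W i g
    W-cong i lt e = down-cong (suc i) _ (ℕₚ.≤-reflexive (suc[k+[n∸suc-k]]≡n lt)) (ω-cong ε (up-cong i (ℕₚ.<⇒≤ lt) e))

    W-scalar : ∀ i {a : Poly n} f → suc i < n → Scalar a → W i (a ⊗ f) ≋ a ⊗ W i f
    W-scalar i f lt A = ≋-trans (down-cong (suc i) _ lt′ (≋-trans (ω-cong ε (up-linear i f (ℕₚ.<⇒≤ lt) (λ j j<k → s-scalar A j (ℕₚ.≤-<-trans j<k (ℕₚ.<⇒≤ lt)))))
                                                          (≋-trans (ω-⊗ ε _ _) (⊗-congʳ (ω-scalar A)))))
      (down-linear (suc i) _ _ lt′ (λ j j< → s-scalar A j (ℕₚ.≤-<-trans j< lt′)))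
      where lt′ = ℕₚ.≤-reflexive (suc[k+[n∸suc-k]]≡n lt)

    W-⊕ : ∀ i (f g : Poly n) → suc i < n → W i (f ⊕ g) ≋ W i f ⊕ W i g
    W-⊕ i f g lt = ≋-trans (down-cong (suc i) _ lt′ (≋-trans (ω-cong ε (up-⊕ i f g (ℕₚ.<⇒≤ lt))) (⊕-homo (ω-hom ε) _ _)))
      (down-⊕ (suc i) _ _ _ lt′)
      where lt′ = ℕₚ.≤-reflexive (suc[k+[n∸suc-k]]≡n lt)

    scp : ℕ × ℕ → Poly n
    scp (a , b) = sc a b

    HasWeight : Poly n → (ℕ → ℕ × ℕ) → Set
    HasWeight f w = ∀ k → k < n → Z ε k f ≋ scp (w k) ⊗ f

    weight-cong : ∀ {f g w} → f ≋ g → HasWeight f w → HasWeight g w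
    weight-cong e h k lt = ≋-trans (Z-cong k lt (≋-sym e)) (≋-trans (h k lt) (⊗-congˡ e))

    weight-scalar : ∀ {a f w} → Scalar a → HasWeight f w → HasWeight (a ⊗ f) w
    weight-scalar {a} {f} A h k lt = ≋-trans (Z-scalar k f lt A) (≋-trans (⊗-congˡ (h k lt))
      (solve 3 (λ a e f → a :* (e :* f) := e :* (a :* f)) ≋-refl a _ f))

    weight-⊕ : ∀ {f g w} → HasWeight f w → HasWeight g w → HasWeight (f ⊕ g) w
    weight-⊕ {f} {g} h h' k lt = ≋-trans (Z-⊕ k f g lt) (≋-trans (⊕-cong (h k lt) (h' k lt)) (≋-sym (PR.distribˡ _ f g)))

    weight-⊖ : ∀ {f g w} → HasWeight f w → HasWeight g w → HasWeight (f ⊖′ g) w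
    weight-⊖ {f} {g} h h' = weight-cong (⊕-congˡ (solve 1 (λ g → (:- :1) :* g := :- g) ≋-refl g))
      (weight-⊕ h (weight-scalar (scalar-⊟ scalar-1) h'))

    -- The intertwiner T_i + (1 - t) / (1 - e/e') for eigenvalues e of Z_i and e' of Z_{i+1},
    -- multiplied by e' - e to clear the denominator. At e = e' it degenerates to a multiple of the
    -- identity.
    Ψ : ℕ → ℕ × ℕ → ℕ × ℕ → Poly n → Poly n
    Ψ i e e' f = (scp e' ⊖′ scp e) ⊗ T′ i f ⊕ ((1p ⊖′ t) ⊗ scp e') ⊗ f

    -- The quadratic relation turns the composite into a scalar. It vanishes exactly when one
    -- eigenvalue is t times the other, the only case in which injectivity can fail.
    Ψ-Ψ : ∀ i e e' f → suc i < n →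
          Ψ i e' e (Ψ i e e' f) ≋ ⊟ ((t ⊗ scp e' ⊖′ scp e) ⊗ (scp e' ⊖′ t ⊗ scp e)) ⊗ f
    Ψ-Ψ i e e' f lt = begin
      (E ⊖′ E') ⊗ T′ i (Ψ i e e' f) ⊕ ((1p ⊖′ t) ⊗ E) ⊗ Ψ i e e' f
        ≈⟨ ⊕-congʳ (⊗-congˡ (≋-trans (T-⊕ i _ _ lt) (⊕-cong
             (≋-trans (T-linear i _ lt (s-scalar (scalar-⊖ (sca e') (sca e)) i lt)) (⊗-congˡ (T-quadratic i f lt)))
             (T-linear i f lt (s-scalar (scalar-⊗ (scalar-⊖ scalar-1 (scalar-sc 0 1)) (sca e')) i lt))))) ⟩
      (E ⊖′ E') ⊗ ((E' ⊖′ E) ⊗ ((t ⊖′ 1p) ⊗ T′ i f ⊕ t ⊗ f) ⊕ ((1p ⊖′ t) ⊗ E') ⊗ T′ i f)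
        ⊕ ((1p ⊖′ t) ⊗ E) ⊗ ((E' ⊖′ E) ⊗ T′ i f ⊕ ((1p ⊖′ t) ⊗ E') ⊗ f)
        ≈⟨ solve 5 (λ E E' t h f →
             (E :- E') :* ((E' :- E) :* ((t :- :1) :* h :+ t :* f) :+ ((:1 :- t) :* E') :* h)
               :+ ((:1 :- t) :* E) :* ((E' :- E) :* h :+ ((:1 :- t) :* E') :* f)
             := (:- ((t :* E' :- E) :* (E' :- t :* E))) :* f) ≋-refl E E' t (T′ i f) f ⟩
      ⊟ ((t ⊗ E' ⊖′ E) ⊗ (E' ⊖′ t ⊗ E)) ⊗ f ∎
      where
      E E' : Poly n
      E = scp e
      E' = scp e'
      sca : ∀ e → Scalar (scp e)
      sca (a , b) = scalar-sc a b

    intertwiner : ∀ i f w w' → suc i < n → HasWeight f w →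
                  w' i ≡ w (suc i) → w' (suc i) ≡ w i → (∀ k → k ≢ i → k ≢ suc i → w' k ≡ w k) →
                  HasWeight (Ψ i (w i) (w (suc i)) f) w'
    intertwiner i f w w' lt h wi wsi wk k ltk = go (ℕₚ.<-cmp k i)
      where
      E E' : Poly n
      E = scp (w i)
      E' = scp (w (suc i))
      scalar : ∀ k → Scalar (scp (w k))
      scalar k = scalar-sc (proj₁ (w k)) (proj₂ (w k))
      T-scp : ∀ k → T′ i (scp (w k) ⊗ f) ≋ scp (w k) ⊗ T′ i f
      T-scp k = T-linear i f lt (s-scalar (scalar k) i lt)
      Z-Ψ : ∀ k {g} → k < n → Z ε k (T′ i f) ≋ g →
            Z ε k (Ψ i (w i) (w (suc i)) f) ≋ (E' ⊖′ E) ⊗ g ⊕ ((1p ⊖′ t) ⊗ E') ⊗ (scp (w k) ⊗ f)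
      Z-Ψ k ltk e = ≋-trans (Z-⊕ k _ _ ltk) (⊕-cong
        (≋-trans (Z-scalar k _ ltk (scalar-⊖ (scalar (suc i)) (scalar i))) (⊗-congˡ e))
        (≋-trans (Z-scalar k f ltk (scalar-⊗ (scalar-⊖ scalar-1 (scalar-sc 0 1)) (scalar (suc i)))) (⊗-congˡ (h k ltk))))
      -- Z_i T_i = τ_i W T_i = τ_i Z_{i+1}, and Z_{i+1} acts on f as E'.
      Z-first : Z ε i (T′ i f) ≋ E' ⊗ (T′ i f ⊕ (1p ⊖′ t) ⊗ f)
      Z-first = begin
        Z ε i (T′ i f) ≡⟨ Z-W i _ lt ⟩
        τ i (Z ε (suc i) f) ≈⟨ τ-cong i lt (h (suc i) lt) ⟩
        τ i (E' ⊗ f) ≈⟨ τ-linear i f lt (s-scalar (scalar (suc i)) i lt) ⟩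
        E' ⊗ τ i f ≈⟨ ⊗-congˡ (τ-T i f) ⟩
        E' ⊗ (T′ i f ⊕ (1p ⊖′ t) ⊗ f) ∎
      -- Z_{i+1} T_i = W T_i², which the quadratic relation reduces to W T_i = Z_{i+1} and t W = T_i
      -- τ_i W = T_i Z_i.
      Z-second : Z ε (suc i) (T′ i f) ≋ (t ⊖′ 1p) ⊗ (E' ⊗ f) ⊕ E ⊗ T′ i f
      Z-second = begin
        W i (T′ i (T′ i f)) ≈⟨ W-cong i lt (T-quadratic i f lt) ⟩
        W i ((t ⊖′ 1p) ⊗ T′ i f ⊕ t ⊗ f) ≈⟨ W-⊕ i _ _ lt ⟩
        W i ((t ⊖′ 1p) ⊗ T′ i f) ⊕ W i (t ⊗ f)
          ≈⟨ ⊕-cong (W-scalar i _ lt (scalar-⊖ (scalar-sc 0 1) scalar-1)) (W-scalar i f lt (scalar-sc 0 1)) ⟩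
        (t ⊖′ 1p) ⊗ Z ε (suc i) f ⊕ t ⊗ W i f ≈⟨ ⊕-cong (⊗-congˡ (h (suc i) lt)) (≋-sym (T-τ i _ lt)) ⟩
        (t ⊖′ 1p) ⊗ (E' ⊗ f) ⊕ T′ i (τ i (W i f)) ≡⟨ cong (λ z → (t ⊖′ 1p) ⊗ (E' ⊗ f) ⊕ T′ i z) (Z-W i f lt) ⟨
        (t ⊖′ 1p) ⊗ (E' ⊗ f) ⊕ T′ i (Z ε i f) ≈⟨ ⊕-congˡ (≋-trans (T-cong i lt (h i (ℕₚ.<⇒≤ lt))) (T-scp i)) ⟩
        (t ⊖′ 1p) ⊗ (E' ⊗ f) ⊕ E ⊗ T′ i f ∎
      Z-other : ∀ k → k < n → T′ i (Z ε k f) ≋ Z ε k (T′ i f) →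
                Z ε k (Ψ i (w i) (w (suc i)) f) ≋ scp (w k) ⊗ Ψ i (w i) (w (suc i)) f
      Z-other k ltk comm = ≋-trans (Z-Ψ k ltk (≋-trans (≋-sym comm) (≋-trans (T-cong i lt (h k ltk)) (T-scp k))))
        (solve 5 (λ A B F h f → A :* (F :* h) :+ B :* (F :* f) := F :* (A :* h :+ B :* f)) ≋-refl
          (E' ⊖′ E) ((1p ⊖′ t) ⊗ E') (scp (w k)) (T′ i f) f)
      go : Tri (k < i) (k ≡ i) (i < k) → Z ε k (Ψ i (w i) (w (suc i)) f) ≋ scp (w' k) ⊗ Ψ i (w i) (w (suc i)) f
      go (tri≈ _ refl _) rewrite wi = ≋-trans (Z-Ψ i ltk Z-first)
        (solve 5 (λ E E' t h f → (E' :- E) :* (E' :* (h :+ (:1 :- t) :* f)) :+ ((:1 :- t) :* E') :* (E :* f)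
          := E' :* ((E' :- E) :* h :+ ((:1 :- t) :* E') :* f)) ≋-refl E E' t (T′ i f) f)
      go (tri< k<i k≢i _) rewrite wk k k≢i (λ { refl → ℕₚ.<-asym k<i ℕₚ.≤-refl }) = Z-other k ltk (T-Z-above i k f k<i lt)
      go (tri> _ k≢i i<k) with ℕₚ.m≤n⇒m<n∨m≡n i<k
      ... | inj₁ si<k rewrite wk k k≢i (λ { refl → ℕₚ.<-irrefl refl si<k }) = Z-other k ltk (T-Z-below i k f si<k ltk)
      ... | inj₂ refl rewrite wsi = ≋-trans (Z-Ψ (suc i) ltk Z-second)
        (solve 5 (λ E E' t h f → (E' :- E) :* ((t :- :1) :* (E' :* f) :+ E :* h) :+ ((:1 :- t) :* E') :* (E' :* f)
          := E :* ((E' :- E) :* h :+ ((:1 :- t) :* E') :* f)) ≋-refl E E' t (T′ i f) f)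

-- The raising operator x₁ ω⁻¹

module _ {n : ℕ} (ε : ℕ) where
  chain-cong : ∀ a m {f g : Poly n} → a ℕ.+ m < n → f ≋ g → chain a m f ≋ chain a m g
  chain-cong a zero    lt e = e
  chain-cong a (suc m) lt e = T-cong a (ℕₚ.≤-<-trans (s≤s (ℕₚ.m≤m+n a m)) (tail-< a lt)) (chain-cong (suc a) m (tail-< a lt) e)

  down-x : ∀ a m (f : Poly n) → a ℕ.+ m < n → down a m (x (a ℕ.+ m) ⊗ f) ≋ x a ⊗ chain a m f
  down-x a zero    f lt = ≋-reflexive (cong (λ i → x i ⊗ f) (ℕₚ.+-identityʳ a))
  down-x a (suc m) f lt = ≋-trans (τ-cong a (head-< a lt) (≋-trans (≋-reflexive (cong (λ i → down (suc a) m (x i ⊗ f)) (ℕₚ.+-suc a m)))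
                                                        (down-x (suc a) m f (tail-< a lt))))
                                  (τ-x a _ (head-< a lt))

  ω-down : ∀ a m (f : Poly n) → suc a ℕ.+ m < n → ω ε (down (suc a) m f) ≋ down a m (ω ε f)
  ω-down a zero    f lt = ≋-refl
  ω-down a (suc m) f lt = ≋-trans (≋-sym (τ-ω ε a _ lt-a)) (τ-cong a (ℕₚ.<⇒≤ lt-a) (ω-down (suc a) m f lt′))
    where
    lt′ = subst (_< n) (ℕₚ.+-suc (suc a) m) lt
    lt-a = ℕₚ.≤-<-trans (s≤s (s≤s (ℕₚ.m≤m+n a m))) lt′

  ω-chain : ∀ a m (f : Poly n) → suc a ℕ.+ m < n → ω ε (chain (suc a) m f) ≋ chain a m (ω ε f)
  ω-chain a zero    f lt = ≋-refl
  ω-chain a (suc m) f lt = ≋-trans (≋-sym (T-ω ε a _ lt-a)) (T-cong a (ℕₚ.<⇒≤ lt-a) (ω-chain (suc a) m f lt′))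
    where
    lt′ = subst (_< n) (ℕₚ.+-suc (suc a) m) lt
    lt-a = ℕₚ.≤-<-trans (s≤s (s≤s (ℕₚ.m≤m+n a m))) lt′

-- g is x₁ ω⁻¹ f up to a power of q; this is stated without ω⁻¹.
module _ {N : ℕ} (ε M : ℕ) (f g : Poly (suc N)) (ωg : ω ε g ≋ sc M 0 ⊗ (x N ⊗ f)) where
  open ≋-Reasoning {suc N}

  ω-reflects : ∀ {p r : Poly (suc N)} → ω ε p ≋ ω ε r → p ≋ r
  ω-reflects e = ⊖≋0⇒≋ (ω-injective ε (≋-trans (ω-⊖ ε _ _) (≋⇒⊖≋0 e)))

  -- `down-x` turns the τ's of Z₁ into the T's of Z_n while the last variable walks to the front;
  -- the outer ω then sends x₁ to q^ε x_n, the source of the extra q^ε in the eigenvalue.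
  raise-first : ∀ a b → Z ε N f ≋ sc a b ⊗ f → Z ε 0 g ≋ sc (a ℕ.+ ε) b ⊗ g
  raise-first a b h = ω-reflects (begin
    ω ε (Z ε 0 g) ≈⟨ ω-cong ε (down-cong 0 N ℕₚ.≤-refl ωg) ⟩
    ω ε (down 0 N (sc M 0 ⊗ (x N ⊗ f))) ≈⟨ ω-cong ε (≋-trans (down-linear 0 N _ ℕₚ.≤-refl (λ j _ → s-sc j M 0)) (⊗-congˡ (down-x ε 0 N f ℕₚ.≤-refl))) ⟩
    ω ε (sc M 0 ⊗ (x 0 ⊗ chain 0 N f)) ≡⟨ cong (λ z → ω ε (sc M 0 ⊗ (x 0 ⊗ z))) (up-chain N f) ⟨
    ω ε (sc M 0 ⊗ (x 0 ⊗ up N f)) ≈⟨ ≋-trans (ω-⊗ ε _ _) (⊗-cong (ω-sc ε M 0) (ω-⊗ ε _ _)) ⟩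
    sc M 0 ⊗ (ω ε (x 0) ⊗ ω ε (up N f)) ≈⟨ ⊗-congˡ (⊗-cong (ω-x-0 ε) last) ⟩
    sc M 0 ⊗ ((sc ε 0 ⊗ x N) ⊗ (sc a b ⊗ f))
      ≈⟨ solve 5 (λ m e x a f → m :* ((e :* x) :* (a :* f)) := (a :* e) :* (m :* (x :* f))) ≋-refl (sc M 0) (sc ε 0) (x N) (sc a b) f ⟩
    (sc a b ⊗ sc ε 0) ⊗ (sc M 0 ⊗ (x N ⊗ f)) ≈⟨ ⊗-cong (≋-trans (sc-⊗ a b ε 0) (≋-reflexive (cong (sc (a ℕ.+ ε)) (ℕₚ.+-identityʳ b)))) (≋-sym ωg) ⟩
    sc (a ℕ.+ ε) b ⊗ ω ε g ≈⟨ ⊗-congʳ (ω-sc ε (a ℕ.+ ε) b) ⟨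
    ω ε (sc (a ℕ.+ ε) b) ⊗ ω ε g ≈⟨ ω-⊗ ε _ _ ⟨
    ω ε (sc (a ℕ.+ ε) b ⊗ g) ∎)
    where
    last : ω ε (up N f) ≋ sc a b ⊗ f
    last = ≋-trans (≋-reflexive (cong (λ m → down N m (ω ε (up N f))) (sym (ℕₚ.n∸n≡0 N)))) h

module _ {N : ℕ} (ε M : ℕ) (f g : Poly (suc (suc N))) (ωg : ω ε g ≋ sc M 0 ⊗ (x (suc N) ⊗ f)) where
  open ≋-Reasoning {suc (suc N)}

  -- In `Z ε (suc k)` the leftmost factor `T′ 0` of `up` crosses ω² as `T′ N`, and the variable
  -- `x N` that it meets there turns it into `τ N`, the very factor that `Z ε k` has in addition.
  raise-next : ∀ k a b → k ≤ N → Z ε k f ≋ sc a b ⊗ f → Z ε (suc k) g ≋ sc a b ⊗ g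
  raise-next k a b k≤N h = ω-reflects ε M f g ωg (begin
    ω ε (down (suc k) m (ω ε (up (suc k) g))) ≈⟨ ω-down ε k m _ (s≤s (ℕₚ.≤-reflexive (cong suc k+m))) ⟩
    down k m (ω ε (ω ε (up (suc k) g))) ≡⟨ cong (λ z → down k m (ω ε (ω ε z))) (up-chain (suc k) g) ⟩
    down k m (ω ε (ω ε (T′ 0 (chain 1 k g)))) ≈⟨ down-cong k m ltm (T-ω² ε (chain 1 k g)) ⟨
    down k m (T′ N (ω ε (ω ε (chain 1 k g)))) ≈⟨ down-cong k m ltm (T-cong N ℕₚ.≤-refl inner) ⟩
    down k m (T′ N (Q ⊗ (x N ⊗ ω ε (up k f))))
      ≈⟨ down-cong k m ltm (≋-trans (T-linear N _ ℕₚ.≤-refl (s-sc N M 0)) (≋-trans (⊗-congˡ (T-x N _ ℕₚ.≤-refl)) (≋-sym (⊗-assoc _ _ _)))) ⟩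
    down k m ((Q ⊗ x (suc N)) ⊗ τ N (ω ε (up k f))) ≈⟨ down-linear k m _ ltm (λ j j< → Qx j (subst (j <_) k+m j<)) ⟩
    (Q ⊗ x (suc N)) ⊗ down k m (τ N (ω ε (up k f))) ≡⟨ cong (λ i → (Q ⊗ x (suc N)) ⊗ down k m (τ i (ω ε (up k f)))) k+m ⟨
    (Q ⊗ x (suc N)) ⊗ down k m (τ (k ℕ.+ m) (ω ε (up k f))) ≡⟨ cong ((Q ⊗ x (suc N)) ⊗_) (down-snoc k m (ω ε (up k f))) ⟨
    (Q ⊗ x (suc N)) ⊗ down k (suc m) (ω ε (up k f)) ≡⟨ cong (λ z → (Q ⊗ x (suc N)) ⊗ down k z (ω ε (up k f))) (sym (ℕₚ.+-∸-assoc 1 k≤N)) ⟩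
    (Q ⊗ x (suc N)) ⊗ Z ε k f ≈⟨ ⊗-congˡ h ⟩
    (Q ⊗ x (suc N)) ⊗ (sc a b ⊗ f) ≈⟨ solve 4 (λ q x a f → (q :* x) :* (a :* f) := a :* (q :* (x :* f))) ≋-refl Q (x (suc N)) (sc a b) f ⟩
    sc a b ⊗ (Q ⊗ (x (suc N) ⊗ f)) ≈⟨ ⊗-cong (ω-sc ε a b) ωg ⟨
    ω ε (sc a b) ⊗ ω ε g ≈⟨ ω-⊗ ε _ _ ⟨
    ω ε (sc a b ⊗ g) ∎)
    where
    m = N ∸ k
    Q : Poly (suc (suc N))
    Q = sc M 0
    k+m : k ℕ.+ m ≡ N
    k+m = ℕₚ.m+[n∸m]≡n k≤N
    ltm : k ℕ.+ m < suc (suc N)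
    ltm = s≤s (ℕₚ.m≤n⇒m≤1+n (ℕₚ.≤-reflexive k+m))
    Qx : ∀ j → j < N → s j (Q ⊗ x (suc N)) ≋ Q ⊗ x (suc N)
    Qx j lt = ≋-trans (s-⊗ j _ _) (⊗-cong (s-sc j M 0) (s-x-far j (suc N) (s≤s lt)))
    inner : ω ε (ω ε (chain 1 k g)) ≋ Q ⊗ (x N ⊗ ω ε (up k f))
    inner = begin
      ω ε (ω ε (chain 1 k g)) ≈⟨ ω-cong ε (ω-chain ε 0 k g (s≤s (s≤s k≤N))) ⟩
      ω ε (chain 0 k (ω ε g)) ≈⟨ ω-cong ε (chain-cong ε 0 k (s≤s (ℕₚ.m≤n⇒m≤1+n k≤N)) (≋-trans ωg (≋-sym (⊗-assoc _ _ _)))) ⟩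
      ω ε (chain 0 k ((Q ⊗ x (suc N)) ⊗ f)) ≡⟨ cong (ω ε) (up-chain k _) ⟨
      ω ε (up k ((Q ⊗ x (suc N)) ⊗ f)) ≈⟨ ω-cong ε (up-linear k f (s≤s (ℕₚ.m≤n⇒m≤1+n k≤N)) (λ j j<k → Qx j (ℕₚ.<-≤-trans j<k k≤N))) ⟩
      ω ε ((Q ⊗ x (suc N)) ⊗ up k f) ≈⟨ ≋-trans (ω-⊗ ε _ _) (⊗-congʳ (≋-trans (ω-⊗ ε _ _) (⊗-cong (ω-sc ε M 0) (ω-x-suc ε N ℕₚ.≤-refl)))) ⟩
      (Q ⊗ x N) ⊗ ω ε (up k f) ≈⟨ ⊗-assoc _ _ _ ⟩
      Q ⊗ (x N ⊗ ω ε (up k f)) ∎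

raised : ∀ {N} ε M (f g : Poly (suc N)) → ω ε g ≋ sc M 0 ⊗ (x N ⊗ f) → ∀ w w' →
         w' 0 ≡ (proj₁ (w N) ℕ.+ ε , proj₂ (w N)) → (∀ k → k < N → w' (suc k) ≡ w k) →
         HasWeight ε f w → HasWeight ε g w'
raised ε M f g ωg w w' e0 es h zero lt rewrite e0 = raise-first ε M f g ωg _ _ (h _ ℕₚ.≤-refl)
raised {suc N} ε M f g ωg w w' e0 es h (suc k) (s≤s (s≤s k≤N)) rewrite es k (s≤s k≤N) =
  raise-next ε M f g ωg k _ _ k≤N (h k (s≤s (ℕₚ.m≤n⇒m≤1+n k≤N)))

-- Coefficients of monomials in x

infix 4 _≟ˡ_
_≟ˡ_ : (u v : List ℕ) → Dec (u ≡ v)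
_≟ˡ_ = Lₚ.≡-dec ℕ._≟_

-- Monomials in x are addressed by lists, not vectors, so that a word can be cut as `A ++ a ∷ b ∷ B`
-- where an operator acts; a list of the wrong length has coefficient 0.
select : ∀ {n} → List ℕ → (Mon 0 → ℚ) → Mon n → ℚ
select u F (a , b , v) with toList v ≟ˡ u
... | yes _ = F (a , b , [])
... | no _  = 0ℚ

select-cong : ∀ {n k} {u u' : List ℕ} {F F' : Mon 0 → ℚ} (a b a' b' : ℕ) (v : Vec ℕ n) (w : Vec ℕ k) →
              (toList v ≡ u → toList w ≡ u') → (toList w ≡ u' → toList v ≡ u) →
              (toList v ≡ u → F (a , b , []) ≡ F' (a' , b' , [])) →
              select u F (a , b , v) ≡ select u' F' (a' , b' , w)
select-cong {u = u} {u'} a b a' b' v w f g h with toList v ≟ˡ u | toList w ≟ˡ u'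
... | yes p | yes q = h p
... | yes p | no ¬q = ⊥-elim (¬q (f p))
... | no ¬p | yes q = ⊥-elim (¬p (g q))
... | no _  | no _  = refl

select-no : ∀ {n} {u : List ℕ} {F : Mon 0 → ℚ} (a b : ℕ) (v : Vec ℕ n) → toList v ≢ u → select u F (a , b , v) ≡ 0ℚ
select-no {u = u} a b v ne with toList v ≟ˡ u
... | yes p = ⊥-elim (ne p)
... | no _  = refl

opaque
  -- the coefficient of x^u, a polynomial in q and t
  cl : ∀ {n} → List ℕ → Poly n → Poly 0
  cl u [] = []
  cl u ((c , a , b , v) ∷ p) with toList v ≟ˡ u
  ... | yes _ = (c , a , b , []) ∷ cl u p
  ... | no _  = cl u p

  pair-cl : ∀ {n} u (p : Poly n) F → pair (cl u p) F ≡ pair p (select u F)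
  pair-cl u [] F = refl
  pair-cl u ((c , a , b , v) ∷ p) F with toList v ≟ˡ u
  ... | yes _ = cong (c Q.* F (a , b , []) Q.+_) (pair-cl u p F)
  ... | no _  = trans (pair-cl u p F) (trans (sym (Qₚ.+-identityˡ _)) (cong (Q._+ pair p (select u F)) (sym (Qₚ.*-zeroʳ c))))

module _ {n : ℕ} where
  cl-cong : ∀ u {p r : Poly n} → p ≋ r → cl u p ≋ cl u r
  cl-cong u {p} {r} e = mk≋ λ F → trans (pair-cl u p F) (trans (pair≡ e _) (sym (pair-cl u r F)))

  cl-≡ : ∀ {u v} (p : Poly n) → u ≡ v → cl u p ≋ cl v p
  cl-≡ p refl = ≋-refl

  cl-⊕ : ∀ u (p r : Poly n) → cl u (p ⊕ r) ≋ cl u p ⊕ cl u r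
  cl-⊕ u p r = mk≋ λ F → trans (pair-cl u _ F) (trans (pair-⊕ p r _)
    (sym (trans (pair-⊕ _ _ F) (cong₂ Q._+_ (pair-cl u p F) (pair-cl u r F)))))

  cl-⊟ : ∀ u (p : Poly n) → cl u (⊟ p) ≋ ⊟ cl u p
  cl-⊟ u p = mk≋ λ F → trans (pair-cl u _ F) (trans (pair-⊟ p _) (sym (trans (pair-⊟ _ F) (cong Q.-_ (pair-cl u p F)))))

  cl-⊖ : ∀ u (p r : Poly n) → cl u (p ⊖′ r) ≋ cl u p ⊖′ cl u r
  cl-⊖ u p r = ≋-trans (cl-⊕ u p (⊟ r)) (⊕-congˡ (cl-⊟ u r))

  cl-ι : ∀ u a (f : Poly n) → cl u (ι a ⊗ f) ≋ a ⊗ cl u f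
  cl-ι u a f = mk≋ λ F → begin
    pair (cl u (ι a ⊗ f)) F ≡⟨ pair-cl u _ F ⟩
    pair (ι a ⊗ f) (select u F) ≡⟨ pair-⊗ (ι a) f _ ⟩
    pair (ι a) (λ m → pair f (λ k → select u F (mulMon m k))) ≡⟨ pair-ι a _ ⟩
    pair a (λ m → pair f (λ k → select u F (mulMon (embedMon m) k))) ≡⟨ pair-cong a (λ m → pair-cong f (λ k → step F m k)) ⟩
    pair a (λ m → pair f (select u (λ k → F (mulMon m k)))) ≡⟨ pair-cong a (λ m → pair-cl u f _) ⟨
    pair a (λ m → pair (cl u f) (λ k → F (mulMon m k))) ≡⟨ pair-⊗ a (cl u f) F ⟨
    pair (a ⊗ cl u f) F ∎
    where
    open ≡-Reasoning
    step : ∀ F m k → select u F (mulMon (embedMon m) k) ≡ select u (λ k → F (mulMon m k)) k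
    step F (a , b , []) (a' , b' , v) = select-cong _ _ _ _ (V.zipWith ℕ._+_ zeros v) v
      (trans (cong toList (sym z+v))) (trans (cong toList z+v)) (λ _ → refl)
      where z+v = Vₚ.zipWith-identityˡ ℕₚ.+-identityˡ v

  cl-sc : ∀ u a b (f : Poly n) → cl u (sc a b ⊗ f) ≋ sc a b ⊗ cl u f
  cl-sc u a b f = ≋-trans (cl-cong u (⊗-congʳ (≋-sym (ι-sc a b)))) (cl-ι u (sc a b) f)

incAt : ℕ → List ℕ → List ℕ
incAt _       []      = []
incAt zero    (a ∷ l) = suc a ∷ l
incAt (suc j) (a ∷ l) = a ∷ incAt j l

toList-unit : ∀ {n} j (v : Vec ℕ n) → j < n → toList (V.zipWith ℕ._+_ (unitV j) v) ≡ incAt j (toList v)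
toList-unit zero (a ∷ v) lt = cong (λ w → suc a ∷ toList w) (Vₚ.zipWith-identityˡ ℕₚ.+-identityˡ v)
toList-unit (suc j) (a ∷ v) (s≤s lt) = cong (a ∷_) (toList-unit j v lt)

incAt-++ : ∀ A {a B} → incAt (length A) (A ++ a ∷ B) ≡ A ++ suc a ∷ B
incAt-++ [] = refl
incAt-++ (x ∷ A) = cong (x ∷_) (incAt-++ A)

incAt-inv : ∀ A {a B} l → incAt (length A) l ≡ A ++ suc a ∷ B → l ≡ A ++ a ∷ B
incAt-inv [] (_ ∷ l) refl = refl
incAt-inv (x ∷ A) (y ∷ l) e = cong₂ _∷_ (Lₚ.∷-injectiveˡ e) (incAt-inv A l (Lₚ.∷-injectiveʳ e))

incAt-pos : ∀ A {B} l → incAt (length A) l ≢ A ++ 0 ∷ B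
incAt-pos [] (_ ∷ l) ()
incAt-pos (x ∷ A) (y ∷ l) e = incAt-pos A l (Lₚ.∷-injectiveʳ e)

swapL : ℕ → List ℕ → List ℕ
swapL zero    (a ∷ b ∷ l) = b ∷ a ∷ l
swapL (suc j) (a ∷ l)     = a ∷ swapL j l
swapL _       l           = l

toList-swap : ∀ {n} j (v : Vec ℕ n) → toList (swapAt j v) ≡ swapL j (toList v)
toList-swap zero [] = refl
toList-swap (suc j) [] = refl
toList-swap zero (a ∷ []) = refl
toList-swap zero (a ∷ b ∷ v) = refl
toList-swap (suc j) (a ∷ v) = cong (a ∷_) (toList-swap j v)

swapL-++ : ∀ A {a b B} → swapL (length A) (A ++ a ∷ b ∷ B) ≡ A ++ b ∷ a ∷ B
swapL-++ [] = refl
swapL-++ (x ∷ A) = cong (x ∷_) (swapL-++ A)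

swapL-inv : ∀ A {a b B} l → swapL (length A) l ≡ A ++ a ∷ b ∷ B → l ≡ A ++ b ∷ a ∷ B
swapL-inv [] (_ ∷ _ ∷ l) refl = refl
swapL-inv (x ∷ A) (y ∷ l) e = cong₂ _∷_ (Lₚ.∷-injectiveˡ e) (swapL-inv A l (Lₚ.∷-injectiveʳ e))

module _ {n : ℕ} where
  cl-x-suc : ∀ A {a B} (f : Poly n) → length A < n → cl (A ++ suc a ∷ B) (x (length A) ⊗ f) ≋ cl (A ++ a ∷ B) f
  cl-x-suc A {a} {B} f lt = mk≋ λ F → trans (pair-cl _ _ F) (trans (pair-mono-⊗ _ f _)
    (trans (pair-cong f (λ { (a' , b' , v) → select-cong _ _ _ _ (V.zipWith ℕ._+_ (unitV (length A)) v) v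
      (λ e → incAt-inv A (toList v) (trans (sym (toList-unit _ v lt)) e))
      (λ e → trans (toList-unit _ v lt) (trans (cong (incAt (length A)) e) (incAt-++ A)))
      (λ _ → refl) }))
    (sym (pair-cl _ f F))))

  cl-x-zero : ∀ A {B} (f : Poly n) → length A < n → cl (A ++ 0 ∷ B) (x (length A) ⊗ f) ≋ 0p
  cl-x-zero A {B} f lt = mk≋ λ F → trans (pair-cl _ _ F) (trans (pair-mono-⊗ _ f _)
    (trans (pair-cong f (λ { (a' , b' , v) → select-no {F = F} _ _ (V.zipWith ℕ._+_ (unitV (length A)) v)
      (λ e → incAt-pos A (toList v) (trans (sym (toList-unit _ v lt)) e)) }))
    (trans (pair-0 f) (sym (pair-0p F)))))

  cl-s : ∀ A {a b B} (f : Poly n) → cl (A ++ a ∷ b ∷ B) (s (length A) f) ≋ cl (A ++ b ∷ a ∷ B) f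
  cl-s A {a} {b} {B} f = mk≋ λ F → trans (pair-cl _ _ F) (trans (pair-s _ f _)
    (trans (pair-cong f (λ { (a' , b' , v) → select-cong _ _ _ _ (swapAt (length A) v) v
      (λ e → swapL-inv A (toList v) (trans (sym (toList-swap _ v)) e))
      (λ e → trans (toList-swap _ v) (trans (cong (swapL (length A)) e) (swapL-++ A)))
      (λ _ → refl) }))
    (sym (pair-cl _ f F))))

  cl-ω : ∀ ε B m (f : Poly n) → cl (B ∷ʳ m) (ω ε f) ≋ sc (ε ℕ.* m) 0 ⊗ cl (m ∷ B) f
  cl-ω ε B m f = mk≋ λ F → trans (pair-cl _ _ F) (trans (pair-ω ε f _)
    (trans (pair-cong f (step F))
    (sym (trans (pair-mono-⊗ _ _ F) (pair-cl _ f _)))))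
    where
    step : ∀ F m' → select (B ∷ʳ m) F (rotMon ε m') ≡ select (m ∷ B) (λ k → F (mulMon (ε ℕ.* m , 0 , zeros) k)) m'
    step F (a , b , []) = trans (select-no {F = F} a b [] (λ e → nil≢ B e)) (sym (select-no {u = m ∷ B} {F = λ k → F (mulMon (ε ℕ.* m , 0 , zeros) k)} a b [] (λ ())))
      where
      nil≢ : ∀ B → [] ≢ B ∷ʳ m
      nil≢ [] ()
      nil≢ (_ ∷ _) ()
    step F (a , b , h ∷ w) = select-cong _ _ _ _ (w V.∷ʳ h) (h ∷ w)
      (λ e → let p , q = Lₚ.∷ʳ-injective (toList w) B (trans (sym (Vₚ.toList-∷ʳ h w)) e) in cong₂ _∷_ q p)
      (λ { refl → Vₚ.toList-∷ʳ h w })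
      (λ e → cong (λ c → F (c , b , [])) (trans (ℕₚ.+-comm a _) (cong (λ z → ε ℕ.* z ℕ.+ a) (proj₂ (Lₚ.∷ʳ-injective (toList w) B (trans (sym (Vₚ.toList-∷ʳ h w)) e))))))

  cl-length : ∀ u (f : Poly n) → length u ≢ n → cl u f ≋ 0p
  cl-length u f ne = mk≋ λ F → trans (pair-cl _ _ F)
    (trans (pair-cong f (λ { (a , b , v) → select-no {F = F} a b v (λ e → ne (trans (cong length (sym e)) (Vₚ.length-toList v))) }))
    (trans (pair-0 f) (sym (pair-0p F))))

  toList-injective : ∀ {n} {v w : Vec ℕ n} → toList v ≡ toList w → v ≡ w
  toList-injective {v = []} {[]} e = refl
  toList-injective {v = a ∷ v} {b ∷ w} e = cong₂ _∷_ (Lₚ.∷-injectiveˡ e) (toList-injective (Lₚ.∷-injectiveʳ e))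

  cl-injective : ∀ {f : Poly n} → (∀ u → cl u f ≋ 0p) → f ≋ 0p
  cl-injective {f} h = ≋-trans (≈P⇒≋ {p = f} {r = []} coeff0) (≋-sym 0p≋[])
    where
    coeff0 : ∀ m → coeff f m ≡ 0ℚ
    coeff0 m@(a , b , v) = trans (coeff-pair f m) (trans (pair-cong f (λ { k@(a' , b' , w) → step k }))
        (trans (sym (pair-cl (toList v) f _)) (trans (pair≡ (h (toList v)) _) (pair-0p (δ (a , b , []))))))
      where
      step : ∀ k → δ m k ≡ select (toList v) (δ (a , b , [])) k
      step (a' , b' , w) with toList w ≟ˡ toList v
      ... | yes e rewrite toList-injective e | vecEqᵇ-refl v = refl
      ... | no ne with monEqᵇ (a' , b' , w) m in e
      ...   | false = refl
      ...   | true = ⊥-elim (ne (cong (toList ∘ proj₂ ∘ proj₂) (monEqᵇ-sound (a' , b' , w) m e)))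

  cl-support : ∀ (f : Poly n) → ∃ λ S → ∀ u → u ∉ S → cl u f ≋ 0p
  cl-support f = support f , λ u u∉ → mk≋ λ F → trans (pair-cl u f F)
      (trans (go u F f u∉) (sym (pair-0p F)))
    where
    support : Poly n → List (List ℕ)
    support = L.map (λ cm → toList (proj₂ (proj₂ (proj₂ cm))))
    go : ∀ u F (f : Poly n) → u ∉ support f → pair f (select u F) ≡ 0ℚ
    go u F [] _ = refl
    go u F ((c , a , b , v) ∷ f) u∉ = trans (cong₂ Q._+_ (trans (cong (c Q.*_) (select-no {F = F} a b v (λ e → u∉ (here (sym e))))) (Qₚ.*-zeroʳ c))
      (go u F f (u∉ ∘ there))) (Qₚ.+-identityˡ 0ℚ)

-- Triangularity

bit : Bool → ℕ
bit true  = 1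
bit false = 0

count< count≤ : ℕ → List ℕ → ℕ
count< m []      = 0
count< m (y ∷ R) = bit (y <ᵇ m) ℕ.+ count< m R
count≤ m []      = 0
count≤ m (y ∷ R) = bit (y ≤ᵇ m) ℕ.+ count≤ m R

<ᵇ-true : ∀ {a b} → a < b → (a <ᵇ b) ≡ true
<ᵇ-true lt = Equivalence.to T-≡ (ℕₚ.<⇒<ᵇ lt)

<ᵇ-false : ∀ {a b} → b ≤ a → (a <ᵇ b) ≡ false
<ᵇ-false {a} {b} le with a <ᵇ b in e
... | false = refl
... | true  = ⊥-elim (ℕₚ.<-irrefl refl (ℕₚ.<-≤-trans (ℕₚ.<ᵇ⇒< a b (subst T (sym e) tt)) le))

≤ᵇ-true : ∀ {a b} → a ≤ b → (a ≤ᵇ b) ≡ true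
≤ᵇ-true le = Equivalence.to T-≡ (ℕₚ.≤⇒≤ᵇ le)

≤ᵇ-false : ∀ {a b} → b < a → (a ≤ᵇ b) ≡ false
≤ᵇ-false {a} {b} lt with a ≤ᵇ b in e
... | false = refl
... | true  = ⊥-elim (ℕₚ.<-irrefl refl (ℕₚ.<-≤-trans lt (ℕₚ.≤ᵇ⇒≤ a b (subst T (sym e) tt))))

-- The square norm is constant on rearrangements and, by `convex`, grows when two letters with fixed
-- sum move apart. The monomials that a divided difference creates strictly between a pair thus have
-- smaller norm.
sq : List ℕ → ℕ
sq []      = 0
sq (a ∷ u) = a ℕ.* a ℕ.+ sq u

sq-++ : ∀ u v → sq (u ++ v) ≡ sq u ℕ.+ sq v
sq-++ []      v = refl
sq-++ (a ∷ u) v = trans (cong (a ℕ.* a ℕ.+_) (sq-++ u v)) (sym (ℕₚ.+-assoc (a ℕ.* a) _ _))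

sq-pair : ∀ A a b B → sq (A ++ a ∷ b ∷ B) ≡ (a ℕ.* a ℕ.+ b ℕ.* b) ℕ.+ (sq A ℕ.+ sq B)
sq-pair A a b B = trans (sq-++ A _)
  (ℕSolver.+-*-Solver.solve 4 (λ A a b B → A ⊹ (a ⊹ (b ⊹ B)) ⩴ (a ⊹ b) ⊹ (A ⊹ B)) refl (sq A) (a ℕ.* a) (b ℕ.* b) (sq B))
  where open ℕSolver.+-*-Solver using () renaming (_:+_ to _⊹_; _:=_ to _⩴_)

sq-swap : ∀ A a b B → sq (A ++ b ∷ a ∷ B) ≡ sq (A ++ a ∷ b ∷ B)
sq-swap A a b B = trans (sq-pair A b a B) (trans (cong (ℕ._+ (sq A ℕ.+ sq B)) (ℕₚ.+-comm (b ℕ.* b) (a ℕ.* a))) (sym (sq-pair A a b B)))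

convex : ∀ {a b k l} → k ℕ.+ l ≡ a ℕ.+ b → a < k → b ≤ a → a ℕ.* a ℕ.+ b ℕ.* b < k ℕ.* k ℕ.+ l ℕ.* l
convex {a} {b} {k} {l} sum a<k b≤a with ℕₚ.m≤n⇒∃[o]m+o≡n a<k | ℕₚ.m≤n⇒∃[o]m+o≡n b≤a
... | e , refl | g , refl with b≡
  where
  b≡ : b ≡ suc e ℕ.+ l
  b≡ = ℕₚ.+-cancelˡ-≡ (b ℕ.+ g) _ _ (trans (sym sum) (trans (cong (ℕ._+ l) (sym (ℕₚ.+-suc (b ℕ.+ g) e))) (ℕₚ.+-assoc (b ℕ.+ g) (suc e) l)))
... | refl = subst (lhs <_) (sym identity) (ℕₚ.m<m+n lhs (s≤s z≤n))
  where
  lhs = (suc e ℕ.+ l ℕ.+ g) ℕ.* (suc e ℕ.+ l ℕ.+ g) ℕ.+ (suc e ℕ.+ l) ℕ.* (suc e ℕ.+ l)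
  open ℕSolver.+-*-Solver using (con) renaming (solve to solveℕ; _:+_ to _⊹_; _:*_ to _✶_; _:=_ to _⩴_)
  -- For letters with a - b = g that move apart by e + 1 each, the gain is 2 (e + 1) (e + 1 + g).
  identity : (suc (suc e ℕ.+ l ℕ.+ g) ℕ.+ e) ℕ.* (suc (suc e ℕ.+ l ℕ.+ g) ℕ.+ e) ℕ.+ l ℕ.* l ≡ lhs ℕ.+ suc e ℕ.* (2 ℕ.* (suc e ℕ.+ g))
  identity = solveℕ 3 (λ e l g → let E = con 1 ⊹ e ; a = E ⊹ l ⊹ g in
    (con 1 ⊹ a ⊹ e) ✶ (con 1 ⊹ a ⊹ e) ⊹ l ✶ l ⩴ a ✶ a ⊹ (E ⊹ l) ✶ (E ⊹ l) ⊹ E ✶ (con 2 ✶ (E ⊹ g))) refl e l g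

split₂ : ∀ j (u : List ℕ) → suc j < length u → ∃ λ A → ∃ λ a → ∃ λ b → ∃ λ B → u ≡ A ++ a ∷ b ∷ B × length A ≡ j
split₂ zero (a ∷ b ∷ u) lt = [] , a , b , u , refl , refl
split₂ zero (a ∷ []) (s≤s ())
split₂ (suc j) (x ∷ u) (s≤s lt) with split₂ j u lt
... | A , a , b , B , refl , refl = x ∷ A , a , b , B , refl , refl

snoc-++ : ∀ (A : List ℕ) b R → (A ++ b ∷ []) ++ R ≡ A ++ b ∷ R
snoc-++ A b R = Lₚ.++-assoc A (b ∷ []) R

length-snoc : ∀ (A : List ℕ) b → length (A ++ b ∷ []) ≡ suc (length A)
length-snoc A b = trans (Lₚ.length-++ A) (ℕₚ.+-comm (length A) 1)

length-swap : ∀ (A : List ℕ) {a b B} → length (A ++ a ∷ b ∷ B) ≡ length (A ++ b ∷ a ∷ B)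
length-swap A = trans (Lₚ.length-++ A) (sym (Lₚ.length-++ A))

Top : ∀ {n} → ℕ → Poly n → Set
Top N f = ∀ u → N < sq u → cl u f ≋ 0p

module _ {n : ℕ} (A B : List ℕ) (lt : suc (length A) < n) where
  private
    j = length A
    lt₀ : j < n
    lt₀ = ℕₚ.<⇒≤ lt
    y-coeff : ∀ {k l} (g : Poly n) → cl (A ++ k ∷ suc l ∷ B) (x (suc j) ⊗ g) ≋ cl (A ++ k ∷ l ∷ B) g
    y-coeff {k} {l} g = ≋-trans (≋-trans (cl-≡ _ (sym (snoc-++ A k (suc l ∷ B)))) (cl-cong _ (⊗-congʳ (≋-reflexive (cong x (sym (length-snoc A k)))))))
      (≋-trans (cl-x-suc (A ++ k ∷ []) g (subst (_< n) (sym (length-snoc A k)) lt)) (cl-≡ g (snoc-++ A k (l ∷ B))))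
    y-zero : ∀ {k} (g : Poly n) → cl (A ++ k ∷ 0 ∷ B) (x (suc j) ⊗ g) ≋ 0p
    y-zero {k} g = ≋-trans (≋-trans (cl-≡ _ (sym (snoc-++ A k (0 ∷ B)))) (cl-cong _ (⊗-congʳ (≋-reflexive (cong x (sym (length-snoc A k)))))))
      (cl-x-zero (A ++ k ∷ []) g (subst (_< n) (sym (length-snoc A k)) lt))

  module _ (f : Poly n) where
    private
      φ D : ℕ → ℕ → Poly 0
      φ k l = cl (A ++ k ∷ l ∷ B) f
      D k l = cl (A ++ k ∷ l ∷ B) (∂ j f)

      ∂-coeff : ∀ k l → cl (A ++ k ∷ l ∷ B) (x j ⊗ ∂ j f) ⊖′ cl (A ++ k ∷ l ∷ B) (x (suc j) ⊗ ∂ j f) ≋ φ k l ⊖′ φ l k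
      ∂-coeff k l = begin
        cl u (x j ⊗ ∂ j f) ⊖′ cl u (x (suc j) ⊗ ∂ j f) ≈⟨ cl-⊖ u _ _ ⟨
        cl u (x j ⊗ ∂ j f ⊖′ x (suc j) ⊗ ∂ j f) ≈⟨ cl-cong u (solve 3 (λ x y d → x :* d :- y :* d := (x :- y) :* d) ≋-refl (x j) (x (suc j)) (∂ j f)) ⟩
        cl u (d j ⊗ ∂ j f) ≈⟨ cl-cong u (∂-eq j f lt) ⟩
        cl u (f ⊖′ s j f) ≈⟨ cl-⊖ u _ _ ⟩
        cl u f ⊖′ cl u (s j f) ≈⟨ ⊖-cong ≋-refl (cl-s A f) ⟩
        φ k l ⊖′ φ l k ∎
        where
        open ≋-Reasoning {0}
        u = A ++ k ∷ l ∷ B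

      eq₁₁ : ∀ k l → D k (suc l) ⊖′ D (suc k) l ≋ φ (suc k) (suc l) ⊖′ φ (suc l) (suc k)
      eq₁₁ k l = ≋-trans (≋-sym (⊖-cong (cl-x-suc A _ lt₀) (y-coeff _))) (∂-coeff (suc k) (suc l))
      eq₁₀ : ∀ k → D k 0 ⊖′ 0p ≋ φ (suc k) 0 ⊖′ φ 0 (suc k)
      eq₁₀ k = ≋-trans (≋-sym (⊖-cong (cl-x-suc A _ lt₀) (y-zero _))) (∂-coeff (suc k) 0)
      eq₀₁ : ∀ l → 0p ⊖′ D 0 l ≋ φ 0 (suc l) ⊖′ φ (suc l) 0
      eq₀₁ l = ≋-trans (≋-sym (⊖-cong (cl-x-zero A _ lt₀) (y-coeff _))) (∂-coeff 0 (suc l))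

      Vanish : ℕ → ℕ → Set
      Vanish k l = φ k l ≋ 0p × φ l k ≋ 0p

      diff0 : ∀ {k l} → Vanish k l → φ k l ⊖′ φ l k ≋ 0p
      diff0 (p , q) = ≋-trans (⊖-cong p q) (≋⇒⊖≋0 ≋-refl)

      x-0 : ∀ {p : Poly 0} → p ⊖′ 0p ≋ 0p → p ≋ 0p
      x-0 = ⊖≋0⇒≋
      0-x : ∀ {p : Poly 0} → 0p ⊖′ p ≋ 0p → p ≋ 0p
      0-x e = ≋-sym (⊖≋0⇒≋ e)

      -- Comparing coefficients in d_j ∂_j f = f - s_j f links neighbouring entries of D on an
      -- antidiagonal. The walk outwards to its end meets only coefficients of f that the hypothesis
      -- makes vanish; `D-low` walks the other way.
      D-high : ∀ l k → (∀ k' l' → k' ℕ.+ l' ≡ suc (k ℕ.+ l) → k < k' → Vanish k' l') → D k l ≋ 0p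
      D-high zero k h = x-0 (≋-trans (eq₁₀ k) (diff0 (h (suc k) 0 refl ℕₚ.≤-refl)))
      D-high (suc l) k h = ≋-trans (⊖≋0⇒≋ (≋-trans (eq₁₁ k l) (diff0 (h (suc k) (suc l) refl ℕₚ.≤-refl))))
        (D-high l (suc k) (λ k' l' e lt → h k' l' (trans e (cong suc (sym (ℕₚ.+-suc k l)))) (ℕₚ.<⇒≤ lt)))

      D-low : ∀ k l → (∀ k' l' → k' ℕ.+ l' ≡ suc (k ℕ.+ l) → k' ≤ k → Vanish k' l') → D k l ≋ 0p
      D-low zero l h = 0-x (≋-trans (eq₀₁ l) (diff0 (h 0 (suc l) refl z≤n)))
      D-low (suc k) l h = ≋-trans (≋-sym (⊖≋0⇒≋ (≋-trans (eq₁₁ k l) (diff0 (h (suc k) (suc l) (cong suc (ℕₚ.+-suc k l)) ℕₚ.≤-refl)))))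
        (D-low k (suc l) (λ k' l' e le → h k' l' (trans e (cong suc (ℕₚ.+-suc k l))) (ℕₚ.m≤n⇒m≤1+n le)))

      C : ℕ → ℕ → Poly 0
      C k l = cl (A ++ k ∷ l ∷ B) (c j ⊗ ∂ j f)

      C-coeff : ∀ k l → C k l ≋ t ⊗ cl (A ++ k ∷ l ∷ B) (x j ⊗ ∂ j f) ⊖′ cl (A ++ k ∷ l ∷ B) (x (suc j) ⊗ ∂ j f)
      C-coeff k l = ≋-trans (cl-cong _ (solve 4 (λ t x y d → (t :* x :- y) :* d := t :* (x :* d) :- y :* d) ≋-refl t (x j) (x (suc j)) (∂ j f)))
        (≋-trans (cl-⊖ _ _ _) (⊖-cong (cl-sc _ 0 1 _) ≋-refl))

      module _ {N : ℕ} (top : Top N f) where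
        outer : ∀ {a b k l} → N ≤ sq (A ++ a ∷ b ∷ B) → k ℕ.+ l ≡ a ℕ.+ b → a < k → b ≤ a → Vanish k l
        outer {a} {b} {k} {l} N≤ e a<k b≤a = top _ big , top _ (subst (N <_) (sym (sq-swap A k l B)) big)
          where big = ℕₚ.≤-<-trans N≤ (subst₂ _<_ (sym (sq-pair A a b B)) (sym (sq-pair A k l B)) (ℕₚ.+-monoˡ-< _ (convex e a<k b≤a)))

        outer′ : ∀ {a b k l} → N ≤ sq (A ++ a ∷ b ∷ B) → k ℕ.+ l ≡ a ℕ.+ b → k < a → a ≤ b → Vanish k l
        outer′ {a} {b} {k} {l} N≤ e k<a a≤b = let p , q = outer {b} {a} {l} {k} (subst (N ≤_) (sym (sq-swap A a b B)) N≤)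
                                                             (trans (ℕₚ.+-comm l k) (trans e (ℕₚ.+-comm a b))) b<l a≤b in q , p
          where
          b<l : b < l
          b<l = ℕₚ.+-cancelˡ-< k b l (subst (k ℕ.+ b <_) (sym e) (ℕₚ.+-monoˡ-< b k<a))

        -- At a > b only the summand t x_j of c_j contributes, at a < b only - x_{j+1}, at a = b
        -- neither: the rest reads entries of D that lie beyond the pair, or would need a negative
        -- exponent.
        C-gt : ∀ {a b} → b < a → N ≤ sq (A ++ a ∷ b ∷ B) → C a b ≋ t ⊗ (φ a b ⊖′ φ b a)
        C-gt {suc a} {zero} lt N≤ = ≋-trans (C-coeff _ _) (≋-trans (⊖-cong (⊗-congˡ (≋-trans (cl-x-suc A _ lt₀)
            (≋-trans (solve 1 (λ d → d := d :- :0) ≋-refl _) (eq₁₀ a)))) (y-zero _)) (solve 1 (λ p → p :- :0 := p) ≋-refl _))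
        C-gt {suc a} {suc b} lt N≤ = ≋-trans (C-coeff _ _) (≋-trans (⊖-cong (⊗-congˡ (≋-trans (cl-x-suc A _ lt₀)
            (≋-trans (≋-trans (solve 1 (λ d → d := d :- :0) ≋-refl _) (⊖-cong ≋-refl (≋-sym D0))) (eq₁₁ a b)))) (≋-trans (y-coeff _) D0)) (solve 1 (λ p → p :- :0 := p) ≋-refl _))
          where
          D0 : D (suc a) b ≋ 0p
          D0 = D-high b (suc a) (λ k' l' e lt' → outer {suc a} {suc b} N≤ (trans e (cong suc (sym (ℕₚ.+-suc a b)))) lt' (ℕₚ.<⇒≤ lt))

        C-lt : ∀ {a b} → a < b → N ≤ sq (A ++ a ∷ b ∷ B) → C a b ≋ φ a b ⊖′ φ b a
        C-lt {zero} {suc b} lt N≤ = ≋-trans (C-coeff _ _) (≋-trans (⊖-cong (⊗-congˡ (cl-x-zero A _ lt₀)) (y-coeff _))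
          (≋-trans (solve 2 (λ t d → t :* :0 :- d := :0 :- d) ≋-refl t _) (eq₀₁ b)))
        C-lt {suc a} {suc b} lt N≤ = ≋-trans (C-coeff _ _) (≋-trans (⊖-cong (⊗-congˡ (≋-trans (cl-x-suc A _ lt₀) D0)) (y-coeff _))
          (≋-trans (solve 2 (λ t d → t :* :0 :- d := :0 :- d) ≋-refl t _) (≋-trans (⊖-cong (≋-sym D0) ≋-refl) (eq₁₁ a b))))
          where
          D0 : D a (suc b) ≋ 0p
          D0 = D-low a (suc b) (λ k' l' e le → outer′ {suc a} {suc b} N≤ e (s≤s le) (ℕₚ.<⇒≤ lt))

        C-eq : ∀ {a} → N ≤ sq (A ++ a ∷ a ∷ B) → C a a ≋ 0p
        C-eq {zero} N≤ = ≋-trans (C-coeff _ _) (≋-trans (⊖-cong (⊗-congˡ (cl-x-zero A _ lt₀)) (y-zero _)) (solve 1 (λ t → t :* :0 :- :0 := :0) ≋-refl t))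
        C-eq {suc a} N≤ = ≋-trans (C-coeff _ _) (≋-trans (⊖-cong (⊗-congˡ (≋-trans (cl-x-suc A _ lt₀) D0)) (≋-trans (y-coeff _) D1)) (solve 1 (λ t → t :* :0 :- :0 := :0) ≋-refl t))
          where
          D0 : D a (suc a) ≋ 0p
          D0 = D-low a (suc a) (λ k' l' e le → outer′ {suc a} {suc a} N≤ e (s≤s le) ℕₚ.≤-refl)
          D1 : D (suc a) a ≋ 0p
          D1 = D-high a (suc a) (λ k' l' e lt' → outer {suc a} {suc a} N≤ (trans e (cong suc (sym (ℕₚ.+-suc a a)))) lt' ℕₚ.≤-refl)

      T-split : ∀ u → cl u (T′ j f) ≋ t ⊗ cl u f ⊖′ cl u (c j ⊗ ∂ j f)
      T-split u = ≋-trans (cl-⊖ u _ _) (⊖-cong (cl-sc u 0 1 f) ≋-refl)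
      τ-split : ∀ u → cl u (τ j f) ≋ cl u f ⊖′ cl u (c j ⊗ ∂ j f)
      τ-split u = cl-⊖ u _ _

    module _ {N : ℕ} (top : Top N f) {a b : ℕ} (N≤ : N ≤ sq (A ++ a ∷ b ∷ B)) where
      -- At words of norm at least N the interior monomials are out of sight, and T_j and τ_j act on
      -- words as in the permutation module of the Hecke algebra.
      T-gt : b < a → cl (A ++ a ∷ b ∷ B) (T′ j f) ≋ t ⊗ cl (A ++ b ∷ a ∷ B) f
      T-gt lt = ≋-trans (T-split _) (≋-trans (⊖-cong ≋-refl (C-gt top lt N≤)) (solve 3 (λ t p q → t :* p :- t :* (p :- q) := t :* q) ≋-refl t _ _))
      T-lt : a < b → cl (A ++ a ∷ b ∷ B) (T′ j f) ≋ cl (A ++ b ∷ a ∷ B) f ⊕ (t ⊖′ 1p) ⊗ cl (A ++ a ∷ b ∷ B) f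
      T-lt lt = ≋-trans (T-split _) (≋-trans (⊖-cong ≋-refl (C-lt top lt N≤)) (solve 3 (λ t p q → t :* p :- (p :- q) := q :+ (t :- :1) :* p) ≋-refl t _ _))
      τ-gt : b < a → cl (A ++ a ∷ b ∷ B) (τ j f) ≋ t ⊗ cl (A ++ b ∷ a ∷ B) f ⊕ (1p ⊖′ t) ⊗ cl (A ++ a ∷ b ∷ B) f
      τ-gt lt = ≋-trans (τ-split _) (≋-trans (⊖-cong ≋-refl (C-gt top lt N≤)) (solve 3 (λ t p q → p :- t :* (p :- q) := t :* q :+ (:1 :- t) :* p) ≋-refl t _ _))
      τ-lt : a < b → cl (A ++ a ∷ b ∷ B) (τ j f) ≋ cl (A ++ b ∷ a ∷ B) f
      τ-lt lt = ≋-trans (τ-split _) (≋-trans (⊖-cong ≋-refl (C-lt top lt N≤)) (solve 2 (λ p q → p :- (p :- q) := q) ≋-refl _ _))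

    module _ {N : ℕ} (top : Top N f) {a : ℕ} (N≤ : N ≤ sq (A ++ a ∷ a ∷ B)) where
      T-same : cl (A ++ a ∷ a ∷ B) (T′ j f) ≋ t ⊗ cl (A ++ a ∷ a ∷ B) f
      T-same = ≋-trans (T-split _) (≋-trans (⊖-cong ≋-refl (C-eq top N≤)) (solve 1 (λ p → p :- :0 := p) ≋-refl _))
      τ-same : cl (A ++ a ∷ a ∷ B) (τ j f) ≋ cl (A ++ a ∷ a ∷ B) f
      τ-same = ≋-trans (τ-split _) (≋-trans (⊖-cong ≋-refl (C-eq top N≤)) (solve 1 (λ p → p :- :0 := p) ≋-refl _))

    module _ {N : ℕ} (top : Top N f) (a b : ℕ) (N≤ : N ≤ sq (A ++ a ∷ b ∷ B))
             (p : cl (A ++ a ∷ b ∷ B) f ≋ 0p) (q : cl (A ++ b ∷ a ∷ B) f ≋ 0p) where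
      T-zero : cl (A ++ a ∷ b ∷ B) (T′ j f) ≋ 0p
      T-zero with ℕₚ.<-cmp a b
      ... | tri< lt _ _ = ≋-trans (T-lt top N≤ lt) (≋-trans (⊕-cong q (⊗-congˡ p)) (solve 1 (λ t → :0 :+ (t :- :1) :* :0 := :0) ≋-refl t))
      ... | tri≈ _ refl _ = ≋-trans (T-same top N≤) (≋-trans (⊗-congˡ p) (⊗-zeroʳ t))
      ... | tri> _ _ gt = ≋-trans (T-gt top N≤ gt) (≋-trans (⊗-congˡ q) (⊗-zeroʳ t))

      τ-zero : cl (A ++ a ∷ b ∷ B) (τ j f) ≋ 0p
      τ-zero with ℕₚ.<-cmp a b
      ... | tri< lt _ _ = ≋-trans (τ-lt top N≤ lt) q
      ... | tri≈ _ refl _ = ≋-trans (τ-same top N≤) p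
      ... | tri> _ _ gt = ≋-trans (τ-gt top N≤ gt) (≋-trans (⊕-cong (⊗-congˡ q) (⊗-congˡ p)) (solve 1 (λ t → t :* :0 :+ (:1 :- t) :* :0 := :0) ≋-refl t))

    module _ {N : ℕ} (top : Top N f) {a b : ℕ} (N≤ : N ≤ sq (A ++ a ∷ b ∷ B)) where
      T-ge : b ≤ a → cl (A ++ a ∷ b ∷ B) (T′ j f) ≋ t ⊗ cl (A ++ b ∷ a ∷ B) f
      T-ge b≤a with ℕₚ.m≤n⇒m<n∨m≡n b≤a
      ... | inj₁ b<a  = T-gt top N≤ b<a
      ... | inj₂ refl = T-same top N≤

      τ-le : a ≤ b → cl (A ++ a ∷ b ∷ B) (τ j f) ≋ cl (A ++ b ∷ a ∷ B) f
      τ-le a≤b with ℕₚ.m≤n⇒m<n∨m≡n a≤b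
      ... | inj₁ a<b  = τ-lt top N≤ a<b
      ... | inj₂ refl = τ-same top N≤

sc-00 : ∀ {n} (f : Poly n) → sc 0 0 ⊗ f ≋ f
sc-00 f = ≋-trans (⊗-congʳ mono-1) (⊗-identityˡ f)

module _ {n : ℕ} where
  Top-T : ∀ {N} j {f : Poly n} → suc j < n → Top N f → Top N (T′ j f)
  Top-T {N} j {f} lt top u N< with length u ℕ.≟ n
  ... | no ne = cl-length u _ ne
  ... | yes len with split₂ j u (subst (suc j <_) (sym len) lt)
  ...   | A , a , b , B , refl , refl = T-zero A B lt f top a b (ℕₚ.<⇒≤ N<) (top _ N<) (top _ (subst (N <_) (sym (sq-swap A a b B)) N<))

  Top-τ : ∀ {N} j {f : Poly n} → suc j < n → Top N f → Top N (τ j f)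
  Top-τ {N} j {f} lt top u N< with length u ℕ.≟ n
  ... | no ne = cl-length u _ ne
  ... | yes len with split₂ j u (subst (suc j <_) (sym len) lt)
  ...   | A , a , b , B , refl , refl = τ-zero A B lt f top a b (ℕₚ.<⇒≤ N<) (top _ N<) (top _ (subst (N <_) (sym (sq-swap A a b B)) N<))

  -- These words depart downwards, after the prefix P, from a word that continues with z. Within one
  -- norm they are among the words above it in the triangularity order.
  Small : ℕ → List ℕ → ℕ → Poly n → Set
  Small N P z f = ∀ y R → y < z → N ≤ sq (P ++ y ∷ R) → cl (P ++ y ∷ R) f ≋ 0p

  -- As j lies beyond the prefix, T_j rearranges only letters behind the letter y of departure.
  Small-T : ∀ {N P z} j {f : Poly n} → suc j < n → length P < j → Top N f → Small N P z f → Small N P z (T′ j f)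
  Small-T {N} {P} j {f} lt P<j top small y R y<z N≤ with length (P ++ y ∷ R) ℕ.≟ n
  ... | no ne = cl-length _ _ ne
  ... | yes len with ℕₚ.m≤n⇒∃[o]m+o≡n P<j
  ...   | i , refl with split₂ i R (ℕₚ.+-cancelˡ-< (suc (length P)) _ _
            (subst₂ _<_ (sym (ℕₚ.+-suc (suc (length P)) i)) (trans (sym len) (trans (Lₚ.length-++ P) (ℕₚ.+-suc (length P) (length R)))) lt))
  ...     | A , a , b , B , refl , refl = ≋-trans (cl-≡ _ (sym (assoc a b))) (≋-trans (cl-cong _ (≋-reflexive (cong (λ k → T′ k f) (sym len′))))
            (T-zero (P ++ y ∷ A) B (subst (λ k → suc k < n) (sym len′) lt) f top a b (subst (λ w → N ≤ sq w) (sym (assoc a b)) N≤)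
              (≋-trans (cl-≡ f (assoc a b)) (small y _ y<z N≤))
              (≋-trans (cl-≡ f (assoc b a)) (small y _ y<z (subst (N ≤_) (trans (cong sq (sym (assoc a b))) (trans (sym (sq-swap (P ++ y ∷ A) a b B)) (cong sq (assoc b a)))) N≤)))))
    where
    assoc : ∀ a b → (P ++ y ∷ A) ++ a ∷ b ∷ B ≡ P ++ y ∷ A ++ a ∷ b ∷ B
    assoc a b = Lₚ.++-assoc P (y ∷ A) (a ∷ b ∷ B)
    len′ : length (P ++ y ∷ A) ≡ suc (length P ℕ.+ length A)
    len′ = trans (Lₚ.length-++ P) (ℕₚ.+-suc (length P) (length A))

  Top-chain : ∀ {N} a m {f : Poly n} → a ℕ.+ m < n → Top N f → Top N (chain a m f)
  Top-chain a zero    lt top = top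
  Top-chain a (suc m) lt top = Top-T a (ℕₚ.≤-<-trans (s≤s (ℕₚ.m≤m+n a m)) (tail-< a lt)) (Top-chain (suc a) m (tail-< a lt) top)

  Top-down : ∀ {N} a m {f : Poly n} → a ℕ.+ m < n → Top N f → Top N (down a m f)
  Top-down a zero    lt top = top
  Top-down a (suc m) lt top = Top-τ a (ℕₚ.≤-<-trans (s≤s (ℕₚ.m≤m+n a m)) (tail-< a lt)) (Top-down (suc a) m (tail-< a lt) top)

  Small-chain : ∀ {N P z} a m {f : Poly n} → a ℕ.+ m < n → length P < a → Top N f → Small N P z f → Small N P z (chain a m f)
  Small-chain a zero    lt P<a top small = small
  Small-chain a (suc m) lt P<a top small = Small-T a (ℕₚ.≤-<-trans (s≤s (ℕₚ.m≤m+n a m)) (tail-< a lt)) P<a (Top-chain (suc a) m (tail-< a lt) top)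
      (Small-chain (suc a) m (tail-< a lt) (ℕₚ.m≤n⇒m≤1+n P<a) top small)

  Top-ω : ∀ {N} ε {f : Poly n} → 0 < n → Top N f → Top N (ω ε f)
  Top-ω {N} ε {f} 0<n top u N< with L.initLast u
  ... | [] = cl-length [] _ (λ e → ℕₚ.<-irrefl e 0<n)
  ... | B L.∷ʳ′ m = ≋-trans (cl-ω ε B m f) (≋-trans (⊗-congˡ (top (m ∷ B) (subst (N <_) (sq-rot B m) N<))) (⊗-zeroʳ _))
    where
    sq-rot : ∀ B m → sq (B ∷ʳ m) ≡ sq (m ∷ B)
    sq-rot B m = trans (sq-++ B (m ∷ [])) (trans (ℕₚ.+-comm (sq B) _) (cong (ℕ._+ sq B) (ℕₚ.+-identityʳ (m ℕ.* m))))

  -- The letter m travels across B and gains t at each b ≤ m. At m < b `T-lt` adds a term at the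
  -- word where m has not moved; that word departs downwards at b, so `Small` kills it.
  move-right : ∀ {N} (f : Poly n) → Top N f → ∀ A B C m k → length A ≡ k → length (A ++ m ∷ B ++ C) ≡ n →
               (∀ B₁ b B₂ → B ≡ B₁ ++ b ∷ B₂ → Small N (A ++ B₁) b f) → N ≤ sq (A ++ m ∷ B ++ C) →
               cl (A ++ m ∷ B ++ C) (chain k (length B) f) ≋ sc 0 (count≤ m B) ⊗ cl (A ++ B ++ m ∷ C) f
  move-right f top A [] C m k lenA len small N≤ = ≋-sym (sc-00 _)
  move-right {N} f top A (b ∷ B) C m k refl len small N≤ = go (m ℕ.<? b)
    where
    open ≋-Reasoning {0}
    g : Poly n
    g = chain (suc k) (length B) f
    range : suc k ℕ.+ length B < n
    range = subst (suc (suc k ℕ.+ length B) ≤_) len (ℕₚ.≤-trans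
      (ℕₚ.≤-reflexive (sym (trans (ℕₚ.+-suc (length A) _) (cong suc (ℕₚ.+-suc (length A) _)))))
      (ℕₚ.≤-trans (ℕₚ.+-monoʳ-≤ (length A) (s≤s (s≤s (ℕₚ.≤-trans (ℕₚ.m≤m+n (length B) (length C)) (ℕₚ.≤-reflexive (sym (Lₚ.length-++ B)))))))
                  (ℕₚ.≤-reflexive (sym (Lₚ.length-++ A)))))
    ltk : suc k < n
    ltk = ℕₚ.≤-<-trans (ℕₚ.m≤m+n (suc k) (length B)) range
    topg : Top N g
    topg = Top-chain (suc k) (length B) range top
    smallg : Small N A b g
    smallg = Small-chain {P = A} (suc k) (length B) range ℕₚ.≤-refl top
      (subst (λ P → Small N P b f) (Lₚ.++-identityʳ A) (small [] b B refl))
    N≤′ : N ≤ sq (A ++ b ∷ m ∷ B ++ C)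
    N≤′ = subst (N ≤_) (sym (sq-swap A m b (B ++ C))) N≤
    IH : cl (A ++ b ∷ m ∷ B ++ C) g ≋ sc 0 (count≤ m B) ⊗ cl (A ++ b ∷ B ++ m ∷ C) f
    IH = ≋-trans (cl-≡ g (sym (snoc-++ A b (m ∷ B ++ C))))
      (≋-trans (move-right f top (A ++ b ∷ []) B C m (suc k) (length-snoc A b)
                 (trans (cong length (snoc-++ A b (m ∷ B ++ C))) (trans (sym (length-swap A)) len))
                 (λ { B₁ b' B₂ refl → subst (λ P → Small N P b' f) (sym (snoc-++ A b B₁)) (small (b ∷ B₁) b' B₂ refl) })
                 (subst (λ u → N ≤ sq u) (sym (snoc-++ A b (m ∷ B ++ C))) N≤′))
        (⊗-congˡ (cl-≡ f (snoc-++ A b (B ++ m ∷ C)))))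
    go : Dec (m < b) → cl (A ++ m ∷ b ∷ B ++ C) (T′ k g) ≋ sc 0 (count≤ m (b ∷ B)) ⊗ cl (A ++ b ∷ B ++ m ∷ C) f
    go (yes m<b) rewrite ≤ᵇ-false m<b = begin
      cl (A ++ m ∷ b ∷ B ++ C) (T′ k g) ≈⟨ T-lt A (B ++ C) ltk g topg N≤ m<b ⟩
      cl (A ++ b ∷ m ∷ B ++ C) g ⊕ (t ⊖′ 1p) ⊗ cl (A ++ m ∷ b ∷ B ++ C) g ≈⟨ ⊕-cong IH (≋-trans (⊗-congˡ (smallg m (b ∷ B ++ C) m<b N≤)) (⊗-zeroʳ _)) ⟩
      sc 0 (count≤ m B) ⊗ cl (A ++ b ∷ B ++ m ∷ C) f ⊕ 0p ≈⟨ ⊕-identityʳ _ ⟩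
      sc 0 (count≤ m B) ⊗ cl (A ++ b ∷ B ++ m ∷ C) f ∎
    go (no m≮b) rewrite ≤ᵇ-true (ℕₚ.≮⇒≥ m≮b) = begin
      cl (A ++ m ∷ b ∷ B ++ C) (T′ k g) ≈⟨ T-ge A (B ++ C) ltk g topg N≤ (ℕₚ.≮⇒≥ m≮b) ⟩
      t ⊗ cl (A ++ b ∷ m ∷ B ++ C) g ≈⟨ ⊗-congˡ IH ⟩
      t ⊗ (sc 0 (count≤ m B) ⊗ cl (A ++ b ∷ B ++ m ∷ C) f) ≈⟨ ⊗-assoc _ _ _ ⟨
      (t ⊗ sc 0 (count≤ m B)) ⊗ cl (A ++ b ∷ B ++ m ∷ C) f ≈⟨ ⊗-congʳ (sc-⊗ 0 1 0 (count≤ m B)) ⟩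
      sc 0 (suc (count≤ m B)) ⊗ cl (A ++ b ∷ B ++ m ∷ C) f ∎

  module _ {N : ℕ} (ε : ℕ) (f : Poly n) (top : Top N f) (A : List ℕ) (z : ℕ)
           (small : ∀ B₁ b B₂ → A ≡ B₁ ++ b ∷ B₂ → Small N B₁ b f) (smallA : Small N A z f) (A<n : length A < n) where
    private
      open ≋-Reasoning {0}
      g₀ h : Poly n
      g₀ = chain 0 (length A) f
      h = ω ε g₀

      0<n : 0 < n
      0<n = ℕₚ.≤-<-trans z≤n A<n

      topG : ∀ k m → k ℕ.+ m < n → Top N (down k m h)
      topG k m lt = Top-down k m lt (Top-ω ε 0<n (Top-chain 0 (length A) A<n top))

      sq-rot : ∀ E y → sq ((A ++ E) ++ y ∷ []) ≡ sq (A ++ y ∷ E)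
      sq-rot E y = trans (cong sq (Lₚ.++-assoc A E (y ∷ []))) (trans (sq-++ A (E ++ y ∷ []))
        (trans (cong (sq A ℕ.+_) (trans (sq-++ E (y ∷ [])) (trans (ℕₚ.+-comm (sq E) _) (cong (ℕ._+ sq E) (ℕₚ.+-identityʳ (y ℕ.* y))))))
               (sym (sq-++ A (y ∷ E)))))

      sq-front : ∀ E y → sq (y ∷ A ++ E) ≡ sq (A ++ y ∷ E)
      sq-front E y = trans (cong (y ℕ.* y ℕ.+_) (sq-++ A E)) (trans (sym (ℕₚ.+-assoc (y ℕ.* y) (sq A) (sq E)))
        (trans (cong (ℕ._+ sq E) (ℕₚ.+-comm (y ℕ.* y) (sq A))) (trans (ℕₚ.+-assoc (sq A) (y ℕ.* y) (sq E)) (sym (sq-++ A (y ∷ E))))))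

      length-rot : ∀ E (y : ℕ) → length ((A ++ E) ++ y ∷ []) ≡ length (y ∷ A ++ E)
      length-rot E y = length-snoc (A ++ E) y

      wrap : ∀ E y → length ((A ++ E) ++ y ∷ []) ≡ n → N ≤ sq ((A ++ E) ++ y ∷ []) →
             cl ((A ++ E) ++ y ∷ []) h ≋ sc (ε ℕ.* y) (count≤ y A) ⊗ cl (A ++ y ∷ E) f
      wrap E y len N≤ = begin
        cl ((A ++ E) ++ y ∷ []) h ≈⟨ cl-ω ε (A ++ E) y g₀ ⟩
        sc (ε ℕ.* y) 0 ⊗ cl (y ∷ A ++ E) g₀ ≈⟨ ⊗-congˡ (move-right f top [] A E y 0 refl (trans (sym (length-rot E y)) len) small
                                                                                (subst (N ≤_) (trans (sq-rot E y) (sym (sq-front E y))) N≤)) ⟩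
        sc (ε ℕ.* y) 0 ⊗ (sc 0 (count≤ y A) ⊗ cl (A ++ y ∷ E) f) ≈⟨ ⊗-assoc _ _ _ ⟨
        (sc (ε ℕ.* y) 0 ⊗ sc 0 (count≤ y A)) ⊗ cl (A ++ y ∷ E) f ≈⟨ ⊗-congʳ (sc-⊗ (ε ℕ.* y) 0 0 (count≤ y A)) ⟩
        sc (ε ℕ.* y ℕ.+ 0) (count≤ y A) ⊗ cl (A ++ y ∷ E) f ≡⟨ cong (λ a → sc a (count≤ y A) ⊗ cl (A ++ y ∷ E) f) (ℕₚ.+-identityʳ _) ⟩
        sc (ε ℕ.* y) (count≤ y A) ⊗ cl (A ++ y ∷ E) f ∎

      module Step (X : List ℕ) (y b : ℕ) (R : List ℕ) (len : length (X ++ y ∷ b ∷ R) ≡ n) where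
        range : suc (length X) ℕ.+ length R < n
        range = ℕₚ.≤-reflexive (trans (sym (trans (Lₚ.length-++ X) (trans (ℕₚ.+-suc (length X) _) (cong suc (ℕₚ.+-suc (length X) _))))) len)
        ltk : suc (length X) < n
        ltk = ℕₚ.≤-<-trans (ℕₚ.m≤m+n _ (length R)) range
        G : Poly n
        G = down (suc (length X)) (length R) h
        topg : Top N G
        topg = topG (suc (length X)) (length R) range
        reshape : ∀ E b → X ≡ A ++ E → ∀ r → X ++ b ∷ r ≡ (A ++ E ++ b ∷ []) ++ r
        reshape E b refl r = trans (sym (snoc-++ (A ++ E) b r)) (cong (_++ r) (Lₚ.++-assoc A E (b ∷ [])))

      -- A letter y < z that travels in place of z would return right behind A, where `smallA`
      -- excludes it. If it meets a smaller b, the traveller may become b, but b < z as well.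
      down-small : ∀ R E y k → length (A ++ E) ≡ k → length ((A ++ E) ++ y ∷ R) ≡ n → y < z → N ≤ sq ((A ++ E) ++ y ∷ R) →
                   cl ((A ++ E) ++ y ∷ R) (down k (length R) h) ≋ 0p
      down-small [] E y k lenk len y<z N≤ = ≋-trans (wrap E y len N≤)
        (≋-trans (⊗-congˡ (smallA y E y<z (subst (N ≤_) (sq-rot E y) N≤))) (⊗-zeroʳ _))
      down-small (b ∷ R) E y k refl len y<z N≤ = go (b ℕ.<? y)
        where
        open Step (A ++ E) y b R len
        IH : ∀ b c → N ≤ sq ((A ++ E) ++ b ∷ c ∷ R) → length ((A ++ E) ++ b ∷ c ∷ R) ≡ n → c < z → cl ((A ++ E) ++ b ∷ c ∷ R) G ≋ 0p
        IH b c N≤ len c<z = ≋-trans (cl-≡ G (reshape E b refl (c ∷ R)))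
          (down-small R (E ++ b ∷ []) c (suc k) (trans (cong length (sym (Lₚ.++-assoc A E (b ∷ [])))) (length-snoc (A ++ E) b))
            (trans (cong length (sym (reshape E b refl (c ∷ R)))) len) c<z (subst (λ u → N ≤ sq u) (reshape E b refl (c ∷ R)) N≤))
        N≤′ = subst (N ≤_) (sym (sq-swap (A ++ E) y b R)) N≤
        len′ = trans (length-swap (A ++ E)) len
        go : Dec (b < y) → cl ((A ++ E) ++ y ∷ b ∷ R) (τ k G) ≋ 0p
        go (yes b<y) = τ-zero (A ++ E) R ltk G topg y b N≤ (IH y b N≤ len (ℕₚ.<-trans b<y y<z)) (IH b y N≤′ len′ y<z)
        go (no b≮y)  = ≋-trans (τ-le (A ++ E) R ltk G topg N≤ (ℕₚ.≮⇒≥ b≮y)) (IH b y N≤′ len′ y<z)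

      -- The travel of z under the τ's gains t at each b < z. The second term of `τ-gt` would send b
      -- on the journey in place of z, which `down-small` excludes.
      down-main : ∀ R E k → length (A ++ E) ≡ k → length ((A ++ E) ++ z ∷ R) ≡ n → N ≤ sq ((A ++ E) ++ z ∷ R) →
                  cl ((A ++ E) ++ z ∷ R) (down k (length R) h) ≋ sc 0 (count< z R) ⊗ cl ((A ++ E ++ R) ++ z ∷ []) h
      down-main [] E k lenk len N≤ = ≋-trans (cl-≡ h (cong (λ e → (A ++ e) ++ z ∷ []) (sym (Lₚ.++-identityʳ E)))) (≋-sym (sc-00 _))
      down-main (b ∷ R) E k refl len N≤ = go (b ℕ.<? z)
        where
        open Step (A ++ E) z b R len
        N≤′ = subst (N ≤_) (sym (sq-swap (A ++ E) z b R)) N≤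
        len-E : ∀ b → length (A ++ E ++ b ∷ []) ≡ suc (length (A ++ E))
        len-E b = trans (cong length (sym (Lₚ.++-assoc A E (b ∷ [])))) (length-snoc (A ++ E) b)
        IH : cl ((A ++ E) ++ b ∷ z ∷ R) G ≋ sc 0 (count< z R) ⊗ cl ((A ++ E ++ b ∷ R) ++ z ∷ []) h
        IH = ≋-trans (cl-≡ G (reshape E b refl (z ∷ R)))
          (≋-trans (down-main R (E ++ b ∷ []) (suc k) (len-E b)
             (trans (cong length (sym (reshape E b refl (z ∷ R)))) (trans (length-swap (A ++ E)) len))
             (subst (λ u → N ≤ sq u) (reshape E b refl (z ∷ R)) N≤′))
           (⊗-congˡ (cl-≡ h (cong (λ e → (A ++ e) ++ z ∷ []) (Lₚ.++-assoc E (b ∷ []) R)))))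
        go : Dec (b < z) → cl ((A ++ E) ++ z ∷ b ∷ R) (τ k G) ≋ sc 0 (count< z (b ∷ R)) ⊗ cl ((A ++ E ++ b ∷ R) ++ z ∷ []) h
        go (yes b<z) rewrite <ᵇ-true b<z = begin
          cl ((A ++ E) ++ z ∷ b ∷ R) (τ k G) ≈⟨ τ-gt (A ++ E) R ltk G topg N≤ b<z ⟩
          t ⊗ cl ((A ++ E) ++ b ∷ z ∷ R) G ⊕ (1p ⊖′ t) ⊗ cl ((A ++ E) ++ z ∷ b ∷ R) G
            ≈⟨ ⊕-cong (⊗-congˡ IH) (≋-trans (⊗-congˡ (≋-trans (cl-≡ G (reshape E z refl (b ∷ R)))
                 (down-small R (E ++ z ∷ []) b (suc k) (len-E z) (trans (cong length (sym (reshape E z refl (b ∷ R)))) len) b<z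
                   (subst (λ u → N ≤ sq u) (reshape E z refl (b ∷ R)) N≤)))) (⊗-zeroʳ _)) ⟩
          t ⊗ (sc 0 (count< z R) ⊗ cl ((A ++ E ++ b ∷ R) ++ z ∷ []) h) ⊕ 0p ≈⟨ ≋-trans (⊕-identityʳ _) (≋-sym (⊗-assoc _ _ _)) ⟩
          (t ⊗ sc 0 (count< z R)) ⊗ cl ((A ++ E ++ b ∷ R) ++ z ∷ []) h ≈⟨ ⊗-congʳ (sc-⊗ 0 1 0 (count< z R)) ⟩
          sc 0 (suc (count< z R)) ⊗ cl ((A ++ E ++ b ∷ R) ++ z ∷ []) h ∎
        go (no b≮z) rewrite <ᵇ-false (ℕₚ.≮⇒≥ b≮z) = ≋-trans (τ-le (A ++ E) R ltk G topg N≤ (ℕₚ.≮⇒≥ b≮z)) IH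

    -- Read from the outside in, z goes right across R under the τ's, is brought from the end to the
    -- front by ω at the price q^(εz), and returns across A under the T's. The powers of t collected
    -- on the way form the diagonal entry.
    Z-coeff : ∀ R → length (A ++ z ∷ R) ≡ n → N ≤ sq (A ++ z ∷ R) →
              cl (A ++ z ∷ R) (Z ε (length A) f) ≋ sc (ε ℕ.* z) (count≤ z A ℕ.+ count< z R) ⊗ cl (A ++ z ∷ R) f
    Z-coeff R len N≤ = begin
      cl (A ++ z ∷ R) (down (length A) (n ∸ suc (length A)) (ω ε (up (length A) f)))
        ≡⟨ cong₂ (λ m p → cl (A ++ z ∷ R) (down (length A) m (ω ε p))) n∸ (up-chain (length A) f) ⟩
      cl (A ++ z ∷ R) (down (length A) (length R) h)
        ≈⟨ cl-≡ _ (cong (_++ z ∷ R) (sym (Lₚ.++-identityʳ A))) ⟩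
      cl ((A ++ []) ++ z ∷ R) (down (length A) (length R) h)
        ≈⟨ down-main R [] (length A) (cong length (Lₚ.++-identityʳ A)) (trans (cong (λ a → length (a ++ z ∷ R)) (Lₚ.++-identityʳ A)) len)
             (subst (λ a → N ≤ sq (a ++ z ∷ R)) (sym (Lₚ.++-identityʳ A)) N≤) ⟩
      sc 0 (count< z R) ⊗ cl ((A ++ R) ++ z ∷ []) h
        ≈⟨ ⊗-congˡ (wrap R z (trans (length-snoc (A ++ R) z) (trans (cong suc (Lₚ.length-++ A)) (trans (sym (trans (Lₚ.length-++ A) (ℕₚ.+-suc (length A) _))) len)))
             (subst (N ≤_) (sym (sq-rot R z)) N≤)) ⟩
      sc 0 (count< z R) ⊗ (sc (ε ℕ.* z) (count≤ z A) ⊗ cl (A ++ z ∷ R) f)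
        ≈⟨ ≋-trans (≋-sym (⊗-assoc _ _ _)) (⊗-congʳ (≋-trans (sc-⊗ 0 (count< z R) (ε ℕ.* z) (count≤ z A)) (≋-reflexive (cong (sc (ε ℕ.* z)) (ℕₚ.+-comm (count< z R) _))))) ⟩
      sc (ε ℕ.* z) (count≤ z A ℕ.+ count< z R) ⊗ cl (A ++ z ∷ R) f ∎
      where
      n∸ : n ∸ suc (length A) ≡ length R
      n∸ = trans (cong (_∸ suc (length A)) (trans (sym len) (trans (Lₚ.length-++ A) (ℕₚ.+-suc (length A) (length R))))) (ℕₚ.m+n∸m≡n (suc (length A)) (length R))

-- Ranks, the monomial order and uniqueness

infixl 9 _!_
_!_ : List ℕ → ℕ → ℕ
[]      ! _     = 0
(x ∷ u) ! zero  = x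
(x ∷ u) ! suc k = u ! k

-- κ u k = n - 1 - (the exponent of t⁻¹ in y_{k+1}(u))
κ : List ℕ → ℕ → ℕ
κ []      _       = 0
κ (x ∷ u) zero    = count< x u
κ (x ∷ u) (suc k) = κ u k ℕ.+ bit (x ≤ᵇ u ! k)

wt : ℕ → List ℕ → ℕ → ℕ × ℕ
wt ε u k = ε ℕ.* (u ! k) , κ u k

!-++ : ∀ A {z R} → (A ++ z ∷ R) ! length A ≡ z
!-++ []      = refl
!-++ (x ∷ A) = !-++ A

κ-++ : ∀ A {z R} → κ (A ++ z ∷ R) (length A) ≡ count≤ z A ℕ.+ count< z R
κ-++ [] = refl
κ-++ (x ∷ A) {z} {R} = begin
  κ (A ++ z ∷ R) (length A) ℕ.+ bit (x ≤ᵇ (A ++ z ∷ R) ! length A) ≡⟨ cong₂ (λ p q → p ℕ.+ bit (x ≤ᵇ q)) (κ-++ A) (!-++ A) ⟩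
  (count≤ z A ℕ.+ count< z R) ℕ.+ bit (x ≤ᵇ z) ≡⟨ ℕₚ.+-comm _ (bit (x ≤ᵇ z)) ⟩
  bit (x ≤ᵇ z) ℕ.+ (count≤ z A ℕ.+ count< z R) ≡⟨ ℕₚ.+-assoc (bit (x ≤ᵇ z)) _ _ ⟨
  count≤ z (x ∷ A) ℕ.+ count< z R ∎
  where open ≡-Reasoning

count≤-++ : ∀ m u v → count≤ m (u ++ v) ≡ count≤ m u ℕ.+ count≤ m v
count≤-++ m [] v = refl
count≤-++ m (y ∷ u) v = trans (cong (bit (y ≤ᵇ m) ℕ.+_) (count≤-++ m u v)) (sym (ℕₚ.+-assoc (bit (y ≤ᵇ m)) _ _))

count<-++ : ∀ m u v → count< m (u ++ v) ≡ count< m u ℕ.+ count< m v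
count<-++ m [] v = refl
count<-++ m (y ∷ u) v = trans (cong (bit (y <ᵇ m) ℕ.+_) (count<-++ m u v)) (sym (ℕₚ.+-assoc (bit (y <ᵇ m)) _ _))

κ-first : ∀ A {a b B} → κ (A ++ a ∷ b ∷ B) (length A) ≡ count≤ a A ℕ.+ (bit (b <ᵇ a) ℕ.+ count< a B)
κ-first A = κ-++ A

!-second : ∀ A {a b B} → (A ++ a ∷ b ∷ B) ! suc (length A) ≡ b
!-second []      = refl
!-second (x ∷ A) = !-second A

κ-second : ∀ A {a b B} → κ (A ++ a ∷ b ∷ B) (suc (length A)) ≡ count≤ b A ℕ.+ (bit (a ≤ᵇ b) ℕ.+ count< b B)
κ-second A {a} {b} {B} = begin
  κ (A ++ a ∷ b ∷ B) (suc (length A)) ≡⟨ cong₂ κ (sym (snoc-++ A a (b ∷ B))) (sym (length-snoc A a)) ⟩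
  κ ((A ++ a ∷ []) ++ b ∷ B) (length (A ++ a ∷ [])) ≡⟨ κ-++ (A ++ a ∷ []) ⟩
  count≤ b (A ++ a ∷ []) ℕ.+ count< b B ≡⟨ cong (ℕ._+ count< b B) (trans (count≤-++ b A (a ∷ [])) (cong (count≤ b A ℕ.+_) (ℕₚ.+-identityʳ _))) ⟩
  count≤ b A ℕ.+ bit (a ≤ᵇ b) ℕ.+ count< b B ≡⟨ ℕₚ.+-assoc (count≤ b A) _ _ ⟩
  count≤ b A ℕ.+ (bit (a ≤ᵇ b) ℕ.+ count< b B) ∎
  where open ≡-Reasoning

bit-≤-mono : ∀ y {a b} → a ≤ b → bit (y ≤ᵇ a) ≤ bit (y ≤ᵇ b)
bit-≤-mono y {a} {b} le with y ℕ.≤? a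
... | yes y≤a rewrite ≤ᵇ-true y≤a | ≤ᵇ-true (ℕₚ.≤-trans y≤a le) = ℕₚ.≤-refl
... | no y≰a rewrite ≤ᵇ-false (ℕₚ.≰⇒> y≰a) = z≤n

bit-<-mono : ∀ y {a b} → a ≤ b → bit (y <ᵇ a) ≤ bit (y <ᵇ b)
bit-<-mono y {a} {b} le with y ℕ.<? a
... | yes y<a rewrite <ᵇ-true y<a | <ᵇ-true (ℕₚ.<-≤-trans y<a le) = ℕₚ.≤-refl
... | no y≮a rewrite <ᵇ-false (ℕₚ.≮⇒≥ y≮a) = z≤n

count≤-mono : ∀ u {a b} → a ≤ b → count≤ a u ≤ count≤ b u
count≤-mono [] le = z≤n
count≤-mono (y ∷ u) le = ℕₚ.+-mono-≤ (bit-≤-mono y le) (count≤-mono u le)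

count<-mono : ∀ u {a b} → a ≤ b → count< a u ≤ count< b u
count<-mono [] le = z≤n
count<-mono (y ∷ u) le = ℕₚ.+-mono-≤ (bit-<-mono y le) (count<-mono u le)

-- κ is the standardisation of the word: it ranks the positions by their letters, from left to right
-- among equal ones.
κ-ascent : ∀ A {a b B} → a ≤ b → κ (A ++ a ∷ b ∷ B) (length A) < κ (A ++ a ∷ b ∷ B) (suc (length A))
κ-ascent A {a} {b} {B} le rewrite κ-first A {a} {b} {B} | κ-second A {a} {b} {B} | <ᵇ-false le | ≤ᵇ-true le =
  ℕₚ.≤-trans (ℕₚ.≤-reflexive (sym (ℕₚ.+-suc (count≤ a A) (count< a B)))) (ℕₚ.+-mono-≤ (count≤-mono A le) (s≤s (count<-mono B le)))

κ-descent : ∀ A {a b B} → b < a → κ (A ++ a ∷ b ∷ B) (suc (length A)) < κ (A ++ a ∷ b ∷ B) (length A)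
κ-descent A {a} {b} {B} lt rewrite κ-first A {a} {b} {B} | κ-second A {a} {b} {B} | <ᵇ-true lt | ≤ᵇ-false lt =
  ℕₚ.≤-trans (ℕₚ.≤-reflexive (sym (ℕₚ.+-suc (count≤ b A) (count< b B)))) (ℕₚ.+-mono-≤ (count≤-mono A (ℕₚ.<⇒≤ lt)) (s≤s (count<-mono B (ℕₚ.<⇒≤ lt))))

bit-≢ : ∀ {a b} → a ≢ b → bit (a <ᵇ b) ≡ bit (a ≤ᵇ b)
bit-≢ {a} {b} a≢b with ℕₚ.<-cmp a b
... | tri< lt _ _ rewrite <ᵇ-true lt | ≤ᵇ-true (ℕₚ.<⇒≤ lt) = refl
... | tri≈ _ e _ = ⊥-elim (a≢b e)
... | tri> _ _ gt rewrite <ᵇ-false (ℕₚ.<⇒≤ gt) | ≤ᵇ-false gt = refl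

κ-swap-first : ∀ A {a b B} → a ≢ b → κ (A ++ b ∷ a ∷ B) (length A) ≡ κ (A ++ a ∷ b ∷ B) (suc (length A))
κ-swap-first A {a} {b} {B} a≢b rewrite κ-first A {b} {a} {B} | κ-second A {a} {b} {B} | bit-≢ a≢b = refl

κ-swap-second : ∀ A {a b B} → a ≢ b → κ (A ++ b ∷ a ∷ B) (suc (length A)) ≡ κ (A ++ a ∷ b ∷ B) (length A)
κ-swap-second A {a} {b} {B} a≢b rewrite κ-first A {a} {b} {B} | κ-second A {b} {a} {B} | bit-≢ (a≢b ∘ sym) = refl

!-swap-other : ∀ A {a b B} k → k ≢ length A → k ≢ suc (length A) → (A ++ b ∷ a ∷ B) ! k ≡ (A ++ a ∷ b ∷ B) ! k
!-swap-other [] zero p q = ⊥-elim (p refl)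
!-swap-other [] (suc zero) p q = ⊥-elim (q refl)
!-swap-other [] (suc (suc k)) p q = refl
!-swap-other (x ∷ A) zero p q = refl
!-swap-other (x ∷ A) (suc k) p q = !-swap-other A k (p ∘ cong suc) (q ∘ cong suc)

+-swapʳ : ∀ a b c → a ℕ.+ b ℕ.+ c ≡ a ℕ.+ c ℕ.+ b
+-swapʳ a b c = trans (ℕₚ.+-assoc a b c) (trans (cong (a ℕ.+_) (ℕₚ.+-comm b c)) (sym (ℕₚ.+-assoc a c b)))

count<-swap : ∀ m A {a b B} → count< m (A ++ b ∷ a ∷ B) ≡ count< m (A ++ a ∷ b ∷ B)
count<-swap m [] {a} {b} {B} = trans (sym (ℕₚ.+-assoc (bit (b <ᵇ m)) _ _)) (trans (cong (ℕ._+ count< m B) (ℕₚ.+-comm (bit (b <ᵇ m)) _)) (ℕₚ.+-assoc (bit (a <ᵇ m)) _ _))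
count<-swap m (x ∷ A) = cong (bit (x <ᵇ m) ℕ.+_) (count<-swap m A)

κ-swap-other : ∀ A {a b B} k → k ≢ length A → k ≢ suc (length A) → κ (A ++ b ∷ a ∷ B) k ≡ κ (A ++ a ∷ b ∷ B) k
κ-swap-other [] zero p q = ⊥-elim (p refl)
κ-swap-other [] (suc zero) p q = ⊥-elim (q refl)
κ-swap-other [] {B = B} (suc (suc k)) p q = +-swapʳ (κ B k) _ _
κ-swap-other (x ∷ A) zero p q = count<-swap x A
κ-swap-other (x ∷ A) (suc k) p q = cong₂ (λ i j → i ℕ.+ bit (x ≤ᵇ j))
  (κ-swap-other A k (p ∘ cong suc) (q ∘ cong suc)) (!-swap-other A k (p ∘ cong suc) (q ∘ cong suc))

count<-suc : ∀ m B → count< (suc m) B ≡ count≤ m B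
count<-suc m [] = refl
count<-suc m (zero ∷ B) = cong suc (count<-suc m B)
count<-suc m (suc y ∷ B) = cong (bit (y <ᵇ m) ℕ.+_) (count<-suc m B)

-- At the end of the word ties count towards the rank of the letter, at the front they do not.
-- Raising it by one compensates, as y < m + 1 means y ≤ m.
κ-rotate-first : ∀ m B → κ (suc m ∷ B) 0 ≡ κ (B ++ m ∷ []) (length B)
κ-rotate-first m B = trans (count<-suc m B) (sym (trans (κ-++ B) (ℕₚ.+-identityʳ _)))

!-snoc : ∀ B m {k} → k < length B → (B ++ m ∷ []) ! k ≡ B ! k
!-snoc (x ∷ B) m {zero} lt = refl
!-snoc (x ∷ B) m {suc k} (s≤s lt) = !-snoc B m lt

κ-snoc : ∀ B m {k} → k < length B → κ (B ++ m ∷ []) k ≡ κ B k ℕ.+ bit (m <ᵇ B ! k)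
κ-snoc (x ∷ B) m {zero} lt = trans (count<-++ x B (m ∷ [])) (cong (count< x B ℕ.+_) (ℕₚ.+-identityʳ _))
κ-snoc (x ∷ B) m {suc k} (s≤s lt) rewrite κ-snoc B m lt | !-snoc B m lt = +-swapʳ (κ B k) _ _

κ-rotate-next : ∀ m B {k} → k < length B → κ (suc m ∷ B) (suc k) ≡ κ (B ++ m ∷ []) k
κ-rotate-next m B lt = sym (κ-snoc B m lt)

infix 4 _<ˡ_ _≻_
data _<ˡ_ : List ℕ → List ℕ → Set where
  here  : ∀ {a b u v} → a < b → (a ∷ u) <ˡ (b ∷ v)
  there : ∀ {a u v} → u <ˡ v → (a ∷ u) <ˡ (a ∷ v)

<ˡ-trans : ∀ {u v w} → u <ˡ v → v <ˡ w → u <ˡ w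
<ˡ-trans (here p)  (here q)  = here (ℕₚ.<-trans p q)
<ˡ-trans (here p)  (there q) = here p
<ˡ-trans (there p) (here q)  = here q
<ˡ-trans (there p) (there q) = there (<ˡ-trans p q)

<ˡ-irrefl : ∀ {u} → ¬ u <ˡ u
<ˡ-irrefl (here p)  = ℕₚ.<-irrefl refl p
<ˡ-irrefl (there p) = <ˡ-irrefl p

_<ˡ?_ : ∀ u v → Dec (u <ˡ v)
[] <ˡ? v = no λ ()
(a ∷ u) <ˡ? [] = no λ ()
(a ∷ u) <ˡ? (b ∷ v) with ℕₚ.<-cmp a b
... | tri< lt _ _ = yes (here lt)
... | tri> ¬lt a≢b _ = no λ { (here lt) → ¬lt lt ; (there _) → a≢b refl }
... | tri≈ ¬lt refl _ with u <ˡ? v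
...   | yes p = yes (there p)
...   | no ¬p = no λ { (here lt) → ¬lt lt ; (there p) → ¬p p }

<ˡ-++ : ∀ A {a b u v} → a < b → (A ++ a ∷ u) <ˡ (A ++ b ∷ v)
<ˡ-++ []      lt = here lt
<ˡ-++ (x ∷ A) lt = there (<ˡ-++ A lt)

-- The Z_k are triangular for this order: the square norm drops at the interior monomials of a divided
-- difference, and within an orbit the lexicographically smaller word is the higher one.
_≻_ : List ℕ → List ℕ → Set
v ≻ u = sq u < sq v ⊎ (sq v ≡ sq u × v <ˡ u)

≻-trans : ∀ {u v w} → u ≻ v → v ≻ w → u ≻ w
≻-trans (inj₁ p) (inj₁ q) = inj₁ (ℕₚ.<-trans q p)
≻-trans {u} (inj₁ p) (inj₂ (e , q)) = inj₁ (subst (_< sq u) e p)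
≻-trans {w = w} (inj₂ (e , p)) (inj₁ q) = inj₁ (subst (sq w <_) (sym e) q)
≻-trans (inj₂ (e , p)) (inj₂ (e' , q)) = inj₂ (trans e e' , <ˡ-trans p q)

≻-irrefl : ∀ {u} → ¬ u ≻ u
≻-irrefl (inj₁ p)       = ℕₚ.<-irrefl refl p
≻-irrefl (inj₂ (_ , p)) = <ˡ-irrefl p

_≻?_ : ∀ v u → Dec (v ≻ u)
v ≻? u with sq u ℕ.<? sq v | sq v ℕ.≟ sq u | v <ˡ? u
... | yes p | _     | _     = yes (inj₁ p)
... | no _  | yes e | yes q = yes (inj₂ (e , q))
... | no ¬p | no ¬e | _     = no λ { (inj₁ p) → ¬p p ; (inj₂ (e , _)) → ¬e e }
... | no ¬p | _     | no ¬q = no λ { (inj₁ p) → ¬p p ; (inj₂ (_ , q)) → ¬q q }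

swap-≻ : ∀ A {a b B} → b < a → (A ++ b ∷ a ∷ B) ≻ (A ++ a ∷ b ∷ B)
swap-≻ A {a} {b} {B} lt = inj₂ (sq-swap A a b B , <ˡ-++ A lt)

-- Norms are unbounded, so an induction from the top of the order needs a finite measure: the words
-- of the support that lie above u.
above : List ℕ → List (List ℕ) → ℕ
above u [] = 0
above u (v ∷ S) with v ≻? u
... | yes _ = suc (above u S)
... | no _  = above u S

above-≤ : ∀ {u v} S → v ≻ u → above v S ≤ above u S
above-≤ [] _ = z≤n
above-≤ {u} {v} (w ∷ S) v≻u with w ≻? v | w ≻? u
... | yes _ | yes _ = s≤s (above-≤ S v≻u)
... | yes p | no ¬q = ⊥-elim (¬q (≻-trans p v≻u))
... | no _  | yes _ = ℕₚ.m≤n⇒m≤1+n (above-≤ S v≻u)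
... | no _  | no _  = above-≤ S v≻u

above-< : ∀ {u v} S → v ≻ u → v ∈ S → above v S < above u S
above-< {u} {v} (.v ∷ S) v≻u (here refl) with v ≻? v | v ≻? u
... | yes p | _     = ⊥-elim (≻-irrefl p)
... | no _  | no ¬q = ⊥-elim (¬q v≻u)
... | no _  | yes _ = s≤s (above-≤ S v≻u)
above-< {u} {v} (w ∷ S) v≻u (there v∈S) with w ≻? v | w ≻? u
... | yes _ | yes _ = s≤s (above-< S v≻u v∈S)
... | yes p | no ¬q = ⊥-elim (¬q (≻-trans p v≻u))
... | no _  | yes _ = ℕₚ.m≤n⇒m≤1+n (above-< S v≻u v∈S)
... | no _  | no _  = above-< S v≻u v∈S

module _ {n : ℕ} where
  open import Data.List.Membership.DecPropositional _≟ˡ_ using (_∈?_)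

  -- Words outside the support have coefficient 0 outright, so the recursion visits only words
  -- counted by `above`. `U` confines the induction to an upward closed range.
  descend : ∀ (f : Poly n) (U : List ℕ → Set) → (∀ {v u} → v ≻ u → U u → U v) →
            (∀ u → length u ≡ n → U u → (∀ v → v ≻ u → cl v f ≋ 0p) → cl u f ≋ 0p) →
            ∀ u → U u → cl u f ≋ 0p
  descend f U upward step u Uu = go _ u Uu ℕₚ.≤-refl
    where
    S = proj₁ (cl-support f)
    go : ∀ k u → U u → above u S ≤ k → cl u f ≋ 0p
    go k u Uu le with length u ℕ.≟ n
    ... | no ne = cl-length u f ne
    ... | yes len = step u len Uu (higher k le)
      where
      higher : ∀ k → above u S ≤ k → ∀ v → v ≻ u → cl v f ≋ 0p
      higher k le v v≻u with v ∈? S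
      ... | no v∉S = proj₂ (cl-support f) v v∉S
      higher zero le v v≻u | yes v∈S with ℕₚ.<-≤-trans (above-< S v≻u v∈S) le
      ... | ()
      higher (suc k) le v v≻u | yes v∈S = go k v (upward v≻u Uu) (ℕₚ.≤-pred (ℕₚ.≤-trans (above-< S v≻u v∈S) le))

  split₁ : ∀ k (u : List ℕ) → k < length u → ∃ λ A → ∃ λ z → ∃ λ R → u ≡ A ++ z ∷ R × length A ≡ k
  split₁ zero    (z ∷ u) lt = [] , z , u , refl , refl
  split₁ (suc k) (x ∷ u) (s≤s lt) with split₁ k u lt
  ... | A , z , R , refl , refl = x ∷ A , z , R , refl , refl

  Z-triangular : ∀ ε (f : Poly n) u k → length u ≡ n → k < n → (∀ v → v ≻ u → cl v f ≋ 0p) →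
                 cl u (Z ε k f) ≋ sc (proj₁ (wt ε u k)) (proj₂ (wt ε u k)) ⊗ cl u f
  Z-triangular ε f u k len lt vanish with split₁ k u (subst (k <_) (sym len) lt)
  ... | A , z , R , refl , refl rewrite κ-++ A {z} {R} | !-++ A {z} {R} =
    Z-coeff ε f (λ v N< → vanish v (inj₁ N<)) A z
      (λ { B₁ b B₂ refl y R' y<b N≤ → low B₁ y b R' (B₂ ++ z ∷ R) y<b (Lₚ.++-assoc B₁ (b ∷ B₂) (z ∷ R)) N≤ })
      (λ y R' y<z N≤ → low A y z R' R y<z refl N≤) lt R len ℕₚ.≤-refl
    where
    -- A word that departs downwards from u, with norm at least that of u, either has larger norm or
    -- is lexicographically smaller at equal norm; both put it above u.
    low : ∀ P y b R' Q → y < b → A ++ z ∷ R ≡ P ++ b ∷ Q → sq (A ++ z ∷ R) ≤ sq (P ++ y ∷ R') → cl (P ++ y ∷ R') f ≋ 0p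
    low P y b R' Q y<b e N≤ with ℕₚ.m≤n⇒m<n∨m≡n N≤
    ... | inj₁ N< = vanish _ (inj₁ N<)
    ... | inj₂ N≡ = vanish _ (inj₂ (sym N≡ , subst ((P ++ y ∷ R') <ˡ_) (sym e) (<ˡ-++ P y<b)))

  -- If f vanishes above u, then Z_k multiplies the coefficient at u by the eigenvalue of the word,
  -- but also by w k. The difference of two distinct monomials in q and t can be cancelled.
  wrong-weight : ∀ ε (f : Poly n) w u k → HasWeight ε f w → length u ≡ n → k < n → (∀ v → v ≻ u → cl v f ≋ 0p) →
                 w k ≢ wt ε u k → cl u f ≋ 0p
  wrong-weight ε f w u k h len lt vanish ne = ⊗-domain
    (mono-diff≢0 (proj₁ (w k) , proj₂ (w k) , []) (proj₁ (wt ε u k) , proj₂ (wt ε u k) , []) (λ e → ne (cong₂ _,_ (cong proj₁ e) (cong (proj₁ ∘ proj₂) e))))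
    (≋-trans (solve 3 (λ a b f → (a :- b) :* f := a :* f :- b :* f) ≋-refl _ _ _)
      (≋⇒⊖≋0 (≋-trans (≋-sym (cl-sc u _ _ f)) (≋-trans (≋-sym (cl-cong u (h k lt))) (Z-triangular ε f u k len lt vanish)))))

  differ : ∀ (u v : List ℕ) → length u ≡ length v → u ≢ v → ∃ λ k → k < length u × u ! k ≢ v ! k
  differ [] [] e ne = ⊥-elim (ne refl)
  differ (a ∷ u) (b ∷ v) e ne with a ℕ.≟ b
  ... | no a≢b = 0 , s≤s z≤n , a≢b
  ... | yes refl with differ u v (ℕₚ.suc-injective e) (ne ∘ cong (a ∷_))
  ...   | k , lt , neq = suc k , s≤s lt , neq

  wrong-word : ∀ (f : Poly n) η u → HasWeight 1 f (wt 1 η) → length η ≡ n → length u ≡ n → (∀ v → v ≻ u → cl v f ≋ 0p) →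
               u ≢ η → cl u f ≋ 0p
  wrong-word f η u h lenη len vanish u≢η with differ u η (trans len (sym lenη)) u≢η
  ... | k , lt , neq = wrong-weight 1 f (wt 1 η) u k h len (subst (k <_) len lt) vanish
    (λ e → neq (sym (trans (sym (ℕₚ.*-identityˡ _)) (trans (cong proj₁ e) (ℕₚ.*-identityˡ _)))))

  uniqueness : ∀ (f : Poly n) η → HasWeight 1 f (wt 1 η) → length η ≡ n → cl η f ≋ 0p → f ≋ 0p
  uniqueness f η h lenη η0 = cl-injective λ u → descend f (λ _ → ⊤) (λ _ _ → tt) step u tt
    where
    step : ∀ u → length u ≡ n → ⊤ → (∀ v → v ≻ u → cl v f ≋ 0p) → cl u f ≋ 0p
    step u len _ vanish with u ≟ˡ η
    ... | yes refl = η0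
    ... | no ne    = wrong-word f η u h lenη len vanish ne

  leading : ∀ (f : Poly n) η → HasWeight 1 f (wt 1 η) → length η ≡ n → ∀ u → u ≻ η → cl u f ≋ 0p
  leading f η h lenη = descend f (_≻ η) ≻-trans (λ u len u≻η vanish → wrong-word f η u h lenη len vanish (λ { refl → ≻-irrefl u≻η }))

-- Existence of eigenvectors regular at q = 1

opaque
  unfolding mono
  pair-mono : ∀ {n} (m : Mon n) F → pair (mono m) F ≡ F m
  pair-mono m F = trans (Qₚ.+-identityʳ _) (Qₚ.*-identityˡ _)

cl-one : ∀ n → cl (L.replicate n 0) (1p {n}) ≋ 1p
cl-one n = ≋-trans (cl-cong _ (≋-sym mono-1)) (≋-trans (mk≋ λ F → trans (pair-cl _ _ F) (trans (pair-mono _ _)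
    (trans (hit F (toList-zeros n)) (sym (pair-mono _ F))))) mono-1)
  where
  toList-zeros : ∀ n → toList (zeros {n}) ≡ L.replicate n 0
  toList-zeros zero    = refl
  toList-zeros (suc n) = cong (0 ∷_) (toList-zeros n)
  hit : ∀ F → toList (zeros {n}) ≡ L.replicate n 0 → select {n} (L.replicate n 0) F (0 , 0 , zeros) ≡ F (0 , 0 , [])
  hit F e with toList (zeros {n}) ≟ˡ L.replicate n 0
  ... | yes _ = refl
  ... | no ne = ⊥-elim (ne e)

1p≢0 : ∀ {n} → ¬ 1p {n} ≋ 0p
1p≢0 e = mono≢0 _ (≋-trans mono-1 e)

Regular : ∀ {n} → List ℕ → Poly n → Set
Regular η f = HasWeight 1 f (wt 1 η) × ¬ spec (cl η f) ≋ 0p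

leading-zeros : ∀ u → u ≡ L.replicate (length u) 0 ⊎ (∃ λ k → ∃ λ b → ∃ λ B → u ≡ L.replicate k 0 ++ suc b ∷ B)
leading-zeros [] = inj₁ refl
leading-zeros (suc b ∷ B) = inj₂ (0 , b , B , refl)
leading-zeros (zero ∷ u) with leading-zeros u
... | inj₁ e = inj₁ (cong (0 ∷_) e)
... | inj₂ (k , b , B , e) = inj₂ (suc k , b , B , cong (0 ∷_) e)

replicate-snoc : ∀ k (R : List ℕ) → L.replicate (suc k) 0 ++ R ≡ L.replicate k 0 ++ 0 ∷ R
replicate-snoc zero    R = refl
replicate-snoc (suc k) R = cong (0 ∷_) (replicate-snoc k R)

!-zeros : ∀ m k → L.replicate m 0 ! k ≡ 0
!-zeros zero    k       = refl
!-zeros (suc m) zero    = refl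
!-zeros (suc m) (suc k) = !-zeros m k

κ-zeros : ∀ m k → k < m → κ (L.replicate m 0) k ≡ k
κ-zeros (suc m) zero lt = count0 m
  where
  count0 : ∀ m → count< 0 (L.replicate m 0) ≡ 0
  count0 zero    = refl
  count0 (suc m) = count0 m
κ-zeros (suc m) (suc k) (s≤s lt) = trans (cong (ℕ._+ 1) (κ-zeros m k lt)) (ℕₚ.+-comm k 1)

module _ {n : ℕ} where
  T-one : ∀ j → suc j < n → T′ {n} j 1p ≋ t ⊗ 1p
  T-one j lt = ≋-trans (⊖-cong ≋-refl (≋-trans (⊗-congˡ (∂-invariant j lt (1-homo (s-hom j)))) (⊗-zeroʳ _)))
    (solve 1 (λ p → p :- :0 := p) ≋-refl _)

  τ-one : ∀ j → suc j < n → τ {n} j 1p ≋ 1p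
  τ-one j lt = ≋-trans (⊖-cong ≋-refl (≋-trans (⊗-congˡ (∂-invariant j lt (1-homo (s-hom j)))) (⊗-zeroʳ _)))
    (solve 1 (λ p → p :- :0 := p) ≋-refl _)

  up-one : ∀ k → k < n → up {n} k 1p ≋ sc 0 k
  up-one zero lt = ≋-sym mono-1
  up-one (suc k) lt = ≋-trans (up-cong k (ℕₚ.<⇒≤ lt) (T-one k lt)) (≋-trans (up-linear k 1p (ℕₚ.<⇒≤ lt) (λ j _ → s-t j))
    (≋-trans (⊗-congˡ (up-one k (ℕₚ.<⇒≤ lt))) (sc-⊗ 0 1 0 k)))

  down-one : ∀ a m → a ℕ.+ m < n → down {n} a m 1p ≋ 1p
  down-one a zero    lt = ≋-refl
  down-one a (suc m) lt = ≋-trans (τ-cong a (head-< a lt) (down-one (suc a) m (tail-< a lt))) (τ-one a (head-< a lt))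

  Z-one : ∀ ε k → k < n → Z {n} ε k 1p ≋ sc 0 k ⊗ 1p
  Z-one ε k lt = ≋-trans (down-cong k _ lt′ (≋-trans (ω-cong ε (up-one k lt)) (≋-trans (ω-sc ε 0 k)
      (solve 1 (λ p → p := p :* :1) ≋-refl _))))
    (≋-trans (down-linear k _ 1p lt′ (λ j _ → s-sc j 0 k)) (⊗-congˡ (down-one k _ lt′)))
    where lt′ = ℕₚ.≤-reflexive (suc[k+[n∸suc-k]]≡n lt)

  regular-zeros : Regular {n} (L.replicate n 0) 1p
  regular-zeros = (λ k lt → ≋-trans (Z-one 1 k lt) (≋-reflexive (cong₂ (λ a b → sc a b ⊗ 1p)
      (sym (trans (ℕₚ.*-identityˡ _) (!-zeros n k))) (sym (κ-zeros n k lt)))))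
    , λ e → 1p≢0 (≋-trans (≋-sym (≋-trans (⟦⟧-cong spec-hom (cl-one n)) (1-homo spec-hom))) e)

  -- The coefficient at the new leading word is multiplied by e' - e, which is nonzero at q = 1
  -- because κ separates positions.
  regular-swap : ∀ A {b c B f} → c < b → length (A ++ b ∷ c ∷ B) ≡ n → Regular {n} (A ++ b ∷ c ∷ B) f →
                 ∃ (Regular {n} (A ++ c ∷ b ∷ B))
  regular-swap A {b} {c} {B} {f} c<b len (h , reg) = F , hF , regF
    where
    i = length A
    v = A ++ b ∷ c ∷ B
    u = A ++ c ∷ b ∷ B
    ltn : suc i < n
    ltn = subst (suc i <_) len (subst (suc i <_) (sym (Lₚ.length-++ A)) (ℕₚ.≤-trans (ℕₚ.≤-reflexive (trans (ℕₚ.+-comm 2 i) refl))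
            (ℕₚ.+-monoʳ-≤ i (s≤s (s≤s z≤n)))))
    w = wt 1 v
    F = Ψ 1 i (w i) (w (suc i)) f
    b≢c : b ≢ c
    b≢c refl = ℕₚ.<-irrefl refl c<b
    hF : HasWeight 1 F (wt 1 u)
    hF = intertwiner 1 i f w (wt 1 u) ltn h
      (cong₂ (λ p q → 1 ℕ.* p , q) (trans (!-++ A) (sym (!-second A))) (κ-swap-first A b≢c))
      (cong₂ (λ p q → 1 ℕ.* p , q) (trans (!-second A) (sym (!-++ A))) (κ-swap-second A b≢c))
      (λ k p q → cong₂ (λ p q → 1 ℕ.* p , q) (!-swap-other A k p q) (κ-swap-other A k p q))
    lead : ∀ v' → v' ≻ v → cl v' f ≋ 0p
    lead = leading f v h len
    uf0 : cl u f ≋ 0p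
    uf0 = lead u (swap-≻ A c<b)
    E E' : ∀ {k} → Poly k
    E = sc (proj₁ (w i)) (proj₂ (w i))
    E' = sc (proj₁ (w (suc i))) (proj₂ (w (suc i)))
    Tf : cl u (T′ i f) ≋ cl v f
    Tf = ≋-trans (T-lt A B ltn f (λ v' N< → lead v' (inj₁ N<)) (ℕₚ.≤-reflexive (sym (sq-swap A b c B))) c<b)
      (≋-trans (⊕-congˡ (≋-trans (⊗-congˡ uf0) (⊗-zeroʳ _))) (⊕-identityʳ _))
    clF : cl u F ≋ (E' ⊖′ E) ⊗ cl v f
    clF = begin
      cl u ((E' ⊖′ E) ⊗ T′ i f ⊕ ((1p ⊖′ t) ⊗ E') ⊗ f)
        ≈⟨ cl-cong u (solve 5 (λ a b t h f → (a :- b) :* h :+ ((:1 :- t) :* a) :* f := (a :* h :- b :* h) :+ (a :* f :- t :* (a :* f))) ≋-refl E' E t (T′ i f) f) ⟩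
      cl u ((E' ⊗ T′ i f ⊖′ E ⊗ T′ i f) ⊕ (E' ⊗ f ⊖′ t ⊗ (E' ⊗ f)))
        ≈⟨ ≋-trans (cl-⊕ u _ _) (⊕-cong (≋-trans (cl-⊖ u _ _) (⊖-cong (cl-sc u _ _ _) (cl-sc u _ _ _)))
                                        (≋-trans (cl-⊖ u _ _) (⊖-cong (cl-sc u _ _ f) (≋-trans (cl-sc u 0 1 _) (⊗-congˡ (cl-sc u _ _ f)))))) ⟩
      (E' ⊗ cl u (T′ i f) ⊖′ E ⊗ cl u (T′ i f)) ⊕ (E' ⊗ cl u f ⊖′ t ⊗ (E' ⊗ cl u f))
        ≈⟨ ⊕-cong (⊖-cong (⊗-congˡ Tf) (⊗-congˡ Tf)) (⊖-cong (⊗-congˡ uf0) (⊗-congˡ (⊗-congˡ uf0))) ⟩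
      (E' ⊗ cl v f ⊖′ E ⊗ cl v f) ⊕ (E' ⊗ 0p ⊖′ t ⊗ (E' ⊗ 0p))
        ≈⟨ solve 4 (λ a b t g → (a :* g :- b :* g) :+ (a :* :0 :- t :* (a :* :0)) := (a :- b) :* g) ≋-refl E' E t (cl v f) ⟩
      (E' ⊖′ E) ⊗ cl v f ∎
      where open ≋-Reasoning {0}
    regF : ¬ spec (cl u F) ≋ 0p
    regF e = reg (⊗-domain (mono-diff≢0 (0 , κ v (suc i) , []) (0 , κ v i , []) λ eq →
        ℕₚ.<-irrefl (cong (proj₁ ∘ proj₂) eq) (κ-descent A c<b))
      (≋-trans (⊗-congʳ (≋-sym (≋-trans (⊖-homo spec-hom _ _) (⊖-cong (spec-sc _ _) (spec-sc _ _)))))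
      (≋-trans (≋-sym (⊗-homo spec-hom _ _)) (≋-trans (⟦⟧-cong spec-hom (≋-sym clF)) e))))

-- Raising multiplies the leading coefficient by a power of q only, up to a power of q on the other
-- side, and both become 1 at q = 1.
regular-raise : ∀ {N} B b {f} → length B ≡ N → Regular {suc N} (B ++ b ∷ []) f → ∃ (Regular {suc N} (suc b ∷ B))
regular-raise {N} B b {f} refl (h , reg) with raise 1 f
... | M , g , ωg = g , raised 1 M f g ωg (wt 1 (B ++ b ∷ [])) (wt 1 (suc b ∷ B))
      (cong₂ _,_ (trans (ℕₚ.*-identityˡ (suc b)) (trans (ℕₚ.+-comm 1 b) (cong (ℕ._+ 1) (sym (trans (ℕₚ.*-identityˡ _) (!-++ B)))))) (κ-rotate-first b B))
      (λ k lt → cong₂ (λ p q → 1 ℕ.* p , q) (sym (!-snoc B b lt)) (κ-rotate-next b B lt)) h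
    , λ e → reg (begin
      spec (cl (B ++ b ∷ []) f) ≈⟨ ⟦⟧-cong spec-hom (cl-x-suc B f ℕₚ.≤-refl) ⟨
      spec (cl (B ∷ʳ suc b) (x N ⊗ f)) ≈⟨ unit (spec (cl (B ∷ʳ suc b) (x N ⊗ f))) M ⟨
      spec (sc M 0) ⊗ spec (cl (B ∷ʳ suc b) (x N ⊗ f)) ≈⟨ ⊗-homo spec-hom _ _ ⟨
      spec (sc M 0 ⊗ cl (B ∷ʳ suc b) (x N ⊗ f)) ≈⟨ ⟦⟧-cong spec-hom (≋-trans (cl-cong _ ωg) (cl-sc _ M 0 _)) ⟨
      spec (cl (B ∷ʳ suc b) (ω 1 g)) ≈⟨ ⟦⟧-cong spec-hom (cl-ω 1 B (suc b) g) ⟩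
      spec (sc (1 ℕ.* suc b) 0 ⊗ cl (suc b ∷ B) g) ≈⟨ ⊗-homo spec-hom _ _ ⟩
      spec (sc (1 ℕ.* suc b) 0) ⊗ spec (cl (suc b ∷ B) g) ≈⟨ unit _ (1 ℕ.* suc b) ⟩
      spec (cl (suc b ∷ B) g) ≈⟨ e ⟩
      0p ∎)
  where
  open ≋-Reasoning {0}
  unit : ∀ p m → spec (sc m 0) ⊗ p ≋ p
  unit p m = ≋-trans (⊗-congʳ (≋-trans (spec-sc m 0) mono-1)) (⊗-identityˡ p)

-- Every word is reached from zeros by raising (rotate the last letter to the front and add one) and by
-- moving its first nonzero letter to the right past zeros.
existence : ∀ {n} η → length η ≡ n → ∃ (Regular {n} η)
existence {n} η len = by-sum (sum η) η refl len
  where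
  -- The recursion is lexicographic: undoing a raise lowers the sum S, undoing a swap keeps S and
  -- shortens the zeros k in front.
  by-sum : ∀ S η → sum η ≡ S → length η ≡ n → ∃ (Regular {n} η)
  by-zeros : ∀ S k b B → sum (L.replicate k 0 ++ suc b ∷ B) ≡ S → length (L.replicate k 0 ++ suc b ∷ B) ≡ n →
             ∃ (Regular {n} (L.replicate k 0 ++ suc b ∷ B))
  by-sum S η e len with leading-zeros η
  ... | inj₁ z = 1p , subst (λ u → Regular u 1p) (sym (trans z (cong (λ m → L.replicate m 0) len))) regular-zeros
  ... | inj₂ (k , b , B , refl) = by-zeros S k b B e len
  by-zeros (suc S) zero b B e refl = regular-raise B b refl
    (proj₂ (by-sum S (B ++ b ∷ []) (trans (sum-++ B (b ∷ [])) (trans (ℕₚ.+-comm (sum B) _) (trans (cong (ℕ._+ sum B) (ℕₚ.+-identityʳ b)) (ℕₚ.suc-injective e)))) (length-snoc B b)))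
  by-zeros S (suc k) b B e len = subst (∃ ∘ Regular) (sym (replicate-snoc k (suc b ∷ B)))
    (regular-swap (L.replicate k 0) (s≤s z≤n) len′ (proj₂ (by-zeros S k b (0 ∷ B) e′ len′)))
    where
    u = L.replicate k 0
    len′ : length (u ++ suc b ∷ 0 ∷ B) ≡ n
    len′ = trans (length-swap u) (trans (cong length (sym (replicate-snoc k (suc b ∷ B)))) len)
    e′ : sum (u ++ suc b ∷ 0 ∷ B) ≡ S
    e′ = trans (sum-++ u _) (trans (sym (sum-++ u (0 ∷ suc b ∷ B))) (trans (cong sum (sym (replicate-snoc k (suc b ∷ B)))) e))

-- Eigenspaces at q = 1

exps : List ℕ → ℕ → ℕ × ℕ
exps w k = 0 , w ! k

module _ {n : ℕ} where
  T-⊖ : ∀ j (f g : Poly n) → suc j < n → T′ j (f ⊖′ g) ≋ T′ j f ⊖′ T′ j g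
  T-⊖ j f g lt = ≋-trans (⊖-cong ≋-refl (⊗-congˡ (∂-⊖ j f g lt)))
    (solve 6 (λ t f g c D E → t :* (f :- g) :- c :* (D :- E) := (t :* f :- c :* D) :- (t :* g :- c :* E))
      ≋-refl t f g (c j) (∂ j f) (∂ j g))

  t-1≢0 : ¬ t {n} ⊖′ 1p ≋ 0p
  t-1≢0 e = mono-diff≢0 (0 , 1 , zeros) (0 , 0 , zeros) (λ ()) (≋-trans (⊖-cong ≋-refl mono-1) e)

  c≢0 : ∀ j → ¬ c {n} j ≋ 0p
  c≢0 j e = mono-diff≢0 (0 , 1 , V.zipWith ℕ._+_ zeros (unitV j)) (0 , 0 , unitV (suc j)) (λ ())
    (≋-trans (⊖-cong (≋-sym (mono-⊗ _ _)) ≋-refl) e)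

  ordered-or-descent : ∀ i (u : List ℕ) → suc i < length u → κ u (suc i) < κ u i →
                       ∃ λ A → ∃ λ a → ∃ λ b → ∃ λ B → u ≡ A ++ a ∷ b ∷ B × length A ≡ i × b < a
  ordered-or-descent i u lt κ> with split₂ i u lt
  ... | A , a , b , B , refl , refl with a ℕ.≤? b
  ...   | no a≰b = A , a , b , B , refl , refl , ℕₚ.≰⇒> a≰b
  ...   | yes a≤b = ⊥-elim (ℕₚ.<-asym κ> (κ-ascent A a≤b))

  -- The vector h below has the swapped weight, so a leading word u of h has u_i > u_{i+1};
  -- but T_i h = - h makes the coefficient at u vanish with the one at the higher word s_i u.
  consecutive⇒T : ∀ {f : Poly n} {w} i b → suc i < n → HasWeight 0 f w → w i ≡ (0 , b) → w (suc i) ≡ (0 , suc b) →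
                  T′ i f ≋ t ⊗ f
  consecutive⇒T {f} {w} i b lt hw wi wsi = ⊖≋0⇒≋ (⊗-domain (mono≢0 (0 , b , zeros)) (⊗-domain t-1≢0 (≋-trans (≋-sym h≋) h0)))
    where
    open ≋-Reasoning {n}
    h h' : Poly n
    h = Ψ 0 i (w i) (w (suc i)) f
    h' = T′ i f ⊖′ t ⊗ f
    tb : sc {n} 0 (suc b) ≋ t ⊗ sc 0 b
    tb = ≋-sym (sc-⊗ 0 1 0 b)
    -- Since e' = t e, the intertwiner is T_i - t up to the nonzero factor (t - 1) t^b.
    h≋ : h ≋ (t ⊖′ 1p) ⊗ (sc 0 b ⊗ h')
    h≋ rewrite wi | wsi = ≋-trans (⊕-cong (⊗-congʳ (⊖-cong tb ≋-refl)) (⊗-congʳ (⊗-congˡ tb)))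
      (solve 4 (λ t e g f → (t :* e :- e) :* g :+ ((:1 :- t) :* (t :* e)) :* f := (t :- :1) :* (e :* (g :- t :* f))) ≋-refl t (sc 0 b) (T′ i f) f)
    Th' : T′ i h' ≋ ⊟ h'
    Th' = ≋-trans (T-⊖ i _ _ lt) (≋-trans (⊖-cong (T-quadratic i f lt) (T-linear i f lt (s-t i)))
      (solve 3 (λ t g f → ((t :- :1) :* g :+ t :* f) :- t :* g := :- (g :- t :* f)) ≋-refl t (T′ i f) f))
    Th : T′ i h ≋ ⊟ h
    Th = begin
      T′ i h ≈⟨ T-cong i lt h≋ ⟩
      T′ i ((t ⊖′ 1p) ⊗ (sc 0 b ⊗ h')) ≈⟨ T-linear i _ lt (≋-trans (s-⊖ i t 1p) (⊖-cong (s-t i) (1-homo (s-hom i)))) ⟩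
      (t ⊖′ 1p) ⊗ T′ i (sc 0 b ⊗ h') ≈⟨ ⊗-congˡ (≋-trans (T-linear i _ lt (s-sc i 0 b)) (⊗-congˡ Th')) ⟩
      (t ⊖′ 1p) ⊗ (sc 0 b ⊗ ⊟ h') ≈⟨ solve 3 (λ t e g → (t :- :1) :* (e :* (:- g)) := :- ((t :- :1) :* (e :* g))) ≋-refl t (sc 0 b) h' ⟩
      ⊟ ((t ⊖′ 1p) ⊗ (sc 0 b ⊗ h')) ≈⟨ ⊟-cong h≋ ⟨
      ⊟ h ∎
    w' : ℕ → ℕ × ℕ
    w' k with k ℕ.≟ i | k ℕ.≟ suc i
    ... | yes _ | _     = w (suc i)
    ... | no _  | yes _ = w i
    ... | no _  | no _  = w k
    w'i : w' i ≡ w (suc i)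
    w'i with i ℕ.≟ i
    ... | yes _ = refl
    ... | no ne = ⊥-elim (ne refl)
    w'si : w' (suc i) ≡ w i
    w'si with suc i ℕ.≟ i | suc i ℕ.≟ suc i
    ... | yes e | _     = ⊥-elim (ℕₚ.1+n≢n e)
    ... | no _  | yes _ = refl
    ... | no _  | no ne = ⊥-elim (ne refl)
    w'k : ∀ k → k ≢ i → k ≢ suc i → w' k ≡ w k
    w'k k p q with k ℕ.≟ i | k ℕ.≟ suc i
    ... | yes e | _     = ⊥-elim (p e)
    ... | no _  | yes e = ⊥-elim (q e)
    ... | no _  | no _  = refl
    hw' : HasWeight 0 h w'
    hw' = intertwiner 0 i f w w' lt hw w'i w'si w'k
    step : ∀ u → length u ≡ n → ⊤ → (∀ v → v ≻ u → cl v h ≋ 0p) → cl u h ≋ 0p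
    step u len _ vanish with κ u i ℕ.≟ suc b | κ u (suc i) ℕ.≟ b
    ... | no ne | _ = wrong-weight 0 h w' u i hw' len (ℕₚ.<⇒≤ lt) vanish (λ e → ne (sym (cong proj₂ (trans (sym (trans w'i wsi)) e))))
    ... | yes _ | no ne = wrong-weight 0 h w' u (suc i) hw' len lt vanish (λ e → ne (sym (cong proj₂ (trans (sym (trans w'si wi)) e))))
    ... | yes κi | yes κsi with ordered-or-descent i u (subst (suc i <_) (sym len) lt) (subst₂ _<_ (sym κsi) (sym κi) ℕₚ.≤-refl)
    -- `T-lt` is used at the higher word s_i u: there T_i h has the coefficient of h at u plus (t -
    -- 1) times a coefficient that vanishes.
    ...   | A , a , c' , B , refl , refl , c'<a = ≋-trans (solve 1 (λ p → p := p :+ (t′ :* :0)) ≋-refl _) (≋-trans (⊕-congˡ (solve 1 (λ s → t′ :* :0 := s :* :0) ≋-refl (t ⊖′ 1p)))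
        (≋-trans (⊕-congˡ (⊗-congˡ (≋-sym swapped))) (≋-trans (≋-sym (T-lt A B lt h (λ v N< → vanish v (inj₁ N<)) (ℕₚ.≤-reflexive (sym (sq-swap A a c' B))) c'<a))
        (≋-trans (cl-cong _ Th) (≋-trans (cl-⊟ _ h) (≋-trans (⊟-cong swapped) (solve 0 (:- :0 := :0) ≋-refl)))))))
      where
      t′ = :1
      swapped : cl (A ++ c' ∷ a ∷ B) h ≋ 0p
      swapped = vanish _ (swap-≻ A c'<a)
    h0 : h ≋ 0p
    h0 = cl-injective λ u → descend h (λ _ → ⊤) (λ _ _ → tt) step u tt

  T⇒s : ∀ {f : Poly n} j → suc j < n → T′ j f ≋ t ⊗ f → s j f ≋ f
  T⇒s {f} j lt e = ≋-sym (⊖≋0⇒≋ (≋-trans (≋-sym (∂-eq j f lt)) (≋-trans (⊗-congˡ (⊗-domain (c≢0 j)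
    (≋-trans (solve 3 (λ t f h → h := t :* f :- (t :* f :- h)) ≋-refl t f _) (≋⇒⊖≋0 (≋-sym e))))) (⊗-zeroʳ _))))

  minimal⇒symmetric : ∀ {f : Poly n} {w} → HasWeight 0 f w → (∀ k → k < n → w k ≡ (0 , k)) → Symmetric f
  minimal⇒symmetric hw e j lt = T⇒s j lt (consecutive⇒T j j lt hw (e j (ℕₚ.<⇒≤ lt)) (e (suc j) lt))

  symmetric-⊗ : ∀ {a b : Poly n} → Symmetric a → Symmetric b → Symmetric (a ⊗ b)
  symmetric-⊗ A B j lt = ≋-trans (s-⊗ j _ _) (⊗-cong (A j lt) (B j lt))

  Proportional : Poly n → Poly n → Set
  Proportional f g = ∃ λ a → ∃ λ b → Symmetric a × Symmetric b × a ⊗ f ≋ b ⊗ g × (a ≋ 0p → g ≋ 0p)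

  OneDimensional : List ℕ → Set
  OneDimensional w = length w ≡ n → ∀ f g → HasWeight 0 f (exps w) → HasWeight 0 g (exps w) → Proportional f g

  Ψ-linear : ∀ i e e' {a b : Poly n} f g → suc i < n → s i a ≋ a → s i b ≋ b →
             Ψ 0 i e e' (a ⊗ f ⊖′ b ⊗ g) ≋ a ⊗ Ψ 0 i e e' f ⊖′ b ⊗ Ψ 0 i e e' g
  Ψ-linear i e e' {a} {b} f g lt sa sb = ≋-trans (⊕-congʳ (⊗-congˡ (≋-trans (T-⊖ i _ _ lt) (⊖-cong (T-linear i f lt sa) (T-linear i g lt sb)))))
    (solve 8 (λ p q a b f g u v → p :* (a :* u :- b :* v) :+ q :* (a :* f :- b :* g) := a :* (p :* u :+ q :* f) :- b :* (p :* v :+ q :* g))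
      ≋-refl (scp 0 e' ⊖′ scp 0 e) ((1p ⊖′ t) ⊗ scp 0 e') a b f g (T′ i f) (T′ i g))

  Ψ-injective : ∀ i a b {f : Poly n} → suc i < n → suc b ≢ a → b ≢ suc a → Ψ 0 i (0 , a) (0 , b) f ≋ 0p → f ≋ 0p
  Ψ-injective i a b {f} lt p q e = ⊗-domain nonzero (≋-trans (≋-sym (Ψ-Ψ 0 i (0 , a) (0 , b) f lt))
    (≋-trans (⊕-cong (⊗-congˡ (≋-trans (T-cong i lt e) (≋-trans (T-cong i lt (≋-sym (⊗-zeroʳ t)))
       (≋-trans (T-linear i 0p lt (s-t i)) (≋-trans (⊗-congˡ T0) (⊗-zeroʳ t)))))) (⊗-congˡ e))
      (solve 2 (λ p q → p :* :0 :+ q :* :0 := :0) ≋-refl _ _)))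
    where
    T0 : T′ i 0p ≋ 0p
    T0 = ≋-trans (⊖-cong (⊗-zeroʳ t) (≋-trans (⊗-congˡ (∂-invariant i lt (0-homo (s-hom i)))) (⊗-zeroʳ _))) (≋⇒⊖≋0 ≋-refl)
    A B : Poly n
    A = sc 0 a
    B = sc 0 b
    first : ¬ t ⊗ B ⊖′ A ≋ 0p
    first e = mono-diff≢0 (0 , suc b , zeros) (0 , a , zeros) (λ eq → p (cong (proj₁ ∘ proj₂) eq)) (≋-trans (⊖-cong (≋-sym (sc-⊗ 0 1 0 b)) ≋-refl) e)
    second : ¬ B ⊖′ t ⊗ A ≋ 0p
    second e = mono-diff≢0 (0 , b , zeros) (0 , suc a , zeros) (λ eq → q (cong (proj₁ ∘ proj₂) eq)) (≋-trans (⊖-cong ≋-refl (≋-sym (sc-⊗ 0 1 0 a))) e)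
    nonzero : ¬ ⊟ ((t ⊗ B ⊖′ A) ⊗ (B ⊖′ t ⊗ A)) ≋ 0p
    nonzero e = ⊗-≢0 first second (≋-trans (solve 1 (λ p → p := :- (:- p)) ≋-refl _) (≋-trans (⊟-cong e) (solve 0 (:- :0 := :0) ≋-refl)))

  -- The multipliers a and b are kept: Ψ commutes with symmetric factors and so maps a f - b g to a
  -- Ψf - b Ψg = 0, whence a f - b g = 0.
  swap-transfer : ∀ A x y B → suc y ≢ x → y ≢ suc x → OneDimensional (A ++ y ∷ x ∷ B) → OneDimensional (A ++ x ∷ y ∷ B)
  swap-transfer A x y B p q one len f g hf hg with one (trans (length-swap A) len) F G (weight f hf) (weight g hg)
    where
    F = Ψ 0 (length A) (exps (A ++ x ∷ y ∷ B) (length A)) (exps (A ++ x ∷ y ∷ B) (suc (length A))) f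
    G = Ψ 0 (length A) (exps (A ++ x ∷ y ∷ B) (length A)) (exps (A ++ x ∷ y ∷ B) (suc (length A))) g
    lt : suc (length A) < n
    lt = subst (suc (length A) <_) len (subst (suc (length A) <_) (sym (Lₚ.length-++ A)) (ℕₚ.≤-trans (ℕₚ.≤-reflexive (ℕₚ.+-comm 2 (length A)))
            (ℕₚ.+-monoʳ-≤ (length A) (s≤s (s≤s z≤n)))))
    weight : ∀ f → HasWeight 0 f (exps (A ++ x ∷ y ∷ B)) →
             HasWeight 0 (Ψ 0 (length A) (exps (A ++ x ∷ y ∷ B) (length A)) (exps (A ++ x ∷ y ∷ B) (suc (length A))) f) (exps (A ++ y ∷ x ∷ B))
    weight f hf = intertwiner 0 (length A) f (exps (A ++ x ∷ y ∷ B)) (exps (A ++ y ∷ x ∷ B)) lt hf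
      (cong (0 ,_) (trans (!-++ A) (sym (!-second A)))) (cong (0 ,_) (trans (!-second A) (sym (!-++ A))))
      (λ k p q → cong (0 ,_) (!-swap-other A k p q))
  ... | a , b , sa , sb , eq , nz = a , b , sa , sb
      , ⊖≋0⇒≋ (inj (≋-trans (Ψ-linear i _ _ f g lt (sa i lt) (sb i lt)) (≋⇒⊖≋0 eq)))
      , (λ a0 → inj (nz a0))
    where
    i = length A
    lt : suc i < n
    lt = subst (suc i <_) len (subst (suc i <_) (sym (Lₚ.length-++ A)) (ℕₚ.≤-trans (ℕₚ.≤-reflexive (ℕₚ.+-comm 2 i))
            (ℕₚ.+-monoʳ-≤ i (s≤s (s≤s z≤n)))))
    inj : ∀ {h : Poly n} → Ψ 0 i (exps (A ++ x ∷ y ∷ B) i) (exps (A ++ x ∷ y ∷ B) (suc i)) h ≋ 0p → h ≋ 0p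
    inj {h} e = Ψ-injective i x y lt p q (≋-trans (≋-reflexive (cong₂ (λ a b → Ψ 0 i (0 , a) (0 , b) h) (sym (!-++ A)) (sym (!-second A)))) e)

  bubble : ∀ A P c B → All (suc (suc c) ≤_) A → OneDimensional (P ++ A ++ c ∷ B) → OneDimensional (P ++ c ∷ A ++ B)
  bubble [] P c B [] one = one
  bubble (y ∷ A) P c B (y≥ ∷ A≥) one = swap-transfer P c y (A ++ B)
    (λ e → ℕₚ.<-irrefl refl (ℕₚ.<-trans (ℕₚ.n<1+n c) (ℕₚ.≤-trans y≥ (ℕₚ.≤-trans (ℕₚ.n≤1+n y) (ℕₚ.≤-reflexive e)))))
    (λ { refl → ℕₚ.<-irrefl refl y≥ })
    (subst OneDimensional (snoc-++ P y (c ∷ A ++ B)) (bubble A (P ++ y ∷ []) c B A≥ (subst OneDimensional (sym (snoc-++ P y (A ++ c ∷ B))) one)))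

-- The equation for the raised vectors is pushed through ω, which fixes the symmetric multipliers at
-- ε = 0, and the last variable is cancelled. The powers of q from `raise` are absorbed into the
-- multipliers.
rotate-transfer : ∀ {N} B x' → OneDimensional {suc N} (x' ∷ B) → OneDimensional {suc N} (B ++ x' ∷ [])
rotate-transfer {N} B x' one len f g hf hg with raise 0 f | raise 0 g
... | M , F , ωF | M' , G , ωG with one (trans (sym (length-snoc B x')) len) F G (weight M f F ωF hf) (weight M' g G ωG hg)
  where
  B≡N : length B ≡ N
  B≡N = ℕₚ.suc-injective (trans (sym (length-snoc B x')) len)
  weight : ∀ M f F → ω 0 F ≋ sc M 0 ⊗ (x N ⊗ f) → HasWeight 0 f (exps (B ++ x' ∷ [])) → HasWeight 0 F (exps (x' ∷ B))
  weight M f F ωF hf = raised 0 M f F ωF (exps (B ++ x' ∷ [])) (exps (x' ∷ B))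
    (cong (0 ,_) (sym (trans (cong ((B ++ x' ∷ []) !_) (sym B≡N)) (!-++ B))))
    (λ k lt → cong (0 ,_) (sym (!-snoc B x' (subst (k <_) (sym B≡N) lt)))) hf
... | a , b , sa , sb , eq , nz = a ⊗ sc M 0 , b ⊗ sc M' 0
    , symmetric-⊗ sa (λ j _ → s-sc j M 0) , symmetric-⊗ sb (λ j _ → s-sc j M' 0)
    , ⊗-cancelˡ x≢0 (begin
        x N ⊗ ((a ⊗ sc M 0) ⊗ f) ≈⟨ solve 4 (λ x a m f → x :* ((a :* m) :* f) := a :* (m :* (x :* f))) ≋-refl (x N) a (sc M 0) f ⟩
        a ⊗ (sc M 0 ⊗ (x N ⊗ f)) ≈⟨ ⊗-cong (symmetric⇒ω sa) ωF ⟨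
        ω 0 a ⊗ ω 0 F ≈⟨ ω-⊗ 0 a F ⟨
        ω 0 (a ⊗ F) ≈⟨ ω-cong 0 eq ⟩
        ω 0 (b ⊗ G) ≈⟨ ω-⊗ 0 b G ⟩
        ω 0 b ⊗ ω 0 G ≈⟨ ⊗-cong (symmetric⇒ω sb) ωG ⟩
        b ⊗ (sc M' 0 ⊗ (x N ⊗ g)) ≈⟨ solve 4 (λ x a m f → x :* ((a :* m) :* f) := a :* (m :* (x :* f))) ≋-refl (x N) b (sc M' 0) g ⟨
        x N ⊗ ((b ⊗ sc M' 0) ⊗ g) ∎)
    , λ e → ⊗-domain x≢0 (⊗-domain (mono≢0 (M' , 0 , zeros)) (≋-trans (≋-sym ωG)
        (≋-trans (ω-cong 0 (nz (⊗-domain (mono≢0 (M , 0 , zeros)) (≋-trans (⊗-comm _ _) e)))) (0-homo (ω-hom 0)))))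
  where
  open ≋-Reasoning {suc N}
  x≢0 : ¬ x {suc N} N ≋ 0p
  x≢0 = mono≢0 _

run : ℕ → ℕ → List ℕ
run s zero    = []
run s (suc b) = s ∷ run (suc s) b

-- consecutive increasing runs of lengths bs, the last run starting at s
runs : ℕ → List ℕ → List ℕ
runs s []       = []
runs s (b ∷ bs) = runs (s ℕ.+ b) bs ++ run s b

run-snoc : ∀ s b → run s (suc b) ≡ run s b ++ (s ℕ.+ b) ∷ []
run-snoc s zero    = cong (_∷ []) (sym (ℕₚ.+-identityʳ s))
run-snoc s (suc b) = cong (s ∷_) (trans (run-snoc (suc s) b) (cong (λ k → run (suc s) b ++ k ∷ []) (sym (ℕₚ.+-suc s b))))

run-≥ : ∀ s b → All (s ≤_) (run s b)
run-≥ s zero    = []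
run-≥ s (suc b) = ℕₚ.≤-refl ∷ All.map (ℕₚ.≤-trans (ℕₚ.n≤1+n s)) (run-≥ (suc s) b)

runs-≥ : ∀ s bs → All (s ≤_) (runs s bs)
runs-≥ s [] = []
runs-≥ s (b ∷ bs) = Allₚ.++⁺ (All.map (ℕₚ.≤-trans (ℕₚ.m≤m+n s b)) (runs-≥ (s ℕ.+ b) bs)) (run-≥ s b)

run-! : ∀ s b {k} → k < b → run s b ! k ≡ s ℕ.+ k
run-! s (suc b) {zero} lt = sym (ℕₚ.+-identityʳ s)
run-! s (suc b) {suc k} (s≤s lt) = trans (run-! (suc s) b lt) (sym (ℕₚ.+-suc s k))

length-run : ∀ s b → length (run s b) ≡ b
length-run s zero    = refl
length-run s (suc b) = cong suc (length-run (suc s) b)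

-- Rank words of partitions

module _ {n : ℕ} where
  -- For the exponents 0, 1, ..., n - 1 both eigenvectors are symmetric, so each serves as the
  -- multiplier of the other.
  run-one-dimensional : ∀ b → OneDimensional {n} (run 0 b)
  run-one-dimensional b len f g hf hg = g , f , minimal⇒symmetric hg minimal , minimal⇒symmetric hf minimal , ⊗-comm g f , id
    where
    minimal : ∀ k → k < n → exps (run 0 b) k ≡ (0 , k)
    minimal k lt = cong (0 ,_) (run-! 0 b (subst (k <_) (trans (sym len) (length-run 0 b)) lt))

-- Rotating the last letter c of the last run to the front and moving it right past all letters
-- but the preceding run, which starts with c + 1, shifts one letter from the last run to that run.
runs-one-dimensional : ∀ {n} b bs → All (1 ≤_) bs → OneDimensional {n} (runs 0 (b ∷ bs))
runs-one-dimensional {zero} b bs _ len f g _ _ = g , f , (λ _ ()) , (λ _ ()) , ⊗-comm g f , id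
runs-one-dimensional {suc N} b [] _ = run-one-dimensional b
runs-one-dimensional {suc N} b₁ (b₂ ∷ bs) (b₂≥ ∷ bs≥) = merge b₁ b₂ b₂≥
  where
  -- Induction on the length b₁ of the last run. Once empty it disappears, and the run before it
  -- takes its place.
  merge : ∀ b₁ b₂ → 1 ≤ b₂ → OneDimensional {suc N} (runs 0 (b₁ ∷ b₂ ∷ bs))
  merge zero b₂ b₂≥ = subst OneDimensional (sym (Lₚ.++-identityʳ (runs 0 (b₂ ∷ bs)))) (runs-one-dimensional b₂ bs bs≥)
  merge (suc c) b₂ b₂≥ = subst OneDimensional shape
    (rotate-transfer (A ++ R ++ S) c (bubble A [] c (R ++ S) A≥ (subst OneDimensional shape′ (merge c (suc b₂) (s≤s z≤n)))))
    where
    A = runs (suc c ℕ.+ b₂) bs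
    R = run (suc c) b₂
    S = run 0 c
    -- The run R is not empty, so it takes up the letter c + 1, and the runs in front of it have
    -- letters from c + 2 on.
    A≥ : All (suc (suc c) ≤_) A
    A≥ = All.map (ℕₚ.≤-trans (ℕₚ.≤-trans (ℕₚ.≤-reflexive (cong suc (ℕₚ.+-comm 1 c))) (ℕₚ.+-monoʳ-≤ (suc c) b₂≥))) (runs-≥ (suc c ℕ.+ b₂) bs)
    shape′ : (runs (c ℕ.+ suc b₂) bs ++ c ∷ R) ++ S ≡ A ++ c ∷ R ++ S
    shape′ = trans (cong (λ k → (runs k bs ++ c ∷ R) ++ S) (ℕₚ.+-suc c b₂)) (Lₚ.++-assoc A (c ∷ R) S)
    shape : (A ++ R ++ S) ++ c ∷ [] ≡ (A ++ R) ++ run 0 (suc c)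
    shape = trans (cong (_++ c ∷ []) (sym (Lₚ.++-assoc A R S))) (trans (Lₚ.++-assoc (A ++ R) S (c ∷ [])) (cong ((A ++ R) ++_) (sym (run-snoc 0 c))))

runs-snoc : ∀ s bs b → runs s (bs ++ b ∷ []) ≡ run (s ℕ.+ sum bs) b ++ runs s bs
runs-snoc s [] b = trans (cong (λ k → [] ++ run k b) (sym (ℕₚ.+-identityʳ s))) (sym (Lₚ.++-identityʳ _))
runs-snoc s (c ∷ bs) b = trans (cong (_++ run s c) (runs-snoc (s ℕ.+ c) bs b))
  (trans (Lₚ.++-assoc (run (s ℕ.+ c ℕ.+ sum bs) b) _ _) (cong (λ k → run k b ++ runs (s ℕ.+ c) bs ++ run s c) (ℕₚ.+-assoc s c (sum bs))))

data Blocks : List ℕ → Set where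
  []    : Blocks []
  block : ∀ y b {v} → All (_< y) v → Blocks v → Blocks (L.replicate (suc b) y ++ v)

blocks : ∀ {u} → AllPairs (λ y z → z ≤ y) u → Blocks u
blocks [] = []
blocks {y ∷ u} (u≤y ∷ pu) = extend u≤y pu (blocks pu)
  where
  extend : ∀ {u} → All (_≤ y) u → AllPairs (λ y z → z ≤ y) u → Blocks u → Blocks (y ∷ u)
  extend [] _ _ = block y 0 [] []
  extend {z ∷ u} (z≤y ∷ _) (pz ∷ _) B with ℕₚ.m≤n⇒m<n∨m≡n z≤y
  ... | inj₁ z<y = block y 0 (z<y ∷ All.map (λ w≤z → ℕₚ.≤-<-trans w≤z z<y) pz) B
  extend {z ∷ u} _ _ (block .z b v< B) | inj₂ refl = block z (suc b) v< B

length-replicate : ∀ b {y : ℕ} v → length (L.replicate b y ++ v) ≡ b ℕ.+ length v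
length-replicate zero    v = refl
length-replicate (suc b) v = cong suc (length-replicate b v)

replicate-! : ∀ b {y v k} → k < b → (L.replicate b y ++ v) ! k ≡ y
replicate-! (suc b) {k = zero} lt = refl
replicate-! (suc b) {k = suc k} (s≤s lt) = replicate-! b lt

++-!ʳ : ∀ A {v} k → (A ++ v) ! (length A ℕ.+ k) ≡ v ! k
++-!ʳ []      k = refl
++-!ʳ (x ∷ A) k = ++-!ʳ A k

All-! : ∀ {P : ℕ → Set} {u} → All P u → ∀ {k} → k < length u → P (u ! k)
All-! (p ∷ ps) {zero} lt = p
All-! (p ∷ ps) {suc k} (s≤s lt) = All-! ps lt

count<-all : ∀ {y v} → All (_< y) v → count< y v ≡ length v
count<-all [] = refl
count<-all (p ∷ ps) rewrite <ᵇ-true p = cong suc (count<-all ps)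

κ-block-head : ∀ {y v} → All (_< y) v → ∀ b {k} → k < b → κ (L.replicate b y ++ v) k ≡ length v ℕ.+ k
κ-block-head {y} {v} v< (suc b) {zero} lt = trans (go b) (sym (ℕₚ.+-identityʳ _))
  where
  go : ∀ b → count< y (L.replicate b y ++ v) ≡ length v
  go zero = count<-all v<
  go (suc b) rewrite <ᵇ-false (ℕₚ.≤-refl {y}) = go b
κ-block-head {y} {v} v< (suc b) {suc k} (s≤s lt) rewrite replicate-! b {y} {v} lt | ≤ᵇ-true (ℕₚ.≤-refl {y}) =
  trans (cong (ℕ._+ 1) (κ-block-head v< b lt)) (trans (ℕₚ.+-assoc (length v) k 1) (cong (length v ℕ.+_) (ℕₚ.+-comm k 1)))

replicate-!ʳ : ∀ b {y v} k → (L.replicate b y ++ v) ! (b ℕ.+ k) ≡ v ! k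
replicate-!ʳ zero    k = refl
replicate-!ʳ (suc b) k = replicate-!ʳ b k

κ-block-tail : ∀ {y v} → All (_< y) v → ∀ b {k} → k < length v → κ (L.replicate b y ++ v) (b ℕ.+ k) ≡ κ v k
κ-block-tail v< zero lt = refl
κ-block-tail {y} {v} v< (suc b) {k} lt rewrite replicate-!ʳ b {y} {v} k | ≤ᵇ-false (All-! v< lt) =
  trans (ℕₚ.+-identityʳ _) (κ-block-tail v< b lt)

++-!ˡ : ∀ A {v k} → k < length A → (A ++ v) ! k ≡ A ! k
++-!ˡ (x ∷ A) {k = zero} lt = refl
++-!ˡ (x ∷ A) {k = suc k} (s≤s lt) = ++-!ˡ A lt

-- In a block followed only by smaller letters v the ranks are length v, length v + 1, ..., so each
-- block of equal parts becomes one run. A block in front is appended to bs at the end, since `runs`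
-- lists the last run first.
κ-runs : ∀ {u} → Blocks u → ∃ λ bs → All (1 ≤_) bs × sum bs ≡ length u × length (runs 0 bs) ≡ length u ×
         (∀ k → k < length u → κ u k ≡ runs 0 bs ! k)
κ-runs [] = [] , [] , refl , refl , λ k ()
κ-runs (block y b {v} v< B) with κ-runs B
... | bs , bs≥ , sum≡ , len≡ , κ≡ = bs ++ suc b ∷ [] , Allₚ.++⁺ bs≥ (s≤s z≤n ∷ []) , sum′ , len′ , κ′
  where
  u = L.replicate (suc b) y ++ v
  shape : runs 0 (bs ++ suc b ∷ []) ≡ run (length v) (suc b) ++ runs 0 bs
  shape = trans (runs-snoc 0 bs (suc b)) (cong (λ s → run s (suc b) ++ runs 0 bs) sum≡)
  sum′ : sum (bs ++ suc b ∷ []) ≡ length u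
  sum′ = trans (sum-++ bs _) (trans (ℕₚ.+-comm (sum bs) _) (trans (cong₂ ℕ._+_ (ℕₚ.+-identityʳ (suc b)) sum≡) (sym (length-replicate (suc b) v))))
  len′ : length (runs 0 (bs ++ suc b ∷ [])) ≡ length u
  len′ = trans (cong length shape) (trans (Lₚ.length-++ (run (length v) (suc b)))
    (trans (cong₂ ℕ._+_ (length-run (length v) (suc b)) len≡) (sym (length-replicate (suc b) v))))
  κ′ : ∀ k → k < length u → κ u k ≡ runs 0 (bs ++ suc b ∷ []) ! k
  κ′ k lt with k ℕ.<? suc b
  ... | yes k< = trans (κ-block-head v< (suc b) k<) (trans (sym (run-! (length v) (suc b) k<))
      (trans (sym (++-!ˡ (run (length v) (suc b)) (subst (k <_) (sym (length-run (length v) (suc b))) k<))) (cong (_! k) (sym shape))))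
  ... | no k≮ with ℕₚ.m≤n⇒∃[o]m+o≡n (ℕₚ.≮⇒≥ k≮)
  ...   | k' , refl = trans (κ-block-tail v< (suc b) k'<) (trans (κ≡ k' k'<) (trans (sym (++-!ʳ (run (length v) (suc b)) k'))
      (trans (cong (λ m → (run (length v) (suc b) ++ runs 0 bs) ! (m ℕ.+ k')) (length-run (length v) (suc b))) (cong (_! (suc b ℕ.+ k')) (sym shape)))))
    where
    k'< : k' < length v
    k'< = ℕₚ.+-cancelˡ-< (suc b) k' (length v) (subst (suc b ℕ.+ k' <_) (length-replicate (suc b) v) lt)

partition⇒AllPairs : ∀ {n} (v : Vec ℕ n) → IsPartition v → AllPairs (λ y z → z ≤ y) (toList v)
partition⇒AllPairs [] _ = []
partition⇒AllPairs (y ∷ v) p = heads v (λ j → p fzero (fsuc j) z≤n) ∷ partition⇒AllPairs v (λ i j le → p (fsuc i) (fsuc j) (s≤s le))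
  where
  heads : ∀ {n} (v : Vec ℕ n) → (∀ j → lookup v j ≤ y) → All (_≤ y) (toList v)
  heads [] _ = []
  heads (z ∷ v) h = h fzero ∷ heads v (h ∘ fsuc)

-- The rank word of inc(λ, φ)

module _ (φ : ℕ → ℕ) (mono-φ : WeaklyOrderPreserving φ) where
  -- Relation of a letter y to a letter z further right. Under it φ alters no comparison that enters
  -- κ: letters merged by φ stand in increasing order, and κ ranks equal letters from left to right.
  SameOrder : ℕ → ℕ → Set
  SameOrder y z = φ z ≤ φ y × (φ y ≡ φ z → y ≤ z)

  SameOrder-trans : ∀ {x y z} → SameOrder x y → SameOrder y z → SameOrder x z
  SameOrder-trans (p , f) (q , g) = ℕₚ.≤-trans q p , λ e → let e′ = ℕₚ.≤-antisym (ℕₚ.≤-trans (ℕₚ.≤-reflexive e) q) p in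
    ℕₚ.≤-trans (f e′) (g (trans (sym e′) e))

  bit-<-φ : ∀ {y z} → SameOrder y z → bit (φ z <ᵇ φ y) ≡ bit (z <ᵇ y)
  bit-<-φ {y} {z} (p , f) with z ℕ.<? y
  ... | no z≮y rewrite <ᵇ-false (ℕₚ.≮⇒≥ z≮y) | <ᵇ-false (mono-φ y z (ℕₚ.≮⇒≥ z≮y)) = refl
  ... | yes z<y rewrite <ᵇ-true z<y | <ᵇ-true (ℕₚ.≤∧≢⇒< p (λ e → ℕₚ.<-irrefl refl (ℕₚ.<-≤-trans z<y (f (sym e))))) = refl

  bit-≤-φ : ∀ {y z} → SameOrder y z → bit (φ y ≤ᵇ φ z) ≡ bit (y ≤ᵇ z)
  bit-≤-φ {y} {z} (p , f) with y ℕ.≤? z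
  ... | yes y≤z rewrite ≤ᵇ-true y≤z | ≤ᵇ-true (mono-φ y z y≤z) = refl
  ... | no y≰z rewrite ≤ᵇ-false (ℕₚ.≰⇒> y≰z) | ≤ᵇ-false (ℕₚ.≤∧≢⇒< p (λ e → y≰z (f (sym e)))) = refl

  map-! : ∀ u {k} → k < length u → L.map φ u ! k ≡ φ (u ! k)
  map-! (x ∷ u) {zero} lt = refl
  map-! (x ∷ u) {suc k} (s≤s lt) = map-! u lt

  κ-map : ∀ {u} → AllPairs SameOrder u → ∀ {k} → k < length u → κ (L.map φ u) k ≡ κ u k
  κ-map {y ∷ u} (p ∷ ps) {zero} lt = go p
    where
    go : ∀ {u} → All (SameOrder y) u → count< (φ y) (L.map φ u) ≡ count< y u
    go [] = refl
    go (q ∷ qs) = cong₂ ℕ._+_ (bit-<-φ q) (go qs)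
  κ-map {y ∷ u} (p ∷ ps) {suc k} (s≤s lt) rewrite map-! u lt = cong₂ ℕ._+_ (κ-map ps lt) (bit-≤-φ (All-! p lt))

  -- Minimality is compared with adjacent swaps: inside a block of constant φ-value a swap leaves
  -- the image unchanged, so it may not make the word lexicographically smaller.
  swap-minimal⇒Linked : ∀ {n} (v : Vec ℕ n) → IsPartition (V.map φ v) →
    (∀ i → V.map φ (swapAt i v) ≡ V.map φ v → LexLeq v (swapAt i v)) → Linked SameOrder (toList v)
  swap-minimal⇒Linked [] _ _ = []
  swap-minimal⇒Linked (y ∷ []) _ _ = [-]
  swap-minimal⇒Linked (y ∷ z ∷ v) part least = (part fzero (fsuc fzero) z≤n , λ e → first (least 0 (cong₂ (λ a b → a ∷ b ∷ V.map φ v) (sym e) e)))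
      ∷ swap-minimal⇒Linked (z ∷ v) (λ i j le → part (fsuc i) (fsuc j) (s≤s le)) (λ i e → next (least (suc i) (cong (φ y ∷_) e)))
    where
    first : LexLeq (y ∷ z ∷ v) (z ∷ y ∷ v) → y ≤ z
    first (inj₁ lt)      = ℕₚ.<⇒≤ lt
    first (inj₂ (e , _)) = ℕₚ.≤-reflexive e
    next : ∀ {n} {v w : Vec ℕ n} → LexLeq (y ∷ v) (y ∷ w) → LexLeq v w
    next (inj₁ lt)      = ⊥-elim (ℕₚ.<-irrefl refl lt)
    next (inj₂ (_ , l)) = l

  swapAt-↭ : ∀ {n} i (v : Vec ℕ n) → toList (swapAt i v) ↭ toList v
  swapAt-↭ zero [] = ↭-refl
  swapAt-↭ (suc i) [] = ↭-refl
  swapAt-↭ zero (y ∷ []) = ↭-refl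
  swapAt-↭ zero (y ∷ z ∷ v) = swap z y ↭-refl
  swapAt-↭ (suc i) (y ∷ v) = prep y (swapAt-↭ i v)

  κ-inc : ∀ {n} (λ' μ ζ : Vec ℕ n) → IsPartition μ → IsInc λ' φ μ ζ → ∀ {k} → k < n → κ (toList μ) k ≡ κ (toList ζ) k
  κ-inc {n} λ' μ ζ part (ζ∈ , refl , least) {k} lt = trans (cong (λ u → κ u k) (Vₚ.toList-map φ ζ))
    (κ-map (Linked⇒AllPairs SameOrder-trans (swap-minimal⇒Linked ζ part (λ i e → least (swapAt i ζ) (↭-trans (swapAt-↭ i ζ) ζ∈) e)))
           (subst (k <_) (sym (Vₚ.length-toList ζ)) lt))

-- The exponents of t in the eigenvalues y_i

foldr-tabulate : ∀ {m k} (g : Fin m → Fin k) (P : Fin k → Bool) →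
  L.foldr (λ j acc → if P j then suc acc else acc) 0 (L.tabulate g) ≡ countFin (P ∘ g)
foldr-tabulate {zero} g P = refl
foldr-tabulate {suc m} g P = cong (λ acc → if P (g fzero) then suc acc else acc)
  (trans (foldr-tabulate (g ∘ fsuc) P) (sym (foldr-tabulate fsuc (P ∘ g))))

countFin-suc : ∀ {n} (P : Fin (suc n) → Bool) → countFin P ≡ bit (P fzero) ℕ.+ countFin (P ∘ fsuc)
countFin-suc {n} P with P fzero
... | true  = cong suc (foldr-tabulate fsuc P)
... | false = foldr-tabulate fsuc P

countFin-false : ∀ n → countFin {n} (λ _ → false) ≡ 0
countFin-false zero    = refl
countFin-false (suc n) = trans (countFin-suc {n} (λ _ → false)) (countFin-false n)

lookup-! : ∀ {n} (v : Vec ℕ n) i → toList v ! toℕ i ≡ lookup v i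
lookup-! (y ∷ v) fzero    = refl
lookup-! (y ∷ v) (fsuc i) = lookup-! v i

bit-complement : ∀ y z → bit (y ≤ᵇ z) ℕ.+ bit (z <ᵇ y) ≡ 1
bit-complement y z with y ℕ.≤? z
... | yes y≤z rewrite ≤ᵇ-true y≤z | <ᵇ-false y≤z = refl
... | no y≰z rewrite ≤ᵇ-false (ℕₚ.≰⇒> y≰z) | <ᵇ-true (ℕₚ.≰⇒> y≰z) = refl

laterᵇ earlierᵇ : ∀ {n} → Vec ℕ n → Fin n → Fin n → Bool
laterᵇ η i j = (toℕ i <ᵇ toℕ j) ∧ (lookup η i ≤ᵇ lookup η j)
earlierᵇ η i j = (toℕ j <ᵇ toℕ i) ∧ (lookup η i <ᵇ lookup η j)

t-exponent : ∀ {n} → Vec ℕ n → Fin n → ℕ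
t-exponent η i = countFin (laterᵇ η i) ℕ.+ countFin (earlierᵇ η i)

count-complement : ∀ {n} y (v : Vec ℕ n) → countFin (λ j → y ≤ᵇ lookup v j) ℕ.+ count< y (toList v) ≡ n
count-complement y [] = refl
count-complement {suc n} y (z ∷ v) = begin
  countFin (λ j → y ≤ᵇ lookup (z ∷ v) j) ℕ.+ (bit (z <ᵇ y) ℕ.+ count< y (toList v))
    ≡⟨ cong (ℕ._+ (bit (z <ᵇ y) ℕ.+ count< y (toList v))) (countFin-suc {n} (λ j → y ≤ᵇ lookup (z ∷ v) j)) ⟩
  (bit (y ≤ᵇ z) ℕ.+ later) ℕ.+ (bit (z <ᵇ y) ℕ.+ count< y (toList v))
    ≡⟨ interchange (bit (y ≤ᵇ z)) later (bit (z <ᵇ y)) (count< y (toList v)) ⟩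
  (bit (y ≤ᵇ z) ℕ.+ bit (z <ᵇ y)) ℕ.+ (later ℕ.+ count< y (toList v)) ≡⟨ cong₂ ℕ._+_ (bit-complement y z) (count-complement y v) ⟩
  suc n ∎
  where
  open ≡-Reasoning
  later = countFin (λ j → y ≤ᵇ lookup v j)
  open ℕSolver.+-*-Solver using () renaming (solve to solveℕ; _:+_ to _⊹_; _:=_ to _⩴_)
  interchange : ∀ a b c d → (a ℕ.+ b) ℕ.+ (c ℕ.+ d) ≡ (a ℕ.+ c) ℕ.+ (b ℕ.+ d)
  interchange = solveℕ 4 (λ a b c d → (a ⊹ b) ⊹ (c ⊹ d) ⩴ (a ⊹ c) ⊹ (b ⊹ d)) refl

-- Each of the n - 1 other positions is counted exactly once, either by the exponent of t⁻¹ in y_i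
-- or by κ, because the two conditions are complementary.
t-exponent+κ : ∀ {n} (η : Vec ℕ n) i → suc (t-exponent η i ℕ.+ κ (toList η) (toℕ i)) ≡ n
t-exponent+κ {suc n} (y ∷ v) fzero = cong suc (trans (cong (ℕ._+ count< y (toList v))
    (trans (cong₂ ℕ._+_ (countFin-suc (laterᵇ (y ∷ v) fzero)) (trans (countFin-suc (earlierᵇ (y ∷ v) fzero)) (countFin-false n)))
           (ℕₚ.+-identityʳ _)))
  (count-complement y v))
t-exponent+κ {suc n} (y ∷ v) (fsuc i) = cong suc (begin
  t-exponent (y ∷ v) (fsuc i) ℕ.+ (κ (toList v) (toℕ i) ℕ.+ bit (y ≤ᵇ toList v ! toℕ i))
    ≡⟨ cong₂ (λ p q → p ℕ.+ (κ (toList v) (toℕ i) ℕ.+ bit (y ≤ᵇ q)))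
             (cong₂ ℕ._+_ (countFin-suc (laterᵇ (y ∷ v) (fsuc i))) (countFin-suc (earlierᵇ (y ∷ v) (fsuc i)))) (lookup-! v i) ⟩
  (p ℕ.+ (bit (lookup v i <ᵇ y) ℕ.+ q)) ℕ.+ (κ (toList v) (toℕ i) ℕ.+ bit (y ≤ᵇ lookup v i))
    ≡⟨ shuffle p (bit (lookup v i <ᵇ y)) q (κ (toList v) (toℕ i)) (bit (y ≤ᵇ lookup v i)) ⟩
  (bit (y ≤ᵇ lookup v i) ℕ.+ bit (lookup v i <ᵇ y)) ℕ.+ ((p ℕ.+ q) ℕ.+ κ (toList v) (toℕ i))
    ≡⟨ cong (ℕ._+ ((p ℕ.+ q) ℕ.+ κ (toList v) (toℕ i))) (bit-complement y (lookup v i)) ⟩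
  suc (t-exponent v i ℕ.+ κ (toList v) (toℕ i))
    ≡⟨ t-exponent+κ v i ⟩
  n ∎)
  where
  open ≡-Reasoning
  p = countFin (laterᵇ v i)
  q = countFin (earlierᵇ v i)
  open ℕSolver.+-*-Solver using () renaming (solve to solveℕ; _:+_ to _⊹_; _:=_ to _⩴_)
  shuffle : ∀ p a q k b → (p ℕ.+ (a ℕ.+ q)) ℕ.+ (k ℕ.+ b) ≡ (b ℕ.+ a) ℕ.+ ((p ℕ.+ q) ℕ.+ k)
  shuffle = solveℕ 5 (λ p a q k b → (p ⊹ (a ⊹ q)) ⊹ (k ⊹ b) ⩴ (b ⊹ a) ⊹ ((p ⊹ q) ⊹ k)) refl

-- Passage to fractions

ωMon-rotMon : ∀ {n} c (m : Mon n) → ωMon (c , m) ≡ (c , rotMon 1 m)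
ωMon-rotMon c (a , b , [])    = refl
ωMon-rotMon c (a , b , h ∷ w) = cong (λ e → c , a ℕ.+ e , b , w V.∷ʳ h) (sym (ℕₚ.*-identityˡ h))

opaque
  unfolding s
  mulP≋ : ∀ {n} (p r : Poly n) → mulP p r ≋ p ⊗ r
  mulP≋ p r = mk≋ λ F → refl
  subP≋ : ∀ {n} (p r : Poly n) → subP p r ≋ p ⊖′ r
  subP≋ p r = mk≋ λ F → refl
  oneP≋ : ∀ {n} → oneP {n} ≋ 1p
  oneP≋ = mk≋ λ F → refl
  zeroP≋ : ∀ {n} → zeroP {n} ≋ 0p
  zeroP≋ = mk≋ λ F → refl
  sP≋ : ∀ {n} j (p : Poly n) → sP (suc j) p ≋ s j p
  sP≋ j p = mk≋ λ F → trans (pair-map _ (swapMon j) (λ _ _ → refl) p F) (sym (pair-s j p F))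
  ωP≋ : ∀ {n} (p : Poly n) → ωP p ≋ ω 1 p
  ωP≋ p = mk≋ λ F → trans (pair-map ωMon (rotMon 1) ωMon-rotMon p F) (sym (pair-ω 1 p F))
  specP≋ : ∀ {n} (p : Poly n) → specP p ≋ spec p
  specP≋ p = mk≋ λ F → trans (pair-map _ specMon (λ _ _ → refl) p F) (sym (pair-spec p F))
  xP≋ : ∀ {n} j → xP {n} (suc j) ≋ x j
  xP≋ j = mk≋ λ F → refl
  tPow≋ : ∀ {n} k → tPow {n} k ≋ sc 0 k
  tPow≋ k = mk≋ λ F → refl
  qPow≋ : ∀ {n} k → qPow {n} k ≋ sc k 0
  qPow≋ k = mk≋ λ F → refl
  xfree-ι : ∀ {n} c → XFree {n} (ι c)
  xfree-ι [] = []
  xfree-ι (_ ∷ c) = refl ∷ xfree-ι c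

xfree⇒ι : ∀ {n} {D : Poly n} → XFree D → ∃ λ d → D ≋ ι d
xfree⇒ι {n} {D} free = mapMon strip D , mk≋ λ F → sym (trans (pair-ι (mapMon strip D) F) (trans (pair-mapMon strip D _)
    (pair-cong-All D (All.map (λ { refl → refl }) free))))
  where
  strip : Mon n → Mon 0
  strip (a , b , _) = a , b , []

xCoeff-cl : ∀ {n} (p : Poly n) ζ → xCoeff p ζ ≋ ι (cl (toList ζ) p)
xCoeff-cl p ζ = mk≋ λ F → trans (go F p) (sym (trans (pair-ι (cl (toList ζ) p) F) (pair-cl (toList ζ) p _)))
  where
  go : ∀ F p → pair (xCoeff p ζ) F ≡ pair p (select (toList ζ) (F ∘ embedMon))
  go F [] = refl
  go F ((c , a , b , v) ∷ p) with vecEqᵇ v ζ in e | toList v ≟ˡ toList ζ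
  ... | true  | yes _ = cong (c Q.* F (a , b , zeros) Q.+_) (go F p)
  ... | true  | no ne = ⊥-elim (ne (cong toList (vecEqᵇ-sound v ζ e)))
  ... | false | no _  = trans (go F p) (trans (sym (Qₚ.+-identityˡ _)) (cong (Q._+ pair p (select (toList ζ) (F ∘ embedMon))) (sym (Qₚ.*-zeroʳ c))))
  ... | false | yes v≡ with trans (sym e) (trans (cong (vecEqᵇ v) (sym (toList-injective {n = 0} v≡))) (vecEqᵇ-refl v))
  ...   | ()

-- The fraction equals P / D. Operators on fractions pile up denominators that involve x; dividing
-- these out leaves a polynomial operator on P, and the D in use stay free of x.
Represents : ∀ {n} → Frac n → Poly n → Poly n → Set
Represents (a , b) P D = a ⊗ D ≋ P ⊗ b × ¬ b ≋ 0p

module _ {n : ℕ} where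
  open ≋-Reasoning {n}

  ≋0-resp : ∀ {p r : Poly n} → p ≋ r → ¬ r ≋ 0p → ¬ p ≋ 0p
  ≋0-resp e ne p0 = ne (≋-trans (≋-sym e) p0)

  represents-cong : ∀ {f P P' D D'} → P ≋ P' → D ≋ D' → Represents {n} f P D → Represents f P' D'
  represents-cong p d (e , ne) = ≋-trans (⊗-congˡ (≋-sym d)) (≋-trans e (⊗-congʳ p)) , ne

  represents-s : ∀ {f P D} j → s j D ≋ D → Represents f P D → Represents {n} (sF (suc j) f) (s j P) D
  represents-s {a , b} {P} {D} j inv (e , ne) =
      (begin
        sP (suc j) a ⊗ D ≈⟨ ⊗-cong (sP≋ j a) (≋-sym inv) ⟩
        s j a ⊗ s j D ≈⟨ s-⊗ j a D ⟨
        s j (a ⊗ D) ≈⟨ s-cong j e ⟩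
        s j (P ⊗ b) ≈⟨ s-⊗ j P b ⟩
        s j P ⊗ s j b ≈⟨ ⊗-congˡ (sP≋ j b) ⟨
        s j P ⊗ sP (suc j) b ∎)
    , λ z → ne (≋-trans (≋-sym (s-involutive j b)) (≋-trans (s-cong j (≋-trans (≋-sym (sP≋ j b)) z)) (0-homo (s-hom j))))

  represents-sub : ∀ {f g P R D} → Represents f P D → Represents g R D → Represents {n} (subF f g) (P ⊖′ R) D
  represents-sub {a , b} {a' , b'} {P} {R} {D} (e , ne) (e' , ne') =
      (begin
        subP (mulP a b') (mulP a' b) ⊗ D ≈⟨ ⊗-congʳ (≋-trans (subP≋ _ _) (⊖-cong (mulP≋ a b') (mulP≋ a' b))) ⟩
        (a ⊗ b' ⊖′ a' ⊗ b) ⊗ D ≈⟨ solve 5 (λ a b a' b' d → (a :* b' :- a' :* b) :* d := (a :* d) :* b' :- (a' :* d) :* b) ≋-refl a b a' b' D ⟩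
        (a ⊗ D) ⊗ b' ⊖′ (a' ⊗ D) ⊗ b ≈⟨ ⊖-cong (⊗-congʳ e) (⊗-congʳ e') ⟩
        (P ⊗ b) ⊗ b' ⊖′ (R ⊗ b') ⊗ b ≈⟨ solve 4 (λ p b r b' → (p :* b) :* b' :- (r :* b') :* b := (p :- r) :* (b :* b')) ≋-refl P b R b' ⟩
        (P ⊖′ R) ⊗ (b ⊗ b') ≈⟨ ⊗-congˡ (mulP≋ b b') ⟨
        (P ⊖′ R) ⊗ mulP b b' ∎)
    , ≋0-resp (mulP≋ b b') (⊗-≢0 ne ne')

  represents-mul : ∀ {f P R D} u v → ¬ v ≋ 0p → u ⊗ P ≋ v ⊗ R → Represents f P D → Represents {n} (mulF (u , v) f) R D
  represents-mul {a , b} {P} {R} {D} u v v≢0 uv (e , ne) =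
      (begin
        mulP u a ⊗ D ≈⟨ ≋-trans (⊗-congʳ (mulP≋ u a)) (⊗-assoc u a D) ⟩
        u ⊗ (a ⊗ D) ≈⟨ ⊗-congˡ e ⟩
        u ⊗ (P ⊗ b) ≈⟨ ⊗-assoc u P b ⟨
        (u ⊗ P) ⊗ b ≈⟨ ⊗-congʳ uv ⟩
        (v ⊗ R) ⊗ b ≈⟨ solve 3 (λ v r b → (v :* r) :* b := r :* (v :* b)) ≋-refl v R b ⟩
        R ⊗ (v ⊗ b) ≈⟨ ⊗-congˡ (mulP≋ v b) ⟨
        R ⊗ mulP v b ∎)
    , ≋0-resp (mulP≋ v b) (⊗-≢0 v≢0 ne)

  represents-div : ∀ {f P D} k → Represents f P D → Represents {n} (mulF (oneP , tPow k) f) P (sc 0 k ⊗ D)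
  represents-div {a , b} {P} {D} k (e , ne) =
      (begin
        mulP oneP a ⊗ (sc 0 k ⊗ D) ≈⟨ ⊗-congʳ (≋-trans (mulP≋ oneP a) (≋-trans (⊗-congʳ oneP≋) (⊗-identityˡ a))) ⟩
        a ⊗ (sc 0 k ⊗ D) ≈⟨ solve 3 (λ a t d → a :* (t :* d) := t :* (a :* d)) ≋-refl a (sc 0 k) D ⟩
        sc 0 k ⊗ (a ⊗ D) ≈⟨ ⊗-congˡ e ⟩
        sc 0 k ⊗ (P ⊗ b) ≈⟨ solve 3 (λ t p b → t :* (p :* b) := p :* (t :* b)) ≋-refl (sc 0 k) P b ⟩
        P ⊗ (sc 0 k ⊗ b) ≈⟨ ⊗-congˡ (≋-trans (mulP≋ (tPow k) b) (⊗-congʳ (tPow≋ k))) ⟨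
        P ⊗ mulP (tPow k) b ∎)
    , ≋0-resp (≋-trans (mulP≋ (tPow k) b) (⊗-congʳ (tPow≋ k))) (⊗-≢0 (mono≢0 (0 , k , zeros)) ne)

  represents-ω : ∀ {f P D} → ω 1 D ≋ D → Represents f P D → Represents {n} (ωF f) (ω 1 P) D
  represents-ω {a , b} {P} {D} inv (e , ne) =
      (begin
        ωP a ⊗ D ≈⟨ ⊗-cong (ωP≋ a) (≋-sym inv) ⟩
        ω 1 a ⊗ ω 1 D ≈⟨ ω-⊗ 1 a D ⟨
        ω 1 (a ⊗ D) ≈⟨ ω-cong 1 e ⟩
        ω 1 (P ⊗ b) ≈⟨ ω-⊗ 1 P b ⟩
        ω 1 P ⊗ ω 1 b ≈⟨ ⊗-congˡ (ωP≋ b) ⟨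
        ω 1 P ⊗ ωP b ∎)
    , λ z → ne (ω-injective 1 (≋-trans (≋-sym (ωP≋ b)) z))

  represents-L : ∀ {f P D} j → suc j < n → s j D ≋ D → Represents f P D → Represents {n} (LF (suc j) f) (c j ⊗ ∂ j P) D
  represents-L {f} {P} {D} j lt inv r = represents-mul _ _ (≋0-resp den (d≢0 j lt))
    (begin
      subP (mulP tP (xP (suc j))) (xP (suc (suc j))) ⊗ (P ⊖′ s j P) ≈⟨ ⊗-cong num (≋-sym (∂-eq j P lt)) ⟩
      c j ⊗ (d j ⊗ ∂ j P) ≈⟨ solve 3 (λ c d p → c :* (d :* p) := d :* (c :* p)) ≋-refl (c j) (d j) (∂ j P) ⟩
      d j ⊗ (c j ⊗ ∂ j P) ≈⟨ ⊗-congʳ den ⟨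
      subP (xP (suc j)) (xP (suc (suc j))) ⊗ (c j ⊗ ∂ j P) ∎)
    (represents-sub r (represents-s j inv r))
    where
    den : subP (xP {n} (suc j)) (xP (suc (suc j))) ≋ d j
    den = ≋-trans (subP≋ _ _) (⊖-cong (xP≋ j) (xP≋ (suc j)))
    num : subP (mulP tP (xP {n} (suc j))) (xP (suc (suc j))) ≋ c j
    num = ≋-trans (subP≋ _ _) (⊖-cong (≋-trans (mulP≋ _ _) (⊗-cong (tPow≋ 1) (xP≋ j))) (xP≋ (suc j)))

  represents-T : ∀ {f P D} j → suc j < n → s j D ≋ D → Represents f P D → Represents {n} (TF (suc j) f) (T′ j P) D
  represents-T {f} {P} {D} j lt inv r = represents-sub
    (represents-mul tP oneP (≋0-resp oneP≋ 1p≢0) (≋-trans (⊗-congʳ (tPow≋ 1)) (≋-trans (≋-sym (⊗-identityˡ _)) (⊗-congʳ (≋-sym oneP≋)))) r)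
    (represents-L j lt inv r)

  represents-Tinv : ∀ {f P D} j → suc j < n → s j D ≋ D → Represents f P D → Represents {n} (TinvF (suc j) f) (τ j P) (t ⊗ D)
  represents-Tinv j lt inv r = represents-div 1 (represents-sub r (represents-L j lt inv r))

  represents-Tup : ∀ {f P D} k → k < n → Scalar 1 D → Represents f P D → Represents {n} (Tup k f) (up k P) D
  represents-Tup zero    lt S r = r
  represents-Tup (suc k) lt S r = represents-Tup k (ℕₚ.<⇒≤ lt) S (represents-T k lt (s-scalar S k lt) r)

  represents-TinvRange : ∀ {f P D} a m → a ℕ.+ m < n → Scalar 1 D → Represents f P D →
                         Represents {n} (TinvRange (suc a) m f) (down a m P) (sc 0 m ⊗ D)
  represents-TinvRange a zero lt S r = represents-cong ≋-refl (≋-sym (sc-00 _)) r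
  represents-TinvRange {D = D} a (suc m) lt S r = represents-cong ≋-refl
      (≋-trans (≋-sym (⊗-assoc _ _ D)) (⊗-congʳ (sc-⊗ 0 1 0 m)))
      (represents-Tinv a (head-< a lt) (s-scalar (scalar-⊗ 1 (scalar-sc 1 0 m) S) a (head-< a lt)) (represents-TinvRange (suc a) m (tail-< a lt) S r))

  -- The exponent n - 1 collects k from the prefactor of Y_{k+1} and one from each of its n - 1 - k
  -- factors T⁻¹.
  represents-Y : ∀ {f P D} k → k < n → Scalar 1 D → Represents f P D → Represents {n} (YF (suc k) f) (Z 1 k P) (sc 0 (n ∸ 1) ⊗ D)
  represents-Y {D = D} k lt S r = represents-cong ≋-refl
    (≋-trans (≋-sym (⊗-assoc _ _ D)) (⊗-congʳ (≋-trans (sc-⊗ 0 k 0 (n ∸ suc k)) (≋-reflexive (cong (sc 0) exponent)))))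
    (represents-div k (represents-TinvRange k (n ∸ suc k) (ℕₚ.≤-reflexive (suc[k+[n∸suc-k]]≡n lt)) S
      (represents-ω (ω-scalar S) (represents-Tup k lt S r))))
    where
    exponent : k ℕ.+ (n ∸ suc k) ≡ n ∸ 1
    exponent = cong (_∸ 1) (suc[k+[n∸suc-k]]≡n lt)

  scalar-cong : ∀ {ε} {a b : Poly n} → a ≋ b → Scalar ε a → Scalar ε b
  scalar-cong {ε} e S = record { s-scalar = λ j lt → ≋-trans (s-cong j (≋-sym e)) (≋-trans (s-scalar S j lt) e)
                               ; ω-scalar = ≋-trans (ω-cong ε (≋-sym e)) (≋-trans (ω-scalar S) e) }

  -- The power t^(n-1) gathered in `represents-Y` turns y_i(η) into q^(η_i) t^κ, by `t-exponent+κ`.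
  eigenvalue-equation : ∀ F η i P D → ¬ D ≋ 0p → Represents F (Z 1 (toℕ i) P) (sc 0 (n ∸ 1) ⊗ D) →
                        F ≈F mulF (yEig η i) (P , D) → Z 1 (toℕ i) P ≋ scp 1 (wt 1 (toList {n = n} η) (toℕ i)) ⊗ P
  eigenvalue-equation (a , b) η i P D ≢0 (rep , b≢0) e = ⊗-cancelˡ (⊗-≢0 (⊗-≢0 b≢0 (mono≢0 (0 , r , zeros))) ≢0) (begin
    ((b ⊗ R) ⊗ D) ⊗ Z 1 (toℕ i) P ≈⟨ solve 4 (λ b r d z → ((b :* r) :* d) :* z := (r :* d) :* (z :* b)) ≋-refl b R D (Z 1 (toℕ i) P) ⟩
    (R ⊗ D) ⊗ (Z 1 (toℕ i) P ⊗ b) ≈⟨ ⊗-congˡ rep ⟨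
    (R ⊗ D) ⊗ (a ⊗ (N ⊗ D)) ≈⟨ solve 4 (λ r d a n → (r :* d) :* (a :* (n :* d)) := (a :* (r :* d)) :* (n :* d)) ≋-refl R D a N ⟩
    (a ⊗ (R ⊗ D)) ⊗ (N ⊗ D) ≈⟨ ⊗-congʳ e′ ⟩
    ((q ⊗ P) ⊗ b) ⊗ (N ⊗ D) ≈⟨ ⊗-congˡ (⊗-congʳ N≋) ⟩
    ((q ⊗ P) ⊗ b) ⊗ ((R ⊗ K) ⊗ D)
      ≈⟨ solve 6 (λ q p b r k d → ((q :* p) :* b) :* ((r :* k) :* d) := ((b :* r) :* d) :* ((q :* k) :* p)) ≋-refl q P b R K D ⟩
    ((b ⊗ R) ⊗ D) ⊗ ((q ⊗ K) ⊗ P) ≈⟨ ⊗-congˡ (⊗-congʳ (≋-trans (sc-⊗ (lookup η i) 0 0 _) (≋-reflexive (cong (λ z → sc z (κ (toList η) (toℕ i)))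
                                                     (trans (ℕₚ.+-identityʳ _) (sym (trans (ℕₚ.*-identityˡ _) (lookup-! η i)))))))) ⟩
    ((b ⊗ R) ⊗ D) ⊗ (scp 1 (wt 1 (toList η) (toℕ i)) ⊗ P) ∎)
    where
    r = t-exponent η i
    q R N K : Poly n
    q = sc (lookup η i) 0
    R = sc 0 r
    N = sc 0 (n ∸ 1)
    K = sc 0 (κ (toList η) (toℕ i))
    N≋ : N ≋ R ⊗ K
    N≋ = ≋-sym (≋-trans (sc-⊗ 0 r 0 _) (≋-reflexive (cong (λ m → sc 0 (m ∸ 1)) (t-exponent+κ η i))))
    e′ : a ⊗ (R ⊗ D) ≋ (q ⊗ P) ⊗ b
    e′ = begin
      a ⊗ (R ⊗ D) ≈⟨ ⊗-congˡ (≋-trans (mulP≋ (tPow r) D) (⊗-congʳ (tPow≋ r))) ⟨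
      a ⊗ mulP (tPow r) D ≈⟨ mulP≋ a _ ⟨
      mulP a (mulP (tPow r) D) ≈⟨ ≈P⇒≋ e ⟩
      mulP (mulP (qPow (lookup η i)) P) b ≈⟨ mulP≋ _ b ⟩
      mulP (qPow (lookup η i)) P ⊗ b ≈⟨ ⊗-congʳ (≋-trans (mulP≋ _ P) (⊗-congʳ (qPow≋ (lookup η i)))) ⟩
      (q ⊗ P) ⊗ b ∎

  -- From `IsE` to eigenvectors, and on to q = 1

  xfree-scalar : ∀ {ε D} → XFree {n} D → Scalar ε D
  xfree-scalar {ε} free = let d , e = xfree⇒ι free in scalar-cong (≋-sym e) (scalar-ι ε d)

  IsE⇒weight : ∀ η P D → IsE {n} η (P , D) → HasWeight 1 P (wt 1 (toList η))
  IsE⇒weight η P D (free , D≢0 , _ , _ , eigen) k lt =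
    subst (λ k → Z 1 k P ≋ scp 1 (wt 1 (toList η) k) ⊗ P) (Fₚ.toℕ-fromℕ< lt)
      (eigenvalue-equation (YF (suc (toℕ i)) (P , D)) η i P D ≢0
        (represents-Y {P , D} {P} {D} (toℕ i) (Fₚ.toℕ<n i) (xfree-scalar free) (≋-refl , ≢0)) (eigen i))
    where
    i = fromℕ< lt
    ≢0 : ¬ D ≋ 0p
    ≢0 e = D≢0 (≋⇒≈P (≋-trans e (≋-sym zeroP≋)))

  IsE⇒leading : ∀ η P D d → IsE {n} η (P , D) → D ≋ ι d → cl (toList η) P ≋ d
  IsE⇒leading η P D d (_ , _ , _ , top , _) D≋ = ⊖≋0⇒≋ (ι-injective {n} (≋-trans (⊖-homo ι-hom _ _)
    (≋⇒⊖≋0 (≋-trans (≋-sym (xCoeff-cl P η)) (≋-trans (≈P⇒≋ top) D≋)))))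

  regular : ∀ η E → IsE {n} η E → ∃ λ R → RegularAt1 E R
  regular η (P , D) isE@(free , D≢0 , _) with xfree⇒ι free | existence {n} (toList η) (Vₚ.length-toList η)
  ... | d' , D≋ | E , hE , reg = (E , ι e) , xfree-ι e , ≋⇒≈P (≋-trans (mulP≋ P (ι e)) (≋-trans same (≋-sym (mulP≋ E D)))) , nonzero
    where
    -- E / e has leading coefficient 1 like E_η. Cross-multiplied, the difference of the two is an
    -- eigenvector without leading coefficient, so it is 0 by `uniqueness`; and e survives q = 1.
    e = cl (toList η) E
    h : Poly n
    h = ι e ⊗ P ⊖′ ι d' ⊗ E
    h0 : h ≋ 0p
    h0 = uniqueness h (toList η)
      (weight-⊖ 1 (weight-scalar 1 (scalar-ι 1 e) (IsE⇒weight η P D isE)) (weight-scalar 1 (scalar-ι 1 d') hE))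
      (Vₚ.length-toList η)
      (≋-trans (cl-⊖ _ _ _) (≋⇒⊖≋0 (≋-trans (cl-ι _ e P) (≋-trans (⊗-congˡ (IsE⇒leading η P D d' isE D≋))
        (≋-trans (⊗-comm e d') (≋-sym (cl-ι _ d' E)))))))
    same : P ⊗ ι e ≋ E ⊗ D
    same = ≋-trans (⊗-comm P _) (≋-trans (⊖≋0⇒≋ h0) (≋-trans (⊗-comm _ E) (⊗-congˡ (≋-sym D≋))))
    nonzero : ¬ (specP (ι e) ≈P zeroP)
    nonzero z = reg (ι-injective {n} (≋-trans (≋-sym (spec-ι e)) (≋-trans (≋-sym (specP≋ (ι e))) (≋-trans (≈P⇒≋ z) zeroP≋))))

  weight-cancel : ∀ {ε f a w} → Scalar ε a → ¬ a ≋ 0p → HasWeight {n} ε (a ⊗ f) w → HasWeight ε f w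
  weight-cancel {ε} {f} {a} A a≢0 h k lt = ⊗-cancelˡ a≢0 (≋-trans (≋-sym (Z-scalar ε k f lt A)) (≋-trans (h k lt)
    (solve 3 (λ e a f → e :* (a :* f) := a :* (e :* f)) ≋-refl _ a f)))

  spec-up : ∀ k (f : Poly n) → k < n → spec (up k f) ≋ up k (spec f)
  spec-up zero    f lt = ≋-refl
  spec-up (suc k) f lt = ≋-trans (spec-up k _ (ℕₚ.<⇒≤ lt)) (up-cong k (ℕₚ.<⇒≤ lt) (spec-T k f lt))

  spec-down : ∀ a m (f : Poly n) → a ℕ.+ m < n → spec (down a m f) ≋ down a m (spec f)
  spec-down a zero    f lt = ≋-refl
  spec-down a (suc m) f lt = ≋-trans (spec-τ a _ (head-< a lt)) (τ-cong a (head-< a lt) (spec-down (suc a) m f (tail-< a lt)))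

  spec-weight : ∀ {f w} → HasWeight {n} 1 f w → HasWeight 0 (spec f) (λ k → 0 , proj₂ (w k))
  spec-weight {f} {w} h k lt = begin
    Z 0 k (spec f) ≈⟨ down-cong k _ lt′ (≋-trans (spec-ω _) (ω-cong 0 (spec-up k f lt))) ⟨
    down k (n ∸ suc k) (spec (ω 1 (up k f))) ≈⟨ spec-down k _ _ lt′ ⟨
    spec (Z 1 k f) ≈⟨ ⟦⟧-cong spec-hom (h k lt) ⟩
    spec (scp 1 (w k) ⊗ f) ≈⟨ ≋-trans (⊗-homo spec-hom _ f) (⊗-congʳ (spec-sc _ _)) ⟩
    sc 0 (proj₂ (w k)) ⊗ spec f ∎
    where lt′ = ℕₚ.≤-reflexive (suc[k+[n∸suc-k]]≡n lt)

  -- The original denominator may vanish at q = 1. Hence the eigenvalue equations are carried over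
  -- to the regular numerator for generic q, where it can be cancelled, and only then is q put equal
  -- to 1.
  regular-weight : ∀ η E R → IsE {n} η E → RegularAt1 E R → HasWeight 0 (spec (proj₁ R)) (λ k → 0 , κ (toList η) k)
  regular-weight η (P , D) (P' , D') isE@(free , D≢0 , _) (free' , e , _) = spec-weight
    (weight-cancel (xfree-scalar free) (λ z → D≢0 (≋⇒≈P (≋-trans z (≋-sym zeroP≋))))
      (weight-cong 1 D'P≋DP' (weight-scalar 1 (xfree-scalar free') (IsE⇒weight η P D isE))))
    where
    D'P≋DP' : D' ⊗ P ≋ D ⊗ P'
    D'P≋DP' = ≋-trans (⊗-comm D' P) (≋-trans (≋-sym (mulP≋ P D')) (≋-trans (≈P⇒≋ e) (≋-trans (mulP≋ P' D) (⊗-comm P' D))))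

  -- This is s_j (f / g) = f / g with denominators cleared. For a ≠ 0 the symmetric multipliers
  -- cancel; for a = 0 both sides vanish with g.
  proportional⇒s : ∀ {f g : Poly n} j → suc j < n → Proportional f g → s j f ⊗ g ≋ f ⊗ s j g
  proportional⇒s {f} {g} j lt (a , b , sa , sb , e , nz) with ≋0? a
  ... | yes a0 = ≋-trans (⊗-congˡ (nz a0)) (≋-trans (⊗-zeroʳ _) (≋-sym (≋-trans (⊗-congˡ (≋-trans (s-cong j (nz a0)) (0-homo (s-hom j)))) (⊗-zeroʳ f))))
  ... | no a≢0 = ⊗-cancelˡ a≢0 (begin
    a ⊗ (s j f ⊗ g) ≈⟨ ⊗-assoc a _ g ⟨
    (a ⊗ s j f) ⊗ g ≈⟨ ⊗-congʳ e′ ⟩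
    (b ⊗ s j g) ⊗ g ≈⟨ solve 3 (λ b h g → (b :* h) :* g := (b :* g) :* h) ≋-refl b (s j g) g ⟩
    (b ⊗ g) ⊗ s j g ≈⟨ ⊗-congʳ e ⟨
    (a ⊗ f) ⊗ s j g ≈⟨ ⊗-assoc a f _ ⟩
    a ⊗ (f ⊗ s j g) ∎)
    where
    e′ : a ⊗ s j f ≋ b ⊗ s j g
    e′ = ≋-trans (⊗-congʳ (≋-sym (sa j lt))) (≋-trans (≋-sym (s-⊗ j a f)) (≋-trans (s-cong j e)
      (≋-trans (s-⊗ j b g) (⊗-congʳ (sb j lt)))))

  spec-xfree : ∀ {D} j → XFree {n} D → s j (specP D) ≋ specP D
  spec-xfree {D} j free = ≋-trans (s-cong j D≋) (≋-trans (s-ι j _) (≋-sym D≋))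
    where
    D≋ : specP D ≋ ι (spec (proj₁ (xfree⇒ι free)))
    D≋ = ≋-trans (specP≋ D) (≋-trans (⟦⟧-cong spec-hom (proj₂ (xfree⇒ι free))) (spec-ι _))

  quotient-symmetric : ∀ {P₁ D₁ P₂ D₂ : Poly n} → XFree D₁ → XFree D₂ → Proportional (spec P₁) (spec P₂) →
                       IsSymmetric (divF (specF (P₁ , D₁)) (specF (P₂ , D₂)))
  quotient-symmetric {P₁} {D₁} {P₂} {D₂} free₁ free₂ prop (suc j) _ lt = ≋⇒≈P (begin
    mulP (sP (suc j) (mulP f d₂)) (mulP d₁ g) ≈⟨ ≋-trans (mulP≋ _ _) (⊗-cong (s-mul f d₂) (mulP≋ d₁ g)) ⟩
    (s j f ⊗ s j d₂) ⊗ (d₁ ⊗ g) ≈⟨ ⊗-congʳ (⊗-congˡ (spec-xfree j free₂)) ⟩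
    (s j f ⊗ d₂) ⊗ (d₁ ⊗ g) ≈⟨ solve 4 (λ f d e g → (f :* d) :* (e :* g) := (d :* e) :* (f :* g)) ≋-refl (s j f) d₂ d₁ g ⟩
    (d₂ ⊗ d₁) ⊗ (s j f ⊗ g) ≈⟨ ⊗-congˡ cross ⟩
    (d₂ ⊗ d₁) ⊗ (f ⊗ s j g) ≈⟨ solve 4 (λ f d e g → (f :* d) :* (e :* g) := (d :* e) :* (f :* g)) ≋-refl f d₂ d₁ (s j g) ⟨
    (f ⊗ d₂) ⊗ (d₁ ⊗ s j g) ≈⟨ ⊗-congˡ (⊗-congʳ (spec-xfree j free₁)) ⟨
    (f ⊗ d₂) ⊗ (s j d₁ ⊗ s j g) ≈⟨ ≋-trans (mulP≋ _ _) (⊗-cong (mulP≋ f d₂) (s-mul d₁ g)) ⟨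
    mulP (mulP f d₂) (sP (suc j) (mulP d₁ g)) ∎)
    where
    f = specP P₁
    d₁ = specP D₁
    g = specP P₂
    d₂ = specP D₂
    s-mul : ∀ p r → sP (suc j) (mulP p r) ≋ s j p ⊗ s j r
    s-mul p r = ≋-trans (sP≋ j _) (≋-trans (s-cong j (mulP≋ p r)) (s-⊗ j p r))
    cross : s j f ⊗ g ≋ f ⊗ s j g
    cross = ≋-trans (⊗-cong (s-cong j (specP≋ P₁)) (specP≋ P₂)) (≋-trans (proportional⇒s j lt prop)
      (≋-sym (⊗-cong (specP≋ P₁) (s-cong j (specP≋ P₂)))))

  partition-one-dimensional : ∀ (μ : Vec ℕ n) → IsPartition μ → ∀ {f g} →
    HasWeight 0 f (λ k → 0 , κ (toList μ) k) → HasWeight 0 g (λ k → 0 , κ (toList μ) k) → Proportional f g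
  partition-one-dimensional μ part {f} {g} hf hg with κ-runs (blocks (partition⇒AllPairs μ part))
  ... | bs , bs≥ , _ , len , κ≡ = one bs bs≥ (trans len (Vₚ.length-toList μ)) f g (to-runs hf) (to-runs hg)
    where
    to-runs : ∀ {f} → HasWeight 0 f (λ k → 0 , κ (toList μ) k) → HasWeight 0 f (exps (runs 0 bs))
    to-runs {f} h k lt = ≋-trans (h k lt) (≋-reflexive (cong (λ m → sc 0 m ⊗ f) (κ≡ k (subst (k <_) (sym (Vₚ.length-toList μ)) lt))))
    one : ∀ bs → All (1 ≤_) bs → OneDimensional {n} (runs 0 bs)
    one [] _ = run-one-dimensional 0
    one (b ∷ bs) (_ ∷ bs≥) = runs-one-dimensional b bs bs≥

theorem4p17 : (n : ℕ) (φ : ℕ → ℕ) (λ' μ ζ : Vec ℕ n) →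
    WeaklyOrderPreserving φ → IsPartition λ' → IsPartition μ → map φ λ' ≡ μ →
    IsInc λ' φ μ ζ →
    (Einc Eμ : Frac n) → IsE ζ Einc → IsE μ Eμ →
    (∃ λ R → RegularAt1 Einc R) × (∃ λ R → RegularAt1 Eμ R) ×
    (∀ R₁ R₂ → RegularAt1 Einc R₁ → RegularAt1 Eμ R₂ →
    IsSymmetric (divF (specF R₁) (specF R₂)))
theorem4p17 n φ λ' μ ζ mono-φ _ part-μ _ inc Einc Eμ isE-ζ isE-μ =
  regular ζ Einc isE-ζ , regular μ Eμ isE-μ , λ R₁ R₂ r₁ r₂ →
    quotient-symmetric (proj₁ r₁) (proj₁ r₂) (partition-one-dimensional μ part-μ
      (λ k lt → ≋-trans (regular-weight ζ Einc R₁ isE-ζ r₁ k lt)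
        (≋-reflexive (cong (λ m → sc 0 m ⊗ spec (proj₁ R₁)) (sym (κ-inc φ mono-φ λ' μ ζ part-μ inc lt)))))
      (regular-weight μ Eμ R₂ isE-μ r₂))
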